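{- $\mathsf{AM}(2)=\mathsf{AM}$.
   Context: For a positive integer $k$, $\mathsf{AM}(k)$ is the class of languages $L\subseteq\{0,1\}^*$ for which there exist a polynomial $q$ and a probabilistic polynomial-time verifier $V$ such that for all inputs $x\in\{0,1\}^n$: if $x\in L$ there exist functions $b_1,\dots,b_k:\{0,1\}^{q(n)}\to\{0,1\}^{q(n)}$ (depending on $x$) with $\Pr[V(x,y_1,\dots,y_k,b_1(y_1),\dots,b_k(y_k))\text{ accepts}]\ge2/3$, where $y_1,\dots,y_k$ are independent uniformly random strings in $\{0,1\}^{q(n)}$; if $x\notin L$, then for all such functions this probability is at most $1/3$. (Each prover $i$ sees only its own challenge $y_i$.) $\mathsf{AM}=\mathsf{AM}(1)$ is the usual single-prover Arthur–Merlin class. -}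

module Defs where

open import Data.Bool using (Bool; true; false; if_then_else_; _∨_)
open import Data.Nat using (ℕ; zero; suc; _+_; _*_; _^_; _≤_)
open import Data.Fin using (Fin; zero; suc; _≟_)
open import Data.List using (List; []; _∷_; _++_; length; map; concatMap)
open import Data.Nat.ListAction using (sum)
open import Data.Vec using (Vec; []; _∷_; toList)
open import Data.Product using (Σ; _×_; _,_; ∃)
open import Relation.Nullary using (¬_)
open import Relation.Nullary.Decidable using (⌊_⌋)
open import Relation.Binary.PropositionalEquality using (_≡_)

Poly : Set
Poly = List ℕ

eval : Poly → ℕ → ℕ
eval []       n = 0
eval (c ∷ cs) n = c + n * eval cs n

-- Deterministic single-tape Turing machines.
-- Tape alphabet Fin (4 + extra): 0 = blank, 1 = bit 0, 2 = bit 1,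
-- 3 = separator '#', the rest are work symbols.

data Move : Set where
  L R S : Move

record TM : Set where
  field
    extra   : ℕ
    nStates : ℕ
    start   : Fin nStates
    accept  : Fin nStates
    reject  : Fin nStates
    δ       : Fin nStates → Fin (4 + extra) →
              Fin nStates × Fin (4 + extra) × Move

module _ (M : TM) where
  open TM M

  Sym : Set
  Sym = Fin (4 + extra)

  blank sep : Sym
  blank = zero
  sep   = suc (suc (suc zero))

  bitSym : Bool → Sym
  bitSym false = suc zero
  bitSym true  = suc (suc zero)

  -- configuration: state, left part (nearest cell first), head symbol, right part
  record Config : Set where
    constructor cfg
    field
      state : Fin nStates
      left  : List Sym
      head  : Sym
      right : List Sym

  halted : Fin nStates → Bool
  halted q = ⌊ q ≟ accept ⌋ ∨ ⌊ q ≟ reject ⌋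

  move : Move → List Sym → Sym → List Sym → Fin nStates → Config
  move L []      a r q = cfg q [] blank (a ∷ r)
  move L (b ∷ l) a r q = cfg q l b (a ∷ r)
  move R l a []      q = cfg q (a ∷ l) blank []
  move R l a (b ∷ r) q = cfg q (a ∷ l) b r
  move S l a r       q = cfg q l a r

  step : Config → Config
  step (cfg q l a r) with halted q
  ... | true  = cfg q l a r
  ... | false with δ q a
  ...   | (q' , a' , m) = move m l a' r q'

  run : ℕ → Config → Config
  run zero    c = c
  run (suc t) c = run t (step c)

  encode : List (List Bool) → List Sym
  encode []            = []
  encode (w ∷ [])      = map bitSym w
  encode (w ∷ v ∷ ws)  = map bitSym w ++ (sep ∷ encode (v ∷ ws))

  initial : List Sym → Config
  initial []      = cfg start [] blank []
  initial (a ∷ r) = cfg start [] a r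

  stateAfter : List (List Bool) → ℕ → Fin nStates
  stateAfter ws t = Config.state (run t (initial (encode ws)))

  inputLength : List (List Bool) → ℕ
  inputLength ws = length (encode ws)

  RunsInTime : Poly → Set
  RunsInTime p = ∀ ws → halted (stateAfter ws (eval p (inputLength ws))) ≡ true

  acceptsWithin : Poly → List (List Bool) → Bool
  acceptsWithin p ws = ⌊ stateAfter ws (eval p (inputLength ws)) ≟ accept ⌋

allVecs : (n : ℕ) → List (Vec Bool n)
allVecs zero    = [] ∷ []
allVecs (suc n) = concatMap (λ v → (false ∷ v) ∷ (true ∷ v) ∷ []) (allVecs n)

allTuples : (k q : ℕ) → List (Vec (Vec Bool q) k)
allTuples zero    q = [] ∷ []
allTuples (suc k) q =
  concatMap (λ y → map (λ ys → y ∷ ys) (allTuples k q)) (allVecs q)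

toBits : ∀ {n} → Vec Bool n → List Bool
toBits = toList

count : ∀ {A : Set} → (A → Bool) → List A → ℕ
count f xs = sum (map (λ a → if f a then 1 else 0) xs)

vmapFin : ∀ {A B : Set} {k} → (Fin k → A → B) → Vec A k → Vec B k
vmapFin f []       = []
vmapFin f (a ∷ as) = f zero a ∷ vmapFin (λ i → f (suc i)) as

-- AM(k)
-- Verifier V is a polynomial-time TM which receives
--   x # y₁ # … # yₖ # b₁(y₁) # … # bₖ(yₖ) # r
-- where r ∈ {0,1}^{m(n)} are V's own random coins.

Provers : ℕ → ℕ → Set
Provers k q = Fin k → Vec Bool q → Vec Bool q

accCount : (k : ℕ) (V : TM) (p q m : Poly) (x : List Bool) →
           Provers k (eval q (length x)) → ℕ
accCount k V p q m x b =
  count (λ yr → let ys = Data.Product.proj₁ yr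
                    r  = Data.Product.proj₂ yr
                in acceptsWithin V p
                     (x ∷ (map toBits (toList ys)
                           ++ map toBits (toList (vmapFin b ys))
                           ++ (toBits r ∷ []))))
        (concatMap (λ ys → map (λ r → (ys , r)) (allVecs (eval m (length x))))
                   (allTuples k (eval q (length x))))

total : (k : ℕ) (q m : Poly) (x : List Bool) → ℕ
total k q m x = 2 ^ (k * eval q (length x) + eval m (length x))

AM : ℕ → (List Bool → Set) → Set
AM k Lang =
  Σ Poly λ q → Σ Poly λ m → Σ TM λ V → Σ Poly λ p →
    RunsInTime V p ×
    (∀ x → (Lang x → Σ (Provers k (eval q (length x))) λ b →
                    2 * total k q m x ≤ 3 * accCount k V p q m x b)
         × (¬ Lang x → ∀ (b : Provers k (eval q (length x))) →
                    3 * accCount k V p q m x b ≤ total k q m x))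

-- For AM(1) ⊆ AM(2) the verifier ignores the second prover.
--
-- For AM(2) ⊆ AM(1), Arthur sends a sample U of challenges for the first prover and a larger sample W for the second,
-- a single Merlin answers all of them, and Arthur runs the given verifier on all pairs from U × W, for a constant
-- number of independent coin strings, and takes the majority.  For honest answers this majority is correct with high
-- probability by large deviation bounds.  For soundness, fix answers on U.  The best replies of the second prover to
-- them are, up to a small loss, determined by a few randomly chosen elements of U with their answers; hence they come
-- from a family of strategies so small that a union bound over it shows that no answers on U beat the value of the
-- original game by much.  As W is much larger than U, a second union bound, over all answers on U, allows W to replace
-- the set of all challenges.
--
-- The verifiers are written as programs over stacks with explicit running times.  A single-tape machine runs such a
-- program by keeping the i-th stack on the i-th track of its tape, and simulates the given machine with one stack
-- for either side of its head.
module Submission where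

open import Defs
open import Data.Bool using (Bool; true; false; if_then_else_; not; _∨_; T)
open import Data.Empty using (⊥-elim)
open import Data.Fin as Fin using (Fin; zero; suc; #_)
import Data.Fin.Properties as Finₚ
open import Data.List using (List; []; _∷_; _++_; length; map; concat; concatMap; reverse; take; drop; zip; _ʳ++_)
import Data.List.Properties as Listₚ
open import Data.List.Relation.Unary.All as All using (All; []; _∷_)
import Data.List.Relation.Unary.All.Properties as Allₚ
open import Data.List.Relation.Unary.Any using (here; there)
import Data.List.Relation.Unary.Any.Properties as Anyₚ
open import Data.List.Membership.Propositional using (_∈_)
open import Data.List.Membership.Propositional.Properties using (∈-map⁺; ∈-map⁻)
open import Data.Maybe using (Maybe; just; nothing)
open import Data.Nat using (ℕ; zero; suc; _+_; _*_; _∸_; _^_; _≤_; _<_; _≤ᵇ_; _≤?_; z≤n; s≤s; NonZero)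
import Data.Nat as ℕ
open import Data.Nat.Properties
open import Data.Nat.DivMod using (_/_; _%_; /-monoˡ-≤; m*n/n≡m; m/n*n≤m; m%n<n; m≡m%n+[m/n]*n)
import Data.Nat.Tactic.RingSolver as ℕ-Ring
open import Data.Product using (Σ; _×_; _,_; ∃; proj₁; proj₂)
open import Data.Sum using (_⊎_; inj₁; inj₂)
import Data.Sum as Sum
open import Data.Unit using (⊤; tt)
open import Data.Vec as Vec using (Vec; []; _∷_)
import Data.Vec.Properties as Vecₚ
open import Function using (_∘_; id)
open import Relation.Binary.PropositionalEquality
open import Relation.Nullary using (¬_; yes; no)
open import Relation.Nullary.Decidable using (⌊_⌋)

-- Finite types

-- The obstacle is that Merlin sees all of U and W before he answers anything. On U alone there are
-- 2^(q k) possible answers, while k independent challenges concentrate only up to an error 2^(-k/c)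
-- with a constant c, so a direct union bound over the answers on U fails. It has to run over
-- second-prover strategies of short description instead: k₀ = O(q) question-answer pairs, that is 2
-- q k₀ bits, a number that does not grow with k. This family is fixed before U is drawn, and
-- playing a best first prover against each member covers all answers on U at once. For W the direct
-- union bound over the answers on U is affordable, because l may be chosen of order q k. Merlin's
-- answers cannot depend on the verifier's coins, so these call for no union bound and constantly
-- many coin strings suffice. Completeness is the same estimate, applied to the rejecting trials of
-- honest provers. The time bound of a machine concerns every input, so the programs are specified
-- on malformed inputs too.

record Finite (A : Set) : Set where
  field
    card    : ℕ
    enc     : A → Fin card
    dec     : Fin card → A
    -- A retraction is enough: it makes `enc` injective, and surplus codes are harmless as states or
    -- tape symbols.
    dec-enc : ∀ a → dec (enc a) ≡ a

open Finite

enc-injective : ∀ {A} (F : Finite A) {a b} → enc F a ≡ enc F b → a ≡ b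
enc-injective F {a} {b} e = trans (sym (dec-enc F a)) (trans (cong (dec F) e) (dec-enc F b))

fin-retract : ∀ {A B : Set} (f : A → B) (g : B → A) → (∀ a → g (f a) ≡ a) → Finite B → Finite A
fin-retract f g gf F = record
  { card    = card F
  ; enc     = enc F ∘ f
  ; dec     = g ∘ dec F
  ; dec-enc = λ a → trans (cong g (dec-enc F (f a))) (gf a)
  }

fin-Fin : ∀ n → Finite (Fin n)
fin-Fin n = record { card = n ; enc = id ; dec = id ; dec-enc = λ _ → refl }

fin-⊤ : Finite ⊤
fin-⊤ = record { card = 1 ; enc = λ _ → zero ; dec = λ _ → tt ; dec-enc = λ _ → refl }

fin-⊎ : ∀ {A B} → Finite A → Finite B → Finite (A ⊎ B)
fin-⊎ F G = record
  { card    = card F + card G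
  ; enc     = λ x → Fin.join (card F) (card G) (Sum.map (enc F) (enc G) x)
  ; dec     = λ i → Sum.map (dec F) (dec G) (Fin.splitAt (card F) i)
  ; dec-enc = λ x → trans (cong (Sum.map (dec F) (dec G)) (Finₚ.splitAt-join (card F) (card G) (Sum.map (enc F) (enc G) x))) (back x)
  }
  where
  back : ∀ x → Sum.map (dec F) (dec G) (Sum.map (enc F) (enc G) x) ≡ x
  back (inj₁ a) = cong inj₁ (dec-enc F a)
  back (inj₂ b) = cong inj₂ (dec-enc G b)

fin-× : ∀ {A B} → Finite A → Finite B → Finite (A × B)
fin-× F G = record
  { card    = card F * card G
  ; enc     = λ (a , b) → Fin.combine (enc F a) (enc G b)
  ; dec     = λ i → let (j , l) = Fin.remQuot (card G) i in dec F j , dec G l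
  ; dec-enc = λ (a , b) →
      trans (cong (λ (j , l) → dec F j , dec G l) (Finₚ.remQuot-combine (enc F a) (enc G b)))
            (cong₂ _,_ (dec-enc F a) (dec-enc G b))
  }

fin-Bool : Finite Bool
fin-Bool = fin-retract (λ { false → zero ; true → suc zero }) (λ { zero → false ; (suc _) → true })
                       (λ { false → refl ; true → refl }) (fin-Fin 2)

fin-Maybe : ∀ {A} → Finite A → Finite (Maybe A)
fin-Maybe F = fin-retract (λ { nothing → inj₁ tt ; (just a) → inj₂ a }) (λ { (inj₁ _) → nothing ; (inj₂ a) → just a })
                          (λ { nothing → refl ; (just _) → refl }) (fin-⊎ fin-⊤ F)

fin-Vec : ∀ {A} → Finite A → ∀ n → Finite (Vec A n)
fin-Vec F zero    = fin-retract (λ _ → tt) (λ _ → []) (λ { [] → refl }) fin-⊤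
fin-Vec F (suc n) = fin-retract (λ { (a ∷ v) → a , v }) (λ (a , v) → a ∷ v) (λ { (_ ∷ _) → refl })
                                (fin-× F (fin-Vec F n))

fin-Σ-Fin : ∀ n {B : Fin n → Set} → (∀ i → Finite (B i)) → Finite (Σ (Fin n) B)
fin-Σ-Fin zero    G = record { card = 0 ; enc = λ () ; dec = λ () ; dec-enc = λ () }
fin-Σ-Fin (suc n) G = fin-retract
  (λ { (zero , b) → inj₁ b ; (suc i , b) → inj₂ (i , b) })
  (λ { (inj₁ b) → zero , b ; (inj₂ (i , b)) → suc i , b })
  (λ { (zero , _) → refl ; (suc _ , _) → refl })
  (fin-⊎ (G zero) (fin-Σ-Fin n (G ∘ suc)))

-- The first component is replaced by its code in `Fin`. Since the fibre is then the one over
-- `dec (enc a)`, the second component is transported there.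
fin-Σ : ∀ {A} {B : A → Set} → Finite A → (∀ a → Finite (B a)) → Finite (Σ A B)
fin-Σ {A} {B} F G = fin-retract
  (λ (a , b) → enc F a , subst B (sym (dec-enc F a)) b)
  (λ (i , b) → dec F i , b)
  (λ (a , b) → transported (dec-enc F a) b)
  (fin-Σ-Fin (card F) (G ∘ dec F))
  where
  transported : ∀ {a a'} (e : a' ≡ a) (b : B a) → (a' , subst B (sym e) b) ≡ (a , b)
  transported refl b = refl

-- Stack programs

-- Memories with n stacks.  As a nested product a memory has definitional η, so that updates at
-- literal positions of an arbitrary memory compute.
Mem : Set → ℕ → Set
Mem Γ zero    = ⊤
Mem Γ (suc n) = List Γ × Mem Γ n

get : ∀ {Γ n} → Fin n → Mem Γ n → List Γ
get zero    (s , σ) = s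
get (suc i) (s , σ) = get i σ

set : ∀ {Γ n} → Fin n → List Γ → Mem Γ n → Mem Γ n
set zero    v (s , σ) = v , σ
set (suc i) v (s , σ) = s , set i v σ

get-set : ∀ {Γ n} (i : Fin n) v (σ : Mem Γ n) → get i (set i v σ) ≡ v
get-set zero    v σ = refl
get-set (suc i) v (_ , σ) = get-set i v σ

get-set-≢ : ∀ {Γ n} {i j : Fin n} → i ≢ j → ∀ v (σ : Mem Γ n) → get i (set j v σ) ≡ get i σ
get-set-≢ {i = zero}  {zero}  i≢j v σ = ⊥-elim (i≢j refl)
get-set-≢ {i = zero}  {suc j} i≢j v σ = refl
get-set-≢ {i = suc i} {zero}  i≢j v σ = refl
get-set-≢ {i = suc i} {suc j} i≢j v (_ , σ) = get-set-≢ (i≢j ∘ cong suc) v σ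

set-get : ∀ {Γ n} (i : Fin n) (σ : Mem Γ n) → set i (get i σ) σ ≡ σ
set-get zero    σ = refl
set-get (suc i) (s , σ) = cong (s ,_) (set-get i σ)

set-set : ∀ {Γ n} (i : Fin n) u v (σ : Mem Γ n) → set i u (set i v σ) ≡ set i u σ
set-set zero    u v σ = refl
set-set (suc i) u v (s , σ) = cong (s ,_) (set-set i u v σ)

set-comm : ∀ {Γ n} {i j : Fin n} → i ≢ j → ∀ u v (σ : Mem Γ n) → set i u (set j v σ) ≡ set j v (set i u σ)
set-comm {i = zero}  {zero}  i≢j u v σ = ⊥-elim (i≢j refl)
set-comm {i = zero}  {suc j} i≢j u v σ = refl
set-comm {i = suc i} {zero}  i≢j u v σ = refl
set-comm {i = suc i} {suc j} i≢j u v (s , σ) = cong (s ,_) (set-comm (i≢j ∘ cong suc) u v σ)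

emptyMem : ∀ {Γ} n → Mem Γ n
emptyMem zero    = tt
emptyMem (suc n) = [] , emptyMem n

get-emptyMem : ∀ {Γ n} (i : Fin n) → get i (emptyMem {Γ} n) ≡ []
get-emptyMem zero    = refl
get-emptyMem (suc i) = get-emptyMem i

module Program {Γ : Set} (n : ℕ) where

  -- Control depends on data only through popped symbols. Over a finite alphabet every branch is
  -- therefore a finite case distinction, and a program has finitely many positions.
  data Cmd : Set where
    skip : Cmd
    push : Fin n → Γ → Cmd
    pop  : Fin n → (Maybe Γ → Cmd) → Cmd
    _⨾_  : Cmd → Cmd → Cmd
    -- Pops the stack until it is empty or a symbol satisfying the test has been popped.
    loop : Fin n → (Γ → Bool) → (Γ → Cmd) → Cmd

  infixr 5 _⨾_
  infix 4 _⊢_⇒_⟨_⟩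

  -- Big-step semantics in which `weaken` makes the time an upper bound, so that all iterations of a
  -- loop can be given one uniform cost.
  data _⊢_⇒_⟨_⟩ : Cmd → Mem Γ n → Mem Γ n → ℕ → Set where
    skip   : ∀ {σ} → skip ⊢ σ ⇒ σ ⟨ 1 ⟩
    push   : ∀ {i g σ} → push i g ⊢ σ ⇒ set i (g ∷ get i σ) σ ⟨ 1 ⟩
    pop-[] : ∀ {i f σ σ' t} → get i σ ≡ [] → f nothing ⊢ σ ⇒ σ' ⟨ t ⟩ → pop i f ⊢ σ ⇒ σ' ⟨ suc t ⟩
    pop-∷  : ∀ {i f σ σ' t g gs} → get i σ ≡ g ∷ gs → f (just g) ⊢ set i gs σ ⇒ σ' ⟨ t ⟩ →
             pop i f ⊢ σ ⇒ σ' ⟨ suc t ⟩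
    _⨾_    : ∀ {c d σ σ' σ'' t t'} → c ⊢ σ ⇒ σ' ⟨ t ⟩ → d ⊢ σ' ⇒ σ'' ⟨ t' ⟩ → (c ⨾ d) ⊢ σ ⇒ σ'' ⟨ t + t' ⟩
    loop-[] : ∀ {i s f σ} → get i σ ≡ [] → loop i s f ⊢ σ ⇒ σ ⟨ 1 ⟩
    loop-stop : ∀ {i s f σ g gs} → get i σ ≡ g ∷ gs → s g ≡ true → loop i s f ⊢ σ ⇒ set i gs σ ⟨ 1 ⟩
    loop-∷ : ∀ {i s f σ σ' σ'' g gs t t'} → get i σ ≡ g ∷ gs → s g ≡ false →
             f g ⊢ set i gs σ ⇒ σ' ⟨ t ⟩ → loop i s f ⊢ σ' ⇒ σ'' ⟨ t' ⟩ → loop i s f ⊢ σ ⇒ σ'' ⟨ suc (t + t') ⟩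
    weaken : ∀ {c σ σ' t t'} → t ≤ t' → c ⊢ σ ⇒ σ' ⟨ t ⟩ → c ⊢ σ ⇒ σ' ⟨ t' ⟩

  -- Programs as finite control graphs

  data Instr (X : Set) : Set where
    jump : X → Instr X
    push : Fin n → Γ → X → Instr X
    pop  : Fin n → (Maybe Γ → X) → Instr X

  mapI : ∀ {X Y} → (X → Y) → Instr X → Instr Y
  mapI h (jump x)     = jump (h x)
  mapI h (push i g x) = push i g (h x)
  mapI h (pop i f)    = pop i (h ∘ f)

  exec : ∀ {X} → Instr X → Mem Γ n → X × Mem Γ n
  exec (jump x)     σ = x , σ
  exec (push i g x) σ = x , set i (g ∷ get i σ) σ
  exec (pop i f)    σ with get i σ
  ... | []     = f nothing , σ
  ... | g ∷ gs = f (just g) , set i gs σ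

  exec-mapI : ∀ {X Y} (h : X → Y) ins {σ x σ'} → exec ins σ ≡ (x , σ') → exec (mapI h ins) σ ≡ (h x , σ')
  exec-mapI h (jump x)     refl = refl
  exec-mapI h (push i g x) refl = refl
  exec-mapI h (pop i f) {σ} e with get i σ
  exec-mapI h (pop i f) refl | []    = refl
  exec-mapI h (pop i f) refl | _ ∷ _ = refl

  data Steps {P E : Set} (code : P → Instr (P ⊎ E)) : P ⊎ E → Mem Γ n → P ⊎ E → Mem Γ n → ℕ → Set where
    done : ∀ {x σ} → Steps code x σ x σ 0
    more : ∀ {p σ x σ₁ y σ₂ t} → exec (code p) σ ≡ (x , σ₁) → Steps code x σ₁ y σ₂ t →
           Steps code (inj₁ p) σ y σ₂ (suc t)

  steps-++ : ∀ {P E} {code : P → Instr (P ⊎ E)} {x y z σ₁ σ₂ σ₃ t t'} →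
             Steps code x σ₁ y σ₂ t → Steps code y σ₂ z σ₃ t' → Steps code x σ₁ z σ₃ (t + t')
  steps-++ done       r = r
  steps-++ (more e q) r = more e (steps-++ q r)

  steps-map : ∀ {P E P' E'} {code : P → Instr (P ⊎ E)} {code' : P' → Instr (P' ⊎ E')}
              (e : P → P') (h : P ⊎ E → P' ⊎ E') → (∀ p → h (inj₁ p) ≡ inj₁ (e p)) →
              (∀ p → code' (e p) ≡ mapI h (code p)) →
              ∀ {x y σ σ' t} → Steps code x σ y σ' t → Steps code' (h x) σ (h y) σ' t
  steps-map e h he hc done = done
  steps-map {code = code} {code'} e h he hc (more {p} q r) rewrite he p =
    more (trans (cong (λ ins → exec ins _) (hc p)) (exec-mapI h (code p) q)) (steps-map e h he hc r)

  -- A position inside the body of `pop` or `loop` carries the symbol that was popped. This is how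
  -- data enter the finite control.
  Pos : Cmd → Set
  Pos skip         = ⊤
  Pos (push i g)   = ⊤
  Pos (pop i f)    = ⊤ ⊎ Σ (Maybe Γ) (Pos ∘ f)
  Pos (c ⨾ d)      = Pos c ⊎ Pos d
  Pos (loop i s f) = ⊤ ⊎ Σ Γ (Pos ∘ f)

  entry : ∀ c → Pos c
  entry skip         = tt
  entry (push i g)   = tt
  entry (pop i f)    = inj₁ tt
  entry (c ⨾ d)      = inj₁ (entry c)
  entry (loop i s f) = inj₁ tt

  fin-Pos : Finite Γ → ∀ c → Finite (Pos c)
  fin-Pos F skip         = fin-⊤
  fin-Pos F (push i g)   = fin-⊤
  fin-Pos F (pop i f)    = fin-⊎ fin-⊤ (fin-Σ (fin-Maybe F) (λ g → fin-Pos F (f g)))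
  fin-Pos F (c ⨾ d)      = fin-⊎ (fin-Pos F c) (fin-Pos F d)
  fin-Pos F (loop i s f) = fin-⊎ fin-⊤ (fin-Σ F (λ g → fin-Pos F (f g)))

  popExit : ∀ {f : Maybe Γ → Cmd} g → Pos (f g) ⊎ ⊤ → (⊤ ⊎ Σ (Maybe Γ) (Pos ∘ f)) ⊎ ⊤
  popExit g (inj₁ p) = inj₁ (inj₂ (g , p))
  popExit g (inj₂ _) = inj₂ tt

  loopExit : ∀ {f : Γ → Cmd} g → Pos (f g) ⊎ ⊤ → (⊤ ⊎ Σ Γ (Pos ∘ f)) ⊎ ⊤
  loopExit g (inj₁ p) = inj₁ (inj₂ (g , p))
  loopExit g (inj₂ _) = inj₁ (inj₁ tt)

  loopTest : ∀ {f : Γ → Cmd} → (Γ → Bool) → Maybe Γ → (⊤ ⊎ Σ Γ (Pos ∘ f)) ⊎ ⊤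
  loopTest     s nothing  = inj₂ tt
  loopTest {f} s (just g) = if s g then inj₂ tt else inj₁ (inj₂ (g , entry (f g)))

  seqExit : ∀ {c d} → Pos c ⊎ ⊤ → (Pos c ⊎ Pos d) ⊎ ⊤
  seqExit         (inj₁ p) = inj₁ (inj₁ p)
  seqExit {d = d} (inj₂ _) = inj₁ (inj₂ (entry d))

  code : ∀ c → Pos c → Instr (Pos c ⊎ ⊤)
  code skip         _              = jump (inj₂ tt)
  code (push i g)   _              = push i g (inj₂ tt)
  code (pop i f)    (inj₁ _)       = pop i (λ g → inj₁ (inj₂ (g , entry (f g))))
  code (pop i f)    (inj₂ (g , p)) = mapI (popExit {f} g) (code (f g) p)
  code (c ⨾ d)      (inj₁ p)       = mapI (seqExit {c} {d}) (code c p)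
  code (c ⨾ d)      (inj₂ p)       = mapI (Sum.map inj₂ id) (code d p)
  code (loop i s f) (inj₁ _)       = pop i (loopTest {f} s)
  code (loop i s f) (inj₂ (g , p)) = mapI (loopExit {f} g) (code (f g) p)

  exec-pop-[] : ∀ {X} i (f : Maybe Γ → X) σ → get i σ ≡ [] → exec (pop i f) σ ≡ (f nothing , σ)
  exec-pop-[] i f σ e with get i σ
  exec-pop-[] i f σ refl | .[] = refl

  exec-pop-∷ : ∀ {X} i (f : Maybe Γ → X) σ {g gs} → get i σ ≡ g ∷ gs → exec (pop i f) σ ≡ (f (just g) , set i gs σ)
  exec-pop-∷ i f σ e with get i σ
  exec-pop-∷ i f σ refl | .(_ ∷ _) = refl

  code-correct : ∀ {c σ σ' t} → c ⊢ σ ⇒ σ' ⟨ t ⟩ →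
                 ∃ λ u → u ≤ t × Steps (code c) (inj₁ (entry c)) σ (inj₂ tt) σ' u
  code-correct skip = 1 , ≤-refl , more refl done
  code-correct push = 1 , ≤-refl , more refl done
  code-correct (pop-[] {i} {f} {σ} e d) with code-correct d
  ... | u , u≤ , r = suc u , s≤s u≤ ,
        more (exec-pop-[] i _ σ e) (steps-map (λ p → inj₂ (nothing , p)) (popExit {f} nothing) (λ _ → refl) (λ _ → refl) r)
  code-correct (pop-∷ {i} {f} {σ} {g = g} e d) with code-correct d
  ... | u , u≤ , r = suc u , s≤s u≤ ,
        more (exec-pop-∷ i _ σ e) (steps-map (λ p → inj₂ (just g , p)) (popExit {f} (just g)) (λ _ → refl) (λ _ → refl) r)
  code-correct (_⨾_ {c} {d} p q) with code-correct p | code-correct q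
  ... | u , u≤ , r | v , v≤ , r' = u + v , +-mono-≤ u≤ v≤ ,
        steps-++ (steps-map inj₁ (seqExit {c} {d}) (λ _ → refl) (λ _ → refl) r)
                 (steps-map inj₂ (Sum.map inj₂ id) (λ _ → refl) (λ _ → refl) r')
  code-correct (loop-[] {i} {s} {f} {σ} e) = 1 , ≤-refl , more (exec-pop-[] i (loopTest {f} s) σ e) done
  code-correct (loop-stop {i} {s} {f} {σ} {g} {gs} e st) = 1 , ≤-refl ,
        more (trans (exec-pop-∷ i (loopTest {f} s) σ e) (cong (λ b → (if b then _ else _) , set i gs σ) st)) done
  code-correct (loop-∷ {i} {s} {f} {σ} {g = g} {gs} e st p q) with code-correct p | code-correct q
  ... | u , u≤ , r | v , v≤ , r' = suc (u + v) , s≤s (+-mono-≤ u≤ v≤) ,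
        more (trans (exec-pop-∷ i (loopTest {f} s) σ e) (cong (λ b → (if b then _ else _) , set i gs σ) st))
             (steps-++ (steps-map (λ p' → inj₂ (g , p')) (loopExit {f} g) (λ _ → refl) (λ _ → refl) r) r')
  code-correct (weaken t≤ d) with code-correct d
  ... | u , u≤ , r = u , ≤-trans u≤ t≤ , r

-- Compilation of stack programs to Turing machines

run-+ : ∀ (M : TM) s t C → run M (s + t) C ≡ run M t (run M s C)
run-+ M zero    t C = refl
run-+ M (suc s) t C = run-+ M s t (step M C)

run-halted : ∀ (M : TM) t {q l a r} → halted M q ≡ true → run M t (cfg q l a r) ≡ cfg q l a r
run-halted M zero    h = refl
run-halted M (suc t) {q} {l} {a} {r} h = trans (cong (run M t) stuck) (run-halted M t h)
  where
  stuck : step M (cfg q l a r) ≡ cfg q l a r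
  stuck rewrite h = refl

step-δ : ∀ (M : TM) {q l a r q' a' m} → halted M q ≡ false → TM.δ M q a ≡ (q' , a' , m) →
         step M (cfg q l a r) ≡ move M m l a' r q'
step-δ M {q} {l} {a} {r} h e with halted M q
step-δ M {q} {l} {a} {r} h e | false with TM.δ M q a
step-δ M {q} {l} {a} {r} h refl | false | _ = refl

⌊≟⌋-refl : ∀ {n} (i : Fin n) → ⌊ i Fin.≟ i ⌋ ≡ true
⌊≟⌋-refl i with i Fin.≟ i
... | yes _ = refl
... | no ¬e = ⊥-elim (¬e refl)

⌊≟⌋-≢ : ∀ {n} {i j : Fin n} → i ≢ j → ⌊ i Fin.≟ j ⌋ ≡ false
⌊≟⌋-≢ {i = i} {j} i≢j with i Fin.≟ j
... | yes e = ⊥-elim (i≢j e)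
... | no _  = refl

module Compile {Γ : Set} (F : Finite Γ) (k : ℕ) (inp : Fin 3 → Γ) where

  open Program {Γ} (suc k)

  answer : List Γ → Bool
  answer []      = true
  answer (_ ∷ _) = false

  -- The input tape already is track 0 of a memory. Its leftmost symbol is next to the home cell and
  -- hence the bottom of the stack, so programs read the input from its end.
  inputMem : List (Fin 3) → Mem Γ (suc k)
  inputMem w = reverse (map inp w) , emptyMem k

  module _ (c : Cmd) (res : Fin (suc k)) where

    Q : Set
    Q = Pos c ⊎ ⊤

    verdict : Maybe Γ → Q ⊎ Bool
    verdict nothing  = inj₂ true
    verdict (just _) = inj₂ false

    mcode : Q → Instr (Q ⊎ Bool)
    mcode (inj₁ p) = mapI inj₁ (code c p)
    mcode (inj₂ _) = pop res verdict

    -- Each tape cell holds one symbol of every stack, the bottoms being next to the home cell, which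
    -- lies just left of the input and is marked by the Boolean.
    Cell : Set
    Cell = Bool × Vec (Maybe Γ) (suc k)

    abstract
      fin-Cell : Finite Cell
      fin-Cell = fin-× fin-Bool (fin-Vec (fin-Maybe F) (suc k))

    -- `boot` lays the home cell, `main` looks up the instruction there, `seek` walks right to the
    -- first cell that is empty on the track concerned, `grab` stands one cell before it, on the top
    -- symbol or at home, and `back` returns home. The argument is the pending position.
    data Phase : Set where
      halt : Bool → Phase
      boot : Bool → Phase
      main seek grab : Q → Phase
      back : Q ⊎ Bool → Phase

    abstract
      fin-Phase : Finite Phase
      fin-Phase = fin-retract
        (λ { (halt b) → inj₁ (inj₁ b) ; (boot b) → inj₁ (inj₂ b) ; (main q) → inj₂ (inj₁ (inj₁ q))
           ; (seek q) → inj₂ (inj₁ (inj₂ q)) ; (grab q) → inj₂ (inj₂ (inj₁ q)) ; (back x) → inj₂ (inj₂ (inj₂ x)) })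
        (λ { (inj₁ (inj₁ b)) → halt b ; (inj₁ (inj₂ b)) → boot b ; (inj₂ (inj₁ (inj₁ q))) → main q
           ; (inj₂ (inj₁ (inj₂ q))) → seek q ; (inj₂ (inj₂ (inj₁ q))) → grab q ; (inj₂ (inj₂ (inj₂ x))) → back x })
        (λ { (halt _) → refl ; (boot _) → refl ; (main _) → refl ; (seek _) → refl ; (grab _) → refl ; (back _) → refl })
        (fin-⊎ (fin-⊎ fin-Bool fin-Bool) (fin-⊎ (fin-⊎ finQ finQ) (fin-⊎ finQ (fin-⊎ finQ fin-Bool))))
        where
        finQ : Finite Q
        finQ = fin-⊎ (fin-Pos F c) fin-⊤

    open Finite

    goto : Q ⊎ Bool → Phase
    goto (inj₁ q) = main q
    goto (inj₂ b) = halt b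

    home : Cell
    home = true , Vec.replicate (suc k) nothing

    put : Fin (suc k) → Maybe Γ → Cell → Cell
    put i m (b , v) = b , v Vec.[ i ]≔ m

    at : Fin (suc k) → Cell → Maybe Γ
    at i (b , v) = Vec.lookup v i

    seekδ : Q → Instr (Q ⊎ Bool) → Cell → Phase × Maybe Cell × Move
    seekδ q (jump x) a = seek q , nothing , S
    seekδ q (push i g x) a with at i a
    ... | nothing = back x , just (put i (just g) a) , L
    ... | just _  = seek q , nothing , R
    seekδ q (pop i f) a with at i a
    ... | nothing = grab q , nothing , L
    ... | just _  = seek q , nothing , R

    grabδ : Q → Instr (Q ⊎ Bool) → Cell → Phase × Maybe Cell × Move
    grabδ q (pop i f) (true  , v) = goto (f nothing) , nothing , S
    grabδ q (pop i f) (false , v) = back (f (Vec.lookup v i)) , just (false , v Vec.[ i ]≔ nothing) , L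
    grabδ q _ a = grab q , nothing , S

    mainδ : Q → Instr (Q ⊎ Bool) → Phase × Maybe Cell × Move
    mainδ q (jump x) = goto x , nothing , S
    mainδ q _        = seek q , nothing , R

    phaseδ : Phase → Cell → Phase × Maybe Cell × Move
    phaseδ (halt b)     a = halt b , nothing , S
    -- Moving left from the first cell creates a fresh blank one, which becomes the home cell; the
    -- input is not overwritten.
    phaseδ (boot false) a = boot true , nothing , L
    phaseδ (boot true)  a = main (inj₁ (entry c)) , just home , S
    phaseδ (main q)     a = mainδ q (mcode q)
    phaseδ (seek q)     a = seekδ q (mcode q) a
    phaseδ (grab q)     a = grabδ q (mcode q) a
    phaseδ (back x)     (true  , v) = goto x , nothing , S
    phaseδ (back x)     (false , v) = back x , nothing , L

    extra : ℕ
    extra = card fin-Cell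

    -- The four original symbols are read as cells as well, input letters as entries of stack 0 and
    -- the blank as empty on all tracks. Input and unvisited tape are thus valid without
    -- translation; every cell that is written uses an extra symbol.
    view⊎ : Fin 4 ⊎ Fin extra → Cell
    view⊎ (inj₁ zero)    = false , Vec.replicate (suc k) nothing
    view⊎ (inj₁ (suc i)) = false , just (inp i) ∷ Vec.replicate k nothing
    view⊎ (inj₂ a)       = dec fin-Cell a

    view : Fin (4 + extra) → Cell
    view s = view⊎ (Fin.splitAt 4 s)

    repr : Cell → Fin (4 + extra)
    repr a = 4 Fin.↑ʳ enc fin-Cell a

    view-repr : ∀ a → view (repr a) ≡ a
    view-repr a = trans (cong view⊎ (Finₚ.splitAt-↑ʳ 4 extra (enc fin-Cell a))) (dec-enc fin-Cell a)

    overwrite : Maybe Cell → Fin (4 + extra) → Fin (4 + extra)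
    overwrite nothing  s = s
    overwrite (just a) s = repr a

    phase : Phase → Fin (card fin-Phase)
    phase = enc fin-Phase

    finish : Fin (4 + extra) → Phase × Maybe Cell × Move → Fin (card fin-Phase) × Fin (4 + extra) × Move
    finish s (p , w , m) = phase p , overwrite w s , m

    machine : TM
    machine = record
      { extra   = extra
      ; nStates = card fin-Phase
      ; start   = phase (boot false)
      ; accept  = phase (halt true)
      ; reject  = phase (halt false)
      ; δ       = λ q s → finish s (phaseδ (dec fin-Phase q) (view s))
      }

    data Running : Phase → Set where
      boot : ∀ {b} → Running (boot b)
      main : ∀ {q} → Running (main q)
      seek : ∀ {q} → Running (seek q)
      grab : ∀ {q} → Running (grab q)
      back : ∀ {x} → Running (back x)

    running-halted : ∀ {p} → Running p → halted machine (phase p) ≡ false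
    running-halted {p} r = cong₂ _∨_ (⌊≟⌋-≢ (ne true r ∘ enc-injective fin-Phase)) (⌊≟⌋-≢ (ne false r ∘ enc-injective fin-Phase))
      where
      ne : ∀ {p} b → Running p → p ≢ halt b
      ne b () refl

    halt-halted : ∀ b → halted machine (phase (halt b)) ≡ true
    halt-halted true  rewrite ⌊≟⌋-refl (phase (halt true)) = refl
    halt-halted false with ⌊ phase (halt false) Fin.≟ phase (halt true) ⌋
    ... | true  = refl
    ... | false = ⌊≟⌋-refl (phase (halt false))

    Conf : Set
    Conf = Config machine

    infix 4 _⟶[_]_
    record _⟶[_]_ (C : Conf) (t : ℕ) (C' : Conf) : Set where
      constructor reach
      field reached : run machine t C ≡ C'
    open _⟶[_]_

    _▸_ : ∀ {C C' C'' s t} → C ⟶[ s ] C' → C' ⟶[ t ] C'' → C ⟶[ s + t ] C''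
    _▸_ {C} {s = s} {t} (reach p) (reach q) = reach (trans (run-+ machine s t C) (trans (cong (run machine t) p) q))

    _by_ : ∀ {C C' s t} → C ⟶[ s ] C' → s ≡ t → C ⟶[ t ] C'
    p by refl = p

    _to_ : ∀ {C C' C'' s} → C ⟶[ s ] C' → C' ≡ C'' → C ⟶[ s ] C''
    p to refl = p

    step-phase : ∀ p l s r {p' w m} → Running p → phaseδ p (view s) ≡ (p' , w , m) →
                 cfg (phase p) l s r ⟶[ 1 ] move machine m l (overwrite w s) r (phase p')
    step-phase p l s r {p'} {w} {m} rp e = reach (step-δ machine {phase p} {l} {s} {r} (running-halted rp)
      (trans (cong (λ p₀ → finish s (phaseδ p₀ (view s))) (dec-enc fin-Phase p)) (cong (finish s) e)))

    infixr 4 _▸_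

    hd : List (Fin (4 + extra)) → Fin (4 + extra)
    hd []      = zero
    hd (s ∷ _) = s

    tl : List (Fin (4 + extra)) → List (Fin (4 + extra))
    tl []      = []
    tl (_ ∷ r) = r

    move-R : ∀ l s r q → move machine R l s r q ≡ cfg q (s ∷ l) (hd r) (tl r)
    move-R l s []      q = refl
    move-R l s (_ ∷ _) q = refl

    -- The stack is listed from the bottom. That the track is empty on all later cells guarantees
    -- that after a push the next cell again marks the end of the stack.
    data Holds (i : Fin (suc k)) : List (Fin (4 + extra)) → List Γ → Set where
      []  : ∀ {r} → All (λ s → at i (view s) ≡ nothing) r → Holds i r []
      _∷_ : ∀ {s r g gs} → at i (view s) ≡ just g → Holds i r gs → Holds i (s ∷ r) (g ∷ gs)

    Inner : List (Fin (4 + extra)) → Set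
    Inner = All (λ s → proj₁ (view s) ≡ false)

    pushAt : Fin (suc k) → Γ → ℕ → List (Fin (4 + extra)) → List (Fin (4 + extra))
    pushAt i g zero    r       = repr (put i (just g) (view (hd r))) ∷ tl r
    pushAt i g (suc n) []      = []
    pushAt i g (suc n) (s ∷ r) = s ∷ pushAt i g n r

    popAt : Fin (suc k) → ℕ → List (Fin (4 + extra)) → List (Fin (4 + extra))
    popAt i zero    []      = []
    -- `seek` has stepped one cell beyond the top, so that cell is now part of the tape even if it
    -- was not before.
    popAt i zero    (s ∷ r) = repr (put i nothing (view s)) ∷ hd r ∷ tl r
    popAt i (suc n) []      = []
    popAt i (suc n) (s ∷ r) = s ∷ popAt i n r

    holds-hd : ∀ {i r} → Holds i r [] → at i (view (hd r)) ≡ nothing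
    holds-hd {i} ([] [])      = Vecₚ.lookup-replicate i nothing
    holds-hd     ([] (e ∷ _)) = e

    holds-extend : ∀ {i r gs} → Holds i r gs → Holds i (hd r ∷ tl r) gs
    holds-extend {i} ([] [])       = [] (Vecₚ.lookup-replicate i nothing ∷ [])
    holds-extend     ([] (e ∷ es)) = [] (e ∷ es)
    holds-extend     (e ∷ h)       = e ∷ h

    inner-extend : ∀ {r} → Inner r → Inner (hd r ∷ tl r)
    inner-extend []       = refl ∷ []
    inner-extend (e ∷ es) = e ∷ es

    at-put : ∀ i m a → at i (put i m a) ≡ m
    at-put i m (b , v) = Vecₚ.lookup∘update i v m

    at-put-≢ : ∀ {i j} m a → j ≢ i → at j (put i m a) ≡ at j a
    at-put-≢ m (b , v) j≢i = Vecₚ.lookup∘update′ j≢i v m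

    at-repr-put : ∀ i m s → at i (view (repr (put i m (view s)))) ≡ m
    at-repr-put i m s = trans (cong (at i) (view-repr _)) (at-put i m (view s))

    at-repr-put-≢ : ∀ {i j} m s → j ≢ i → at j (view (repr (put i m (view s)))) ≡ at j (view s)
    at-repr-put-≢ {j = j} m s j≢i = trans (cong (at j) (view-repr _)) (at-put-≢ m (view s) j≢i)

    inner-repr-put : ∀ i m s → proj₁ (view s) ≡ false → proj₁ (view (repr (put i m (view s)))) ≡ false
    inner-repr-put i m s e = trans (cong proj₁ (view-repr _)) e

    all-tl : ∀ {P : Fin (4 + extra) → Set} {r} → All P r → All P (tl r)
    all-tl []       = []
    all-tl (_ ∷ es) = es

    pushAt-holds : ∀ {i g r gs} → Holds i r gs → Holds i (pushAt i g (length gs) r) (gs ++ g ∷ [])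
    pushAt-holds {i} {g} {r} ([] es) = at-repr-put i (just g) (hd r) ∷ [] (all-tl es)
    pushAt-holds (e ∷ h) = e ∷ pushAt-holds h

    pushAt-other : ∀ {i j g r hs} n → j ≢ i → Holds j r hs → Holds j (pushAt i g n r) hs
    pushAt-other {j = j} {g} {r} zero j≢i h with holds-extend h
    ... | [] (e ∷ es) = [] (trans (at-repr-put-≢ (just g) (hd r) j≢i) e ∷ es)
    ... | e ∷ h'      = trans (at-repr-put-≢ (just g) (hd r) j≢i) e ∷ h'
    pushAt-other (suc n) j≢i ([] [])       = [] []
    pushAt-other (suc n) j≢i ([] (e ∷ es)) with pushAt-other n j≢i ([] es)
    ... | [] es' = [] (e ∷ es')
    pushAt-other (suc n) j≢i (e ∷ h) = e ∷ pushAt-other n j≢i h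

    pushAt-inner : ∀ {i g r} n → Inner r → Inner (pushAt i g n r)
    pushAt-inner {i} {g} {r} zero es with inner-extend es
    ... | e ∷ es' = inner-repr-put i (just g) (hd r) e ∷ es'
    pushAt-inner (suc n) []       = []
    pushAt-inner (suc n) (e ∷ es) = e ∷ pushAt-inner n es

    popAt-holds : ∀ {i g r} gs → Holds i r (gs ++ g ∷ []) → Holds i (popAt i (length gs) r) gs
    popAt-holds {i} [] (_∷_ {s} e h) with holds-extend h
    ... | [] es = [] (at-repr-put i nothing s ∷ es)
    popAt-holds (_ ∷ gs) (e ∷ h) = e ∷ popAt-holds gs h

    popAt-other : ∀ {i j r hs} n → j ≢ i → Holds j r hs → Holds j (popAt i n r) hs
    popAt-other zero j≢i ([] []) = [] []
    popAt-other zero j≢i ([] (_∷_ {s} e es)) with holds-extend ([] es)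
    ... | [] es' = [] (trans (at-repr-put-≢ nothing s j≢i) e ∷ es')
    popAt-other zero j≢i (_∷_ {s} e h) = trans (at-repr-put-≢ nothing s j≢i) e ∷ holds-extend h
    popAt-other (suc n) j≢i ([] [])       = [] []
    popAt-other (suc n) j≢i ([] (e ∷ es)) with popAt-other n j≢i ([] es)
    ... | [] es' = [] (e ∷ es')
    popAt-other (suc n) j≢i (e ∷ h) = e ∷ popAt-other n j≢i h

    popAt-inner : ∀ {i r} n → Inner r → Inner (popAt i n r)
    popAt-inner zero [] = []
    popAt-inner {i} zero (_∷_ {s} e es) = inner-repr-put i nothing s e ∷ inner-extend es
    popAt-inner (suc n) []       = []
    popAt-inner (suc n) (e ∷ es) = e ∷ popAt-inner n es

    seek-push-empty : ∀ {q i g x l s r} → mcode q ≡ push i g x → at i (view s) ≡ nothing →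
      cfg (phase (seek q)) l s r ⟶[ 1 ] move machine L l (repr (put i (just g) (view s))) r (phase (back x))
    seek-push-empty {q} {i} {g} {x} {l} {s} {r} eq e = step-phase (seek q) l s r seek (lemma (view s) e)
      where
      lemma : ∀ a → at i a ≡ nothing → phaseδ (seek q) a ≡ (back x , just (put i (just g) a) , L)
      lemma a e rewrite eq | e = refl

    seek-push-full : ∀ {q i g x l s r g'} → mcode q ≡ push i g x → at i (view s) ≡ just g' →
      cfg (phase (seek q)) l s r ⟶[ 1 ] cfg (phase (seek q)) (s ∷ l) (hd r) (tl r)
    seek-push-full {q} {i} {g} {x} {l} {s} {r} {g'} eq e =
      step-phase (seek q) l s r seek (lemma (view s) e) to move-R l s r _
      where
      lemma : ∀ a → at i a ≡ just g' → phaseδ (seek q) a ≡ (seek q , nothing , R)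
      lemma a e rewrite eq | e = refl

    seek-pop-empty : ∀ {q i f l s r} → mcode q ≡ pop i f → at i (view s) ≡ nothing →
      cfg (phase (seek q)) l s r ⟶[ 1 ] move machine L l s r (phase (grab q))
    seek-pop-empty {q} {i} {f} {l} {s} {r} eq e = step-phase (seek q) l s r seek (lemma (view s) e)
      where
      lemma : ∀ a → at i a ≡ nothing → phaseδ (seek q) a ≡ (grab q , nothing , L)
      lemma a e rewrite eq | e = refl

    seek-pop-full : ∀ {q i f l s r g'} → mcode q ≡ pop i f → at i (view s) ≡ just g' →
      cfg (phase (seek q)) l s r ⟶[ 1 ] cfg (phase (seek q)) (s ∷ l) (hd r) (tl r)
    seek-pop-full {q} {i} {f} {l} {s} {r} {g'} eq e =
      step-phase (seek q) l s r seek (lemma (view s) e) to move-R l s r _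
      where
      lemma : ∀ a → at i a ≡ just g' → phaseδ (seek q) a ≡ (seek q , nothing , R)
      lemma a e rewrite eq | e = refl

    grab-home : ∀ {q i f l s r} → mcode q ≡ pop i f → proj₁ (view s) ≡ true →
      cfg (phase (grab q)) l s r ⟶[ 1 ] cfg (phase (goto (f nothing))) l s r
    grab-home {q} {i} {f} {l} {s} {r} eq e = step-phase (grab q) l s r grab (lemma (view s) e)
      where
      lemma : ∀ a → proj₁ a ≡ true → phaseδ (grab q) a ≡ (goto (f nothing) , nothing , S)
      lemma (.true , _) refl rewrite eq = refl

    grab-inner : ∀ {q i f g l s r} → mcode q ≡ pop i f → proj₁ (view s) ≡ false → at i (view s) ≡ just g →
      cfg (phase (grab q)) l s r ⟶[ 1 ] move machine L l (repr (put i nothing (view s))) r (phase (back (f (just g))))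
    grab-inner {q} {i} {f} {g} {l} {s} {r} eq e₁ e₂ = step-phase (grab q) l s r grab (lemma (view s) e₁ e₂)
      where
      lemma : ∀ a → proj₁ a ≡ false → at i a ≡ just g →
              phaseδ (grab q) a ≡ (back (f (just g)) , just (put i nothing a) , L)
      lemma (.false , v) refl e rewrite eq | e = refl

    back-home : ∀ {x l s r} → proj₁ (view s) ≡ true →
      cfg (phase (back x)) l s r ⟶[ 1 ] cfg (phase (goto x)) l s r
    back-home {x} {l} {s} {r} e = step-phase (back x) l s r back (lemma (view s) e)
      where
      lemma : ∀ a → proj₁ a ≡ true → phaseδ (back x) a ≡ (goto x , nothing , S)
      lemma (.true , _) refl = refl

    back-inner : ∀ {x l s r} → proj₁ (view s) ≡ false →
      cfg (phase (back x)) l s r ⟶[ 1 ] move machine L l s r (phase (back x))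
    back-inner {x} {l} {s} {r} e = step-phase (back x) l s r back (lemma (view s) e)
      where
      lemma : ∀ a → proj₁ a ≡ false → phaseδ (back x) a ≡ (back x , nothing , L)
      lemma (.false , _) refl = refl

    -- Each symbol of the stack is passed once on the way out and once on the way back, hence two
    -- time steps per symbol.
    walk-push : ∀ {q i g x gs r} → mcode q ≡ push i g x → Holds i r gs → Inner r → ∀ l s →
                cfg (phase (seek q)) (s ∷ l) (hd r) (tl r) ⟶[ suc (2 * length gs) ]
                cfg (phase (back x)) l s (pushAt i g (length gs) r)
    walk-push eq h@([] _) ir l s = seek-push-empty eq (holds-hd h)
    walk-push {gs = _ ∷ gs} {s' ∷ r} eq (e ∷ h) (ei ∷ ir) l s =
      (seek-push-full eq e ▸ walk-push eq h ir (s ∷ l) s' ▸ back-inner ei) by there-and-back (length gs)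
      where
      there-and-back : ∀ n → 1 + (suc (2 * n) + 1) ≡ suc (2 * suc n)
      there-and-back = ℕ-Ring.solve-∀

    walk-pop : ∀ {q i f g r} gs → mcode q ≡ pop i f → Holds i r (gs ++ g ∷ []) → Inner r → ∀ l s →
               cfg (phase (seek q)) (s ∷ l) (hd r) (tl r) ⟶[ 3 + 2 * length gs ]
               cfg (phase (back (f (just g)))) l s (popAt i (length gs) r)
    walk-pop [] eq (e ∷ h@([] _)) (ei ∷ ir) l s =
      seek-pop-full eq e ▸ seek-pop-empty eq (holds-hd h) ▸ grab-inner eq ei e
    walk-pop {r = s' ∷ r} (_ ∷ gs) eq (e ∷ h) (ei ∷ ir) l s =
      (seek-pop-full eq e ▸ walk-pop gs eq h ir (s ∷ l) s' ▸ back-inner ei) by there-and-back (length gs)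
      where
      there-and-back : ∀ n → 1 + (3 + 2 * n + 1) ≡ 3 + 2 * suc n
      there-and-back = ℕ-Ring.solve-∀

    record Rep (r : List (Fin (4 + extra))) (σ : Mem Γ (suc k)) : Set where
      field
        inner : Inner r
        holds : ∀ i → Holds i r (reverse (get i σ))
    open Rep

    homeS : Fin (4 + extra)
    homeS = repr home

    homeS-home : proj₁ (view homeS) ≡ true
    homeS-home = cong proj₁ (view-repr home)

    atHome : Q ⊎ Bool → List (Fin (4 + extra)) → Conf
    atHome x r = cfg (phase (goto x)) [] homeS r

    main-seek : ∀ {q r} → (∀ a → phaseδ (main q) a ≡ (seek q , nothing , R)) →
      atHome (inj₁ q) r ⟶[ 1 ] cfg (phase (seek q)) (homeS ∷ []) (hd r) (tl r)
    main-seek {q} {r} e = step-phase (main q) [] homeS r main (e (view homeS)) to move-R [] homeS r _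

    main-push : ∀ {q i g x} → mcode q ≡ push i g x → ∀ a → phaseδ (main q) a ≡ (seek q , nothing , R)
    main-push eq a rewrite eq = refl

    main-pop : ∀ {q i f} → mcode q ≡ pop i f → ∀ a → phaseδ (main q) a ≡ (seek q , nothing , R)
    main-pop eq a rewrite eq = refl

    main-jump : ∀ {q x r} → mcode q ≡ jump x → atHome (inj₁ q) r ⟶[ 1 ] atHome x r
    main-jump {q} {x} {r} eq = step-phase (main q) [] homeS r main lemma
      where
      lemma : phaseδ (main q) (view homeS) ≡ (goto x , nothing , S)
      lemma rewrite eq = refl

    Simulated : ∀ (x : Q ⊎ Bool) → List (Fin (4 + extra)) → Q ⊎ Bool → Mem Γ (suc k) → ℕ → Set
    Simulated x r y σ' t = ∃ λ r' → Rep r' σ' × ∃ λ u → u ≤ t × atHome x r ⟶[ u ] atHome y r'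

    simulate-instr : ∀ {r σ x σ' h} q → (∀ i → length (get i σ) ≤ h) → Rep r σ → exec (mcode q) σ ≡ (x , σ') →
                     Simulated (inj₁ q) r x σ' (6 + 2 * h)
    simulate-instr {r} {σ} {h = h} q b ρ e with mcode q in eq
    simulate-instr {r} {σ} q b ρ refl | jump x =
      r , ρ , 1 , s≤s z≤n , main-jump eq
    simulate-instr {r} {σ} {h = h} q b ρ refl | push i g x =
      pushAt i g n r ,
      record { inner = pushAt-inner n (inner ρ) ; holds = held } ,
      1 + (suc (2 * n) + 1) ,
      bound ,
      main-seek (main-push eq) ▸ walk-push eq (holds ρ i) (inner ρ) [] homeS ▸ back-home homeS-home
      where
      n = length (reverse (get i σ))
      bound : 1 + (suc (2 * n) + 1) ≤ 6 + 2 * h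
      bound = ≤-trans (s≤s (≤-reflexive (+-comm (suc (2 * n)) 1)))
              (+-mono-≤ {3} {6} (s≤s (s≤s (s≤s z≤n))) (*-monoʳ-≤ 2 (≤-trans (≤-reflexive (Listₚ.length-reverse (get i σ))) (b i))))
      held : ∀ j → Holds j (pushAt i g n r) (reverse (get j (set i (g ∷ get i σ) σ)))
      held j with j Fin.≟ i
      ... | yes refl = subst (Holds j (pushAt j g n r))
                             (sym (trans (cong reverse (get-set j (g ∷ get j σ) σ)) (Listₚ.unfold-reverse g (get j σ))))
                             (pushAt-holds (holds ρ j))
      ... | no j≢i   = subst (Holds j (pushAt i g n r)) (sym (cong reverse (get-set-≢ j≢i (g ∷ get i σ) σ)))
                             (pushAt-other n j≢i (holds ρ j))
    simulate-instr {r} {σ} {h = h} q b ρ e | pop i f with get i σ in gi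
    simulate-instr {r} {σ} {h = h} q b ρ refl | pop i f | [] =
      hd r ∷ tl r ,
      record { inner = inner-extend (inner ρ) ; holds = λ j → holds-extend (holds ρ j) } ,
      3 , s≤s (s≤s (s≤s z≤n)) ,
      main-seek (main-pop eq) ▸ seek-pop-empty eq (holds-hd empty) ▸ grab-home eq homeS-home
      where
      empty : Holds i r []
      empty = subst (Holds i r ∘ reverse) gi (holds ρ i)
    simulate-instr {r} {σ} {h = h} q b ρ refl | pop i f | g ∷ gs =
      popAt i n r ,
      record { inner = popAt-inner n (inner ρ) ; holds = held } ,
      1 + (3 + 2 * n + 1) ,
      bound ,
      main-seek (main-pop eq) ▸ walk-pop (reverse gs) eq full (inner ρ) [] homeS ▸ back-home homeS-home
      where
      n = length (reverse gs)
      n<h : suc n ≤ h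
      n<h = ≤-trans (≤-reflexive (trans (cong suc (Listₚ.length-reverse gs)) (sym (cong length gi)))) (b i)
      bound : 1 + (3 + 2 * n + 1) ≤ 6 + 2 * h
      bound = ≤-trans (s≤s (≤-reflexive (+-comm (3 + 2 * n) 1)))
              (+-mono-≤ {5} {6} (s≤s (s≤s (s≤s (s≤s (s≤s z≤n))))) (*-monoʳ-≤ 2 (≤-trans (n≤1+n n) n<h)))
      full : Holds i r (reverse gs ++ g ∷ [])
      full = subst (Holds i r) (trans (cong reverse gi) (Listₚ.unfold-reverse g gs)) (holds ρ i)
      held : ∀ j → Holds j (popAt i n r) (reverse (get j (set i gs σ)))
      held j with j Fin.≟ i
      ... | yes refl = subst (Holds j (popAt j n r)) (sym (cong reverse (get-set j gs σ))) (popAt-holds (reverse gs) full)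
      ... | no j≢i   = subst (Holds j (popAt i n r)) (sym (cong reverse (get-set-≢ j≢i gs σ))) (popAt-other n j≢i (holds ρ j))

    set-length : ∀ {σ : Mem Γ (suc k)} {h v} i → (∀ j → length (get j σ) ≤ h) → length v ≤ suc h →
                 ∀ j → length (get j (set i v σ)) ≤ suc h
    set-length {σ} {h} {v} i b bv j with j Fin.≟ i
    ... | yes refl = ≤-trans (≤-reflexive (cong length (get-set j v σ))) bv
    ... | no j≢i   = ≤-trans (≤-reflexive (cong length (get-set-≢ j≢i v σ))) (≤-trans (b j) (n≤1+n h))

    exec-length : ∀ {X : Set} {σ σ' : Mem Γ (suc k)} {x : X} {h} (ins : Instr X) → (∀ i → length (get i σ) ≤ h) →
                  exec ins σ ≡ (x , σ') → ∀ i → length (get i σ') ≤ suc h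
    exec-length {h = h} (jump x) b refl i = ≤-trans (b i) (n≤1+n h)
    exec-length {σ = σ} (push i g x) b refl = set-length {σ} i b (s≤s (b i))
    exec-length {σ = σ} {h = h} (pop i f) b e with get i σ in gi
    exec-length {σ = σ} {h = h} (pop i f) b refl | [] = λ j → ≤-trans (b j) (n≤1+n h)
    exec-length {σ = σ} {h = h} (pop i f) b refl | g ∷ gs = set-length {σ} i b
      (≤-trans (n≤1+n _) (≤-trans (≤-reflexive (sym (cong length gi))) (≤-trans (b i) (n≤1+n h))))

    -- A step raises a stack by at most one, so all heights stay below `h + t`, and every
    -- instruction is a round trip over at most that many cells.
    simulate : ∀ {x y r σ σ' t h} → (∀ i → length (get i σ) ≤ h) → Rep r σ → Steps mcode x σ y σ' t →
               Simulated x r y σ' (t * (6 + 2 * (h + t)))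
    simulate {r = r} b ρ done = r , ρ , 0 , z≤n , reach refl
    simulate {r = r} {h = h} b ρ (more {p} {t = t} e s) with simulate-instr p b ρ e
    ... | r₁ , ρ₁ , u₁ , u₁≤ , run₁ with simulate (exec-length (mcode p) b e) ρ₁ s
    ... | r₂ , ρ₂ , u₂ , u₂≤ , run₂ = r₂ , ρ₂ , u₁ + u₂ ,
          +-mono-≤ (≤-trans u₁≤ (+-monoʳ-≤ 6 (*-monoʳ-≤ 2 (m≤m+n h (suc t)))))
                   (≤-trans u₂≤ (*-monoʳ-≤ t (+-monoʳ-≤ 6 (*-monoʳ-≤ 2 (≤-reflexive (sym (+-suc h t))))))) ,
          (run₁ ▸ run₂)

    rawSym : Fin 3 → Fin (4 + extra)
    rawSym i = suc i Fin.↑ˡ extra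

    view-raw : ∀ i → view (rawSym i) ≡ (false , just (inp i) ∷ Vec.replicate k nothing)
    view-raw i = cong view⊎ (Finₚ.splitAt-↑ˡ 4 (suc i) extra)

    inputTape : List (Fin 3) → List (Fin (4 + extra))
    inputTape w = hd (map rawSym w) ∷ tl (map rawSym w)

    inputRep : ∀ w → Rep (inputTape w) (inputMem w)
    inputRep w = record { inner = inner-extend (inner₀ w) ; holds = λ i → holds-extend (holds₀ i) }
      where
      inner₀ : ∀ w → Inner (map rawSym w)
      inner₀ []      = []
      inner₀ (i ∷ w) = cong proj₁ (view-raw i) ∷ inner₀ w
      bottom : ∀ w → Holds zero (map rawSym w) (map inp w)
      bottom []      = [] []
      bottom (i ∷ w) = cong (at zero) (view-raw i) ∷ bottom w
      others : ∀ j w → All (λ s → at (suc j) (view s) ≡ nothing) (map rawSym w)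
      others j []      = []
      others j (i ∷ w) = trans (cong (at (suc j)) (view-raw i)) (Vecₚ.lookup-replicate j nothing) ∷ others j w
      holds₀ : ∀ i → Holds i (map rawSym w) (reverse (get i (inputMem w)))
      holds₀ zero    = subst (Holds zero _) (sym (Listₚ.reverse-involutive (map inp w))) (bottom w)
      holds₀ (suc j) = subst (Holds (suc j) _ ∘ reverse) (sym (get-emptyMem j)) ([] (others j w))

    boot-run : ∀ w → initial machine (map rawSym w) ⟶[ 2 ] atHome (inj₁ (inj₁ (entry c))) (inputTape w)
    boot-run []      = step-phase (boot false) _ _ _ boot refl ▸ step-phase (boot true) _ _ _ boot refl
    boot-run (i ∷ w) = step-phase (boot false) _ _ _ boot refl ▸ step-phase (boot true) _ _ _ boot refl

    exec-verdict : ∀ σ → ∃ λ σ' → exec (pop res verdict) σ ≡ (inj₂ (answer (get res σ)) , σ')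
    exec-verdict σ with get res σ
    ... | []     = _ , refl
    ... | _ ∷ _  = _ , refl

    -- Two steps boot the machine; the extra program step is the final pop that turns emptiness of
    -- `res` into acceptance.
    runtime : ℕ → ℕ → ℕ
    runtime N t = 2 + (t + 1) * (6 + 2 * (N + (t + 1)))

    machine-run : ∀ {w σ' t} → c ⊢ inputMem w ⇒ σ' ⟨ t ⟩ → ∀ {u} → runtime (length w) t ≤ u →
                  Config.state (run machine u (initial machine (map rawSym w))) ≡ phase (halt (answer (get res σ')))
    machine-run {w} {σ'} {t} d {u} ≤u with code-correct d
    ... | v , v≤t , s with exec-verdict σ'
    ... | σ'' , ev with simulate {h = length w} lengths (inputRep w)
                       (steps-++ (steps-map {code' = mcode} inj₁ inj₁ (λ _ → refl) (λ _ → refl) s) (more ev done))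
      where
      lengths : ∀ i → length (get i (inputMem w)) ≤ length w
      lengths zero    = ≤-reflexive (trans (Listₚ.length-reverse (map inp w)) (Listₚ.length-map inp w))
      lengths (suc i) = ≤-trans (≤-reflexive (cong length (get-emptyMem i))) z≤n
    ... | r' , _ , a , a≤ , ρ = cong Config.state (reached
          (((boot-run w ▸ ρ) ▸ reach (run-halted machine (u ∸ (2 + a)) (halt-halted (answer (get res σ')))))
             by m+[n∸m]≡n le))
      where
      v≤ : v + 1 ≤ t + 1
      v≤ = +-monoˡ-≤ 1 v≤t
      le : 2 + a ≤ u
      le = ≤-trans (+-monoʳ-≤ 2 (≤-trans a≤ (*-mono-≤ v≤ (+-monoʳ-≤ 6 (*-monoʳ-≤ 2 (+-monoʳ-≤ (length w) v≤)))))) ≤u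

-- Finite sums and tuples

∑ : ∀ {𝔸 : Set} → List 𝔸 → (𝔸 → ℕ) → ℕ
∑ []       f = 0
∑ (x ∷ xs) f = f x + ∑ xs f

infix 5 ∑
syntax ∑ xs (λ x → e) = ∑[ x ∈ xs ] e

𝟙 : Bool → ℕ
𝟙 b = if b then 1 else 0

private variable
  𝔸 𝔹 : Set

∑-mono-∈ : ∀ (xs : List 𝔸) {f g : 𝔸 → ℕ} → (∀ {x} → x ∈ xs → f x ≤ g x) → ∑ xs f ≤ ∑ xs g
∑-mono-∈ []       h = z≤n
∑-mono-∈ (x ∷ xs) h = +-mono-≤ (h (here refl)) (∑-mono-∈ xs (h ∘ there))

∑-mono : ∀ (xs : List 𝔸) {f g : 𝔸 → ℕ} → (∀ x → f x ≤ g x) → ∑ xs f ≤ ∑ xs g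
∑-mono xs h = ∑-mono-∈ xs (λ {x} _ → h x)

∑-cong-∈ : ∀ (xs : List 𝔸) {f g : 𝔸 → ℕ} → (∀ {x} → x ∈ xs → f x ≡ g x) → ∑ xs f ≡ ∑ xs g
∑-cong-∈ []       h = refl
∑-cong-∈ (x ∷ xs) h = cong₂ _+_ (h (here refl)) (∑-cong-∈ xs (h ∘ there))

∑-cong : ∀ (xs : List 𝔸) {f g : 𝔸 → ℕ} → (∀ x → f x ≡ g x) → ∑ xs f ≡ ∑ xs g
∑-cong xs h = ∑-cong-∈ xs (λ {x} _ → h x)

∑-+ : ∀ (xs : List 𝔸) (f g : 𝔸 → ℕ) → ∑ xs (λ x → f x + g x) ≡ ∑ xs f + ∑ xs g
∑-+ []       f g = refl
∑-+ (x ∷ xs) f g rewrite ∑-+ xs f g = interchange (f x) (g x) (∑ xs f) (∑ xs g)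
  where
  interchange : ∀ a b c d → a + b + (c + d) ≡ a + c + (b + d)
  interchange = ℕ-Ring.solve-∀

∑-*ˡ : ∀ c (xs : List 𝔸) (f : 𝔸 → ℕ) → ∑ xs (λ x → c * f x) ≡ c * ∑ xs f
∑-*ˡ c []       f = sym (*-zeroʳ c)
∑-*ˡ c (x ∷ xs) f rewrite ∑-*ˡ c xs f = sym (*-distribˡ-+ c (f x) (∑ xs f))

∑-*ʳ : ∀ c (xs : List 𝔸) (f : 𝔸 → ℕ) → ∑ xs (λ x → f x * c) ≡ ∑ xs f * c
∑-*ʳ c xs f = trans (∑-cong xs (λ x → *-comm (f x) c)) (trans (∑-*ˡ c xs f) (*-comm c (∑ xs f)))

∑-const : ∀ (xs : List 𝔸) c → ∑ xs (λ _ → c) ≡ length xs * c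
∑-const []       c = refl
∑-const (x ∷ xs) c = cong (c +_) (∑-const xs c)

∑-bound : ∀ (xs : List 𝔸) {f : 𝔸 → ℕ} {c} → (∀ {x} → x ∈ xs → f x ≤ c) → ∑ xs f ≤ length xs * c
∑-bound xs {c = c} h = ≤-trans (∑-mono-∈ xs h) (≤-reflexive (∑-const xs c))

∑-++ : ∀ (xs ys : List 𝔸) (f : 𝔸 → ℕ) → ∑ (xs ++ ys) f ≡ ∑ xs f + ∑ ys f
∑-++ []       ys f = refl
∑-++ (x ∷ xs) ys f rewrite ∑-++ xs ys f = sym (+-assoc (f x) (∑ xs f) (∑ ys f))

∑-map : ∀ (h : 𝔸 → 𝔹) (xs : List 𝔸) (f : 𝔹 → ℕ) → ∑ (map h xs) f ≡ ∑ xs (f ∘ h)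
∑-map h []       f = refl
∑-map h (x ∷ xs) f = cong (f (h x) +_) (∑-map h xs f)

∑-concatMap : ∀ (h : 𝔸 → List 𝔹) (xs : List 𝔸) (f : 𝔹 → ℕ) → ∑ (concatMap h xs) f ≡ ∑ xs (λ x → ∑ (h x) f)
∑-concatMap h []       f = refl
∑-concatMap h (x ∷ xs) f = trans (∑-++ (h x) (concatMap h xs) f) (cong (∑ (h x) f +_) (∑-concatMap h xs f))

∑-swap : ∀ (xs : List 𝔸) (ys : List 𝔹) (f : 𝔸 → 𝔹 → ℕ) →
         ∑ xs (λ x → ∑ ys (f x)) ≡ ∑ ys (λ y → ∑ xs (λ x → f x y))
∑-swap []       ys f = sym (trans (∑-const ys 0) (*-zeroʳ (length ys)))
∑-swap (x ∷ xs) ys f = trans (cong (∑ ys (f x) +_) (∑-swap xs ys f)) (sym (∑-+ ys (f x) _))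

∑-term : ∀ {xs : List 𝔸} {x} (f : 𝔸 → ℕ) → x ∈ xs → f x ≤ ∑ xs f
∑-term {xs = x ∷ xs} f (here refl) = m≤m+n (f x) (∑ xs f)
∑-term {xs = y ∷ xs} f (there p)   = ≤-trans (∑-term f p) (m≤n+m (∑ xs f) (f y))

tuples : List 𝔸 → ℕ → List (List 𝔸)
tuples Ω zero    = [] ∷ []
tuples Ω (suc n) = concatMap (λ x → map (x ∷_) (tuples Ω n)) Ω

∑-tuples-suc : ∀ (Ω : List 𝔸) n (F : List 𝔸 → ℕ) →
               ∑ (tuples Ω (suc n)) F ≡ ∑[ x ∈ Ω ] ∑[ t ∈ tuples Ω n ] F (x ∷ t)
∑-tuples-suc Ω n F = trans (∑-concatMap _ Ω F) (∑-cong Ω (λ x → ∑-map (x ∷_) (tuples Ω n) F))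

∑-tuples-+ : ∀ (Ω : List 𝔸) m n (F : List 𝔸 → ℕ) →
             ∑ (tuples Ω (m + n)) F ≡ ∑[ s ∈ tuples Ω m ] ∑[ t ∈ tuples Ω n ] F (s ++ t)
∑-tuples-+ Ω zero    n F = sym (+-identityʳ _)
∑-tuples-+ Ω (suc m) n F = trans (∑-tuples-suc Ω (m + n) F)
  (trans (∑-cong Ω (λ x → ∑-tuples-+ Ω m n (F ∘ (x ∷_)))) (sym (∑-tuples-suc Ω m _)))

∑-tuples-* : ∀ (Ω : List 𝔸) k q (F : List 𝔸 → ℕ) →
             ∑ (tuples Ω (k * q)) F ≡ ∑[ t ∈ tuples (tuples Ω q) k ] F (concat t)
∑-tuples-* Ω zero    q F = refl
∑-tuples-* Ω (suc k) q F = trans (∑-tuples-+ Ω q (k * q) F)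
  (trans (∑-cong (tuples Ω q) (λ s → ∑-tuples-* Ω k q (F ∘ (s ++_)))) (sym (∑-tuples-suc (tuples Ω q) k _)))

length-∑ : ∀ (xs : List 𝔸) → length xs ≡ ∑ xs (λ _ → 1)
length-∑ xs = sym (trans (∑-const xs 1) (*-identityʳ (length xs)))

length-tuples : ∀ (Ω : List 𝔸) n → length (tuples Ω n) ≡ length Ω ^ n
length-tuples Ω zero    = refl
length-tuples Ω (suc n) = begin
  length (tuples Ω (suc n))            ≡⟨ length-∑ (tuples Ω (suc n)) ⟩
  ∑ (tuples Ω (suc n)) (λ _ → 1)       ≡⟨ ∑-tuples-suc Ω n _ ⟩
  ∑ Ω (λ _ → ∑ (tuples Ω n) (λ _ → 1)) ≡⟨ ∑-const Ω _ ⟩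
  length Ω * ∑ (tuples Ω n) (λ _ → 1)  ≡⟨ cong (length Ω *_) (trans (sym (length-∑ (tuples Ω n))) (length-tuples Ω n)) ⟩
  length Ω * length Ω ^ n              ∎
  where open ≡-Reasoning

∈-concatMap⁻ : ∀ {h : 𝔸 → List 𝔹} xs {y} → y ∈ concatMap h xs → ∃ λ x → x ∈ xs × y ∈ h x
∈-concatMap⁻ {h = h} (x ∷ xs) p with Anyₚ.++⁻ (h x) p
... | inj₁ q = x , here refl , q
... | inj₂ q with ∈-concatMap⁻ xs q
... | x' , x'∈ , y∈ = x' , there x'∈ , y∈

∈-tuples⁻ : ∀ {Ω : List 𝔸} n {t} → t ∈ tuples Ω n → All (_∈ Ω) t × length t ≡ n
∈-tuples⁻ zero (here refl) = [] , refl
∈-tuples⁻ {Ω = Ω} (suc n) p with ∈-concatMap⁻ Ω p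
... | x , x∈ , q with ∈-map⁻ (x ∷_) q
... | t , t∈ , refl with ∈-tuples⁻ n t∈
... | a , l = (x∈ ∷ a) , cong suc l

∈-concatMap⁺ : ∀ {h : 𝔸 → List 𝔹} {xs x y} → x ∈ xs → y ∈ h x → y ∈ concatMap h xs
∈-concatMap⁺ {h = h} (here refl) q = Anyₚ.++⁺ˡ q
∈-concatMap⁺ {h = h} {x' ∷ _} (there p) q = Anyₚ.++⁺ʳ (h x') (∈-concatMap⁺ p q)

∈-tuples⁺ : ∀ {Ω : List 𝔸} {t} → All (_∈ Ω) t → t ∈ tuples Ω (length t)
∈-tuples⁺ []       = here refl
∈-tuples⁺ (x∈ ∷ a) = ∈-concatMap⁺ x∈ (∈-map⁺ _ (∈-tuples⁺ a))

∏ : List 𝔸 → (𝔸 → ℕ) → ℕ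
∏ []       w = 1
∏ (x ∷ xs) w = w x * ∏ xs w

-- The entries of a uniform tuple are independent, so the mean of a product of weights is a power.
-- This is what the exponential-moment method rests on.
∑∏ : ∀ (Ω : List 𝔸) n (w : 𝔸 → ℕ) → ∑[ t ∈ tuples Ω n ] ∏ t w ≡ ∑ Ω w ^ n
∑∏ Ω zero    w = refl
∑∏ Ω (suc n) w = begin
  ∑ (tuples Ω (suc n)) (λ t → ∏ t w)                ≡⟨ ∑-tuples-suc Ω n _ ⟩
  ∑ Ω (λ x → ∑ (tuples Ω n) (λ t → w x * ∏ t w))    ≡⟨ ∑-cong Ω (λ x → ∑-*ˡ (w x) (tuples Ω n) _) ⟩
  ∑ Ω (λ x → w x * ∑ (tuples Ω n) (λ t → ∏ t w))    ≡⟨ ∑-*ʳ _ Ω w ⟩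
  ∑ Ω w * ∑ (tuples Ω n) (λ t → ∏ t w)              ≡⟨ cong (∑ Ω w *_) (∑∏ Ω n w) ⟩
  ∑ Ω w * ∑ Ω w ^ n                                 ∎
  where open ≡-Reasoning

-- Large deviations

^-distribʳ-* : ∀ l m n → (m * n) ^ l ≡ m ^ l * n ^ l
^-distribʳ-* zero    m n = refl
^-distribʳ-* (suc l) m n rewrite ^-distribʳ-* l m n = interchange m n (m ^ l) (n ^ l)
  where
  interchange : ∀ a b c d → a * b * (c * d) ≡ a * c * (b * d)
  interchange = ℕ-Ring.solve-∀

-- Of the gap 2/G between the mean and the threshold, one half pays for rounding f to multiples of D/G and the other
-- for the exponential tail.
DeviationBound : (G c a : ℕ) → Set₁
DeviationBound G c a = ∀ {A : Set} (Ω : List A) (f : A → ℕ) (D : ℕ) ⦃ D≢0 : NonZero D ⦄ →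
  (∀ {x} → x ∈ Ω → f x ≤ D) → G * ∑ Ω f ≤ a * (D * length Ω) → ∀ h →
  (∑[ t ∈ tuples Ω (c * h) ] 𝟙 ((2 + a) * (D * (c * h)) ≤ᵇ G * ∑ t f)) * 2 ^ h ≤ length Ω ^ (c * h)

module LargeDeviation (M d G c a b : ℕ) ⦃ M≢0 : NonZero M ⦄ ⦃ G≢0 : NonZero G ⦄ ⦃ c≢0 : NonZero c ⦄
                      (G≡ : suc a + b ≡ G) where

  -- Exponential moments in integers. The tilt is N/M, and an entry of size j is given the weight
  -- `N ^ j * M ^ (G ∸ j)`, which is (N/M)^j scaled by M^G. By convexity `X` bounds G times the mean
  -- weight if the mean of j is at most a; `V` is the weight at j = `suc a`.
  N e X V : ℕ
  N = M + d
  e = N ^ G ∸ M ^ G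
  X = G * M ^ G + a * e
  V = N ^ suc a * M ^ b

  M≤N : M ≤ N
  M≤N = m≤m+n M d

  N≢0 : NonZero N
  N≢0 = ℕ.>-nonZero (≤-trans (ℕ.>-nonZero⁻¹ M) M≤N)

  -- Replacing the j factors N = M + d by M one after the other costs at most `d * N ^ (i + j)` each
  -- time.
  power-step : ∀ i j → M ^ suc i * N ^ j ≤ M ^ (suc i + j) + j * (d * N ^ (i + j))
  power-step i zero = ≤-trans (≤-reflexive (trans (*-identityʳ _) (cong (M ^_) (sym (+-identityʳ (suc i)))))) (m≤m+n _ _)
  power-step i (suc j) = begin
    M ^ suc i * N ^ suc j                                ≡⟨ expand M d (M ^ i) (N ^ j) ⟩
    M ^ suc (suc i) * N ^ j + d * (M ^ suc i * N ^ j)    ≤⟨ +-mono-≤ (power-step (suc i) j) (*-monoʳ-≤ d (*-monoˡ-≤ (N ^ j) (^-monoˡ-≤ (suc i) M≤N))) ⟩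
    (M ^ (suc (suc i) + j) + j * (d * N ^ (suc i + j))) + d * (N ^ suc i * N ^ j)
      ≡⟨ cong (λ u → (M ^ (suc (suc i) + j) + j * (d * N ^ (suc i + j))) + d * u) (sym (^-distribˡ-+-* N (suc i) j)) ⟩
    (M ^ (suc (suc i) + j) + j * (d * N ^ (suc i + j))) + d * N ^ (suc i + j)
      ≡⟨ collect (M ^ (suc (suc i) + j)) j (d * N ^ (suc i + j)) ⟩
    M ^ (suc (suc i) + j) + suc j * (d * N ^ (suc i + j)) ≡⟨ cong (λ u → M ^ suc u + suc j * (d * N ^ u)) (sym (+-suc i j)) ⟩
    M ^ (suc i + suc j) + suc j * (d * N ^ (i + suc j))  ∎
    where
    open ≤-Reasoning
    expand : ∀ m d p q → m * p * ((m + d) * q) ≡ m * (m * p) * q + d * (m * p * q)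
    expand = ℕ-Ring.solve-∀
    collect : ∀ u j v → u + j * v + v ≡ u + suc j * v
    collect = ℕ-Ring.solve-∀

  -- Convexity of j ↦ N^j M^(s-j) on 0 ≤ j ≤ s, where s = i + j.
  chord : ∀ i j → (i + j) * (N ^ j * M ^ i) ≤ i * M ^ (i + j) + j * N ^ (i + j)
  chord zero    j = ≤-reflexive (cong (j *_) (*-identityʳ _))
  chord (suc i) j = begin
    suc (i + j) * (N ^ j * M ^ suc i)                        ≡⟨ expand (i + j) (N ^ j) M (M ^ i) ⟩
    M * ((i + j) * (N ^ j * M ^ i)) + M ^ suc i * N ^ j      ≤⟨ +-mono-≤ (*-monoʳ-≤ M (chord i j)) (power-step i j) ⟩
    M * (i * M ^ (i + j) + j * N ^ (i + j)) + (M ^ suc (i + j) + j * (d * N ^ (i + j)))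
      ≡⟨ collect i j M d (M ^ (i + j)) (N ^ (i + j)) ⟩
    suc i * M ^ suc (i + j) + j * N ^ suc (i + j)            ∎
    where
    open ≤-Reasoning
    expand : ∀ s q m p → suc s * (q * (m * p)) ≡ m * (s * (q * p)) + m * p * q
    expand = ℕ-Ring.solve-∀
    collect : ∀ i j m d p q → m * (i * p + j * q) + (m * p + j * (d * q)) ≡ suc i * (m * p) + j * ((m + d) * q)
    collect = ℕ-Ring.solve-∀

  w : ℕ → ℕ
  w j = N ^ j * M ^ (G ∸ j)

  w-chord : ∀ {j} → j ≤ G → G * w j ≤ G * M ^ G + j * e
  w-chord {j} j≤G = begin
    G * w j                                    ≡⟨ cong (_* w j) (sym i+j) ⟩
    (G ∸ j + j) * w j                          ≤⟨ chord (G ∸ j) j ⟩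
    (G ∸ j) * M ^ (G ∸ j + j) + j * N ^ (G ∸ j + j)  ≡⟨ cong (λ u → (G ∸ j) * M ^ u + j * N ^ u) i+j ⟩
    (G ∸ j) * M ^ G + j * N ^ G                ≡⟨ cong (λ u → (G ∸ j) * M ^ G + j * u) (sym (m+[n∸m]≡n (^-monoˡ-≤ G M≤N))) ⟩
    (G ∸ j) * M ^ G + j * (M ^ G + e)          ≡⟨ collect (G ∸ j) j (M ^ G) e ⟩
    (G ∸ j + j) * M ^ G + j * e                ≡⟨ cong (λ u → u * M ^ G + j * e) i+j ⟩
    G * M ^ G + j * e                          ∎
    where
    open ≤-Reasoning
    i+j : G ∸ j + j ≡ G
    i+j = m∸n+n≡m j≤G
    collect : ∀ i j p e → i * p + j * (p + e) ≡ (i + j) * p + j * e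
    collect = ℕ-Ring.solve-∀

  w-shift : ∀ {j} → j ≤ G → w j * M ^ j ≡ N ^ j * M ^ G
  w-shift {j} j≤G = trans (*-assoc (N ^ j) _ _)
    (cong (N ^ j *_) (trans (sym (^-distribˡ-+-* M (G ∸ j) j)) (cong (M ^_) (m∸n+n≡m j≤G))))

  V-shift : V * M ^ suc a ≡ N ^ suc a * M ^ G
  V-shift = trans (*-assoc (N ^ suc a) _ _)
    (cong (N ^ suc a *_) (trans (sym (^-distribˡ-+-* M b (suc a))) (cong (M ^_) (trans (+-comm b (suc a)) G≡))))

  -- With s = `∑ t φ` the product of weights is N^s M^(G l - s); multiplying by M^s avoids the
  -- subtraction.
  ∏-shift : ∀ {A : Set} (φ : A → ℕ) t → All (λ x → φ x ≤ G) t →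
            ∏ t (w ∘ φ) * M ^ ∑ t φ ≡ N ^ ∑ t φ * (M ^ G) ^ length t
  ∏-shift φ []      []       = refl
  ∏-shift φ (x ∷ t) (p ∷ ps) = begin
    w (φ x) * ∏ t (w ∘ φ) * M ^ (φ x + ∑ t φ)          ≡⟨ cong (w (φ x) * ∏ t (w ∘ φ) *_) (^-distribˡ-+-* M (φ x) (∑ t φ)) ⟩
    w (φ x) * ∏ t (w ∘ φ) * (M ^ φ x * M ^ ∑ t φ)      ≡⟨ swap (w (φ x)) _ _ _ ⟩
    w (φ x) * M ^ φ x * (∏ t (w ∘ φ) * M ^ ∑ t φ)      ≡⟨ cong₂ _*_ (w-shift p) (∏-shift φ t ps) ⟩
    N ^ φ x * M ^ G * (N ^ ∑ t φ * (M ^ G) ^ length t) ≡⟨ swap (N ^ φ x) _ _ _ ⟩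
    N ^ φ x * N ^ ∑ t φ * (M ^ G * (M ^ G) ^ length t) ≡⟨ cong (_* (M ^ G * (M ^ G) ^ length t)) (sym (^-distribˡ-+-* N (φ x) (∑ t φ))) ⟩
    N ^ (φ x + ∑ t φ) * (M ^ G) ^ suc (length t)       ∎
    where
    open ≡-Reasoning
    swap : ∀ p q r s → p * q * (r * s) ≡ p * r * (q * s)
    swap = ℕ-Ring.solve-∀

  ∏-lower : ∀ {A : Set} (φ : A → ℕ) t → All (λ x → φ x ≤ G) t → suc a * length t ≤ ∑ t φ →
            V ^ length t ≤ ∏ t (w ∘ φ)
  ∏-lower φ t ps s₀≤s = *-cancelʳ-≤ _ _ (M ^ ∑ t φ) ⦃ m^n≢0 M (∑ t φ) ⦄ (begin
    V ^ l * M ^ s                          ≡⟨ cong (λ u → V ^ l * M ^ u) (sym s≡) ⟩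
    V ^ l * M ^ (suc a * l + r)            ≡⟨ cong (V ^ l *_) (^-distribˡ-+-* M (suc a * l) r) ⟩
    V ^ l * (M ^ (suc a * l) * M ^ r)      ≤⟨ *-monoʳ-≤ (V ^ l) (*-monoʳ-≤ (M ^ (suc a * l)) (^-monoˡ-≤ r M≤N)) ⟩
    V ^ l * (M ^ (suc a * l) * N ^ r)      ≡⟨ cong (λ u → V ^ l * (u * N ^ r)) (sym (^-*-assoc M (suc a) l)) ⟩
    V ^ l * ((M ^ suc a) ^ l * N ^ r)      ≡⟨ trans (sym (*-assoc (V ^ l) _ _)) (cong (_* N ^ r) (sym (^-distribʳ-* l V (M ^ suc a)))) ⟩
    (V * M ^ suc a) ^ l * N ^ r            ≡⟨ cong (λ u → u ^ l * N ^ r) V-shift ⟩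
    (N ^ suc a * M ^ G) ^ l * N ^ r        ≡⟨ cong (_* N ^ r) (^-distribʳ-* l (N ^ suc a) (M ^ G)) ⟩
    (N ^ suc a) ^ l * (M ^ G) ^ l * N ^ r  ≡⟨ swap ((N ^ suc a) ^ l) _ _ ⟩
    (N ^ suc a) ^ l * N ^ r * (M ^ G) ^ l  ≡⟨ cong (λ u → u * N ^ r * (M ^ G) ^ l) (^-*-assoc N (suc a) l) ⟩
    N ^ (suc a * l) * N ^ r * (M ^ G) ^ l  ≡⟨ cong (_* (M ^ G) ^ l) (sym (^-distribˡ-+-* N (suc a * l) r)) ⟩
    N ^ (suc a * l + r) * (M ^ G) ^ l      ≡⟨ cong (λ u → N ^ u * (M ^ G) ^ l) s≡ ⟩
    N ^ s * (M ^ G) ^ l                    ≡⟨ sym (∏-shift φ t ps) ⟩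
    ∏ t (w ∘ φ) * M ^ s                    ∎)
    where
    open ≤-Reasoning
    l s r : ℕ
    l = length t
    s = ∑ t φ
    r = s ∸ suc a * l
    s≡ : suc a * l + r ≡ s
    s≡ = m+[n∸m]≡n s₀≤s
    swap : ∀ p q r → p * q * r ≡ p * r * q
    swap = ℕ-Ring.solve-∀

  -- Bernoulli's inequality for (1 + 1/c)^m, cleared of denominators.
  bernoulli : ∀ m → (c + m) * c ^ m ≤ c * suc c ^ m
  bernoulli zero    = ≤-reflexive (cong (_* 1) (+-identityʳ c))
  bernoulli (suc m) = begin
    (c + suc m) * (c * c ^ m)                   ≤⟨ m≤m+n _ (m * c ^ m) ⟩
    (c + suc m) * (c * c ^ m) + m * c ^ m       ≡⟨ expand c m (c ^ m) ⟩
    suc c * ((c + m) * c ^ m)                   ≤⟨ *-monoʳ-≤ (suc c) (bernoulli m) ⟩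
    suc c * (c * suc c ^ m)                     ≡⟨ swap (suc c) c (suc c ^ m) ⟩
    c * (suc c * suc c ^ m)                     ∎
    where
    open ≤-Reasoning
    expand : ∀ c m p → (c + suc m) * (c * p) + m * p ≡ suc c * ((c + m) * p)
    expand = ℕ-Ring.solve-∀
    swap : ∀ p q r → p * (q * r) ≡ q * (p * r)
    swap = ℕ-Ring.solve-∀

  -- Because (1 + 1/c)^c is at least 2, a factor 1 + 1/c gained per sample becomes one bit of
  -- confidence for every c samples.
  doubling : 2 * c ^ c ≤ suc c ^ c
  doubling = *-cancelˡ-≤ c (≤-trans (≤-reflexive (expand c (c ^ c))) (bernoulli c))
    where
    expand : ∀ c p → c * (2 * p) ≡ (c + c) * p
    expand = ℕ-Ring.solve-∀

  module _ (gap : suc c * X ≤ c * (G * V)) {A : Set} (Ω : List A) where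

    private
      n = length Ω

    -- Markov's inequality for the product weight: its mean is at most (X/G)^l, while a tuple above
    -- the threshold weighs at least V^l. By `gap` the quotient is at most (c/(c+1))^l, and
    -- `doubling` turns this into 2^(-h) since l = c h.
    tail-ℕ : (φ : A → ℕ) → (∀ {x} → x ∈ Ω → φ x ≤ G) → ∑ Ω φ ≤ a * n → ∀ h →
             (∑[ t ∈ tuples Ω (c * h) ] 𝟙 (suc a * (c * h) ≤ᵇ ∑ t φ)) * 2 ^ h ≤ n ^ (c * h)
    tail-ℕ φ φ≤G mean h = *-cancelʳ-≤ _ _ (c ^ l) ⦃ m^n≢0 c l ⦄ (begin
      bad * 2 ^ h * c ^ l             ≡⟨ *-assoc bad (2 ^ h) (c ^ l) ⟩
      bad * (2 ^ h * c ^ l)           ≡⟨ cong (λ u → bad * (2 ^ h * u)) (sym (^-*-assoc c c h)) ⟩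
      bad * (2 ^ h * (c ^ c) ^ h)     ≡⟨ cong (bad *_) (sym (^-distribʳ-* h 2 (c ^ c))) ⟩
      bad * (2 * c ^ c) ^ h           ≤⟨ *-monoʳ-≤ bad (^-monoˡ-≤ h doubling) ⟩
      bad * (suc c ^ c) ^ h           ≡⟨ cong (bad *_) (^-*-assoc (suc c) c h) ⟩
      bad * suc c ^ l                 ≤⟨ *-cancelʳ-≤ _ _ (Y ^ l) ⦃ m^n≢0 Y l ⦃ Y≢0 ⦄ ⦄ scaled ⟩
      n ^ l * c ^ l                   ∎)
      where
      open ≤-Reasoning
      l bad Y : ℕ
      l = c * h
      bad = ∑[ t ∈ tuples Ω l ] 𝟙 (suc a * l ≤ᵇ ∑ t φ)
      Y = G * V
      Y≢0 : NonZero Y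
      Y≢0 = m*n≢0 G V ⦃ G≢0 ⦄ ⦃ m*n≢0 (N ^ suc a) (M ^ b) ⦃ m^n≢0 N (suc a) ⦃ N≢0 ⦄ ⦄ ⦃ m^n≢0 M b ⦄ ⦄
      weight : G * ∑ Ω (w ∘ φ) ≤ n * X
      weight = begin
        G * ∑ Ω (w ∘ φ)                           ≡⟨ sym (∑-*ˡ G Ω (w ∘ φ)) ⟩
        ∑ Ω (λ x → G * w (φ x))                   ≤⟨ ∑-mono-∈ Ω (λ x∈ → w-chord (φ≤G x∈)) ⟩
        ∑ Ω (λ x → G * M ^ G + φ x * e)           ≡⟨ ∑-+ Ω _ _ ⟩
        ∑ Ω (λ _ → G * M ^ G) + ∑ Ω (λ x → φ x * e) ≡⟨ cong₂ _+_ (∑-const Ω _) (∑-*ʳ e Ω φ) ⟩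
        n * (G * M ^ G) + ∑ Ω φ * e               ≤⟨ +-monoʳ-≤ (n * (G * M ^ G)) (*-monoˡ-≤ e mean) ⟩
        n * (G * M ^ G) + a * n * e               ≡⟨ collect n (G * M ^ G) a e ⟩
        n * X                                     ∎
        where
        collect : ∀ n p a e → n * p + a * n * e ≡ n * (p + a * e)
        collect = ℕ-Ring.solve-∀
      markov : bad * V ^ l ≤ ∑ Ω (w ∘ φ) ^ l
      markov = begin
        bad * V ^ l                                           ≡⟨ sym (∑-*ʳ (V ^ l) (tuples Ω l) _) ⟩
        ∑ (tuples Ω l) (λ t → 𝟙 (suc a * l ≤ᵇ ∑ t φ) * V ^ l)  ≤⟨ ∑-mono-∈ (tuples Ω l) pointwise ⟩
        ∑ (tuples Ω l) (λ t → ∏ t (w ∘ φ))                    ≡⟨ ∑∏ Ω l (w ∘ φ) ⟩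
        ∑ Ω (w ∘ φ) ^ l                                       ∎
        where
        pointwise : ∀ {t} → t ∈ tuples Ω l → 𝟙 (suc a * l ≤ᵇ ∑ t φ) * V ^ l ≤ ∏ t (w ∘ φ)
        pointwise {t} t∈ with suc a * l ≤ᵇ ∑ t φ in eq | ∈-tuples⁻ l t∈
        ... | false | _ = z≤n
        ... | true  | mem , len = begin
          V ^ l + 0        ≡⟨ +-identityʳ (V ^ l) ⟩
          V ^ l            ≡⟨ cong (V ^_) (sym len) ⟩
          V ^ length t     ≤⟨ ∏-lower φ t (All.map φ≤G mem)
                                (subst (λ u → suc a * u ≤ ∑ t φ) (sym len) (≤ᵇ⇒≤ _ _ (subst T (sym eq) tt))) ⟩
          ∏ t (w ∘ φ)      ∎
      scaled : bad * suc c ^ l * Y ^ l ≤ n ^ l * c ^ l * Y ^ l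
      scaled = begin
        bad * suc c ^ l * Y ^ l                    ≡⟨ cong (bad * suc c ^ l *_) (^-distribʳ-* l G V) ⟩
        bad * suc c ^ l * (G ^ l * V ^ l)          ≡⟨ rearrange bad (suc c ^ l) (G ^ l) (V ^ l) ⟩
        suc c ^ l * (G ^ l * (bad * V ^ l))        ≤⟨ *-monoʳ-≤ (suc c ^ l) (*-monoʳ-≤ (G ^ l) markov) ⟩
        suc c ^ l * (G ^ l * ∑ Ω (w ∘ φ) ^ l)      ≡⟨ cong (suc c ^ l *_) (sym (^-distribʳ-* l G (∑ Ω (w ∘ φ)))) ⟩
        suc c ^ l * (G * ∑ Ω (w ∘ φ)) ^ l          ≤⟨ *-monoʳ-≤ (suc c ^ l) (^-monoˡ-≤ l weight) ⟩
        suc c ^ l * (n * X) ^ l                    ≡⟨ sym (^-distribʳ-* l (suc c) (n * X)) ⟩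
        (suc c * (n * X)) ^ l                      ≡⟨ cong (_^ l) (swap (suc c) n X) ⟩
        (n * (suc c * X)) ^ l                      ≤⟨ ^-monoˡ-≤ l (*-monoʳ-≤ n gap) ⟩
        (n * (c * Y)) ^ l                          ≡⟨ trans (^-distribʳ-* l n (c * Y)) (cong (n ^ l *_) (^-distribʳ-* l c Y)) ⟩
        n ^ l * (c ^ l * Y ^ l)                    ≡⟨ sym (*-assoc (n ^ l) (c ^ l) (Y ^ l)) ⟩
        n ^ l * c ^ l * Y ^ l                      ∎
        where
        rearrange : ∀ p q r s → p * q * (r * s) ≡ q * (r * (p * s))
        rearrange = ℕ-Ring.solve-∀
        swap : ∀ p q r → p * (q * r) ≡ q * (p * r)
        swap = ℕ-Ring.solve-∀

    tail : (f : A → ℕ) (D : ℕ) ⦃ D≢0 : NonZero D ⦄ → (∀ {x} → x ∈ Ω → f x ≤ D) →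
           G * ∑ Ω f ≤ a * (D * n) → ∀ h →
           (∑[ t ∈ tuples Ω (c * h) ] 𝟙 ((2 + a) * (D * (c * h)) ≤ᵇ G * ∑ t f)) * 2 ^ h ≤ n ^ (c * h)
    tail f D f≤D mean h = ≤-trans (*-monoˡ-≤ (2 ^ h) (∑-mono-∈ (tuples Ω l) pointwise)) (tail-ℕ φ φ≤G φ-mean h)
      where
      open ≤-Reasoning
      l : ℕ
      l = c * h
      φ : A → ℕ
      φ x = G * f x / D
      φ≤G : ∀ {x} → x ∈ Ω → φ x ≤ G
      φ≤G x∈ = ≤-trans (/-monoˡ-≤ D (*-monoʳ-≤ G (f≤D x∈))) (≤-reflexive (m*n/n≡m G D))
      φ-mean : ∑ Ω φ ≤ a * n
      φ-mean = *-cancelʳ-≤ _ _ D (begin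
        ∑ Ω φ * D               ≡⟨ sym (∑-*ʳ D Ω φ) ⟩
        ∑ Ω (λ x → φ x * D)     ≤⟨ ∑-mono Ω (λ x → m/n*n≤m (G * f x) D) ⟩
        ∑ Ω (λ x → G * f x)     ≡⟨ ∑-*ˡ G Ω f ⟩
        G * ∑ Ω f               ≤⟨ mean ⟩
        a * (D * n)             ≡⟨ swap a D n ⟩
        a * n * D               ∎)
        where
        swap : ∀ a d n → a * (d * n) ≡ a * n * d
        swap = ℕ-Ring.solve-∀
      rounded : ∀ t → G * ∑ t f ≤ (∑ t φ + length t) * D
      rounded []      = ≤-reflexive (*-zeroʳ G)
      rounded (x ∷ t) = begin
        G * (f x + ∑ t f)                                ≡⟨ *-distribˡ-+ G (f x) (∑ t f) ⟩
        G * f x + G * ∑ t f                              ≡⟨ cong (_+ G * ∑ t f) (m≡m%n+[m/n]*n (G * f x) D) ⟩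
        (G * f x) % D + φ x * D + G * ∑ t f              ≤⟨ +-mono-≤ (+-monoˡ-≤ (φ x * D) (<⇒≤ (m%n<n (G * f x) D))) (rounded t) ⟩
        D + φ x * D + (∑ t φ + length t) * D             ≡⟨ collect D (φ x) (∑ t φ) (length t) ⟩
        (φ x + ∑ t φ + suc (length t)) * D               ∎
        where
        collect : ∀ d p q r → d + p * d + (q + r) * d ≡ (p + q + suc r) * d
        collect = ℕ-Ring.solve-∀
      pointwise : ∀ {t} → t ∈ tuples Ω l →
                  𝟙 ((2 + a) * (D * l) ≤ᵇ G * ∑ t f) ≤ 𝟙 (suc a * l ≤ᵇ ∑ t φ)
      pointwise {t} t∈ with (2 + a) * (D * l) ≤ᵇ G * ∑ t f in eq
      ... | false = z≤n
      ... | true with suc a * l ≤ᵇ ∑ t φ in eq'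
      ...   | true = ≤-refl
      ...   | false = ⊥-elim (subst T eq' (≤⇒≤ᵇ {suc a * l} {∑ t φ} (+-cancelʳ-≤ l _ _ (*-cancelʳ-≤ _ _ D (begin
              (suc a * l + l) * D      ≡⟨ expand a l D ⟩
              (2 + a) * (D * l)        ≤⟨ ≤ᵇ⇒≤ _ _ (subst T (sym eq) tt) ⟩
              G * ∑ t f                ≤⟨ rounded t ⟩
              (∑ t φ + length t) * D   ≡⟨ cong (λ u → (∑ t φ + u) * D) (proj₂ (∈-tuples⁻ l t∈)) ⟩
              (∑ t φ + l) * D          ∎)))))
        where
        expand : ∀ a l d → (suc a * l + l) * d ≡ (2 + a) * (d * l)
        expand = ℕ-Ring.solve-∀

  deviation : T (suc c * X ≤ᵇ c * (G * V)) → DeviationBound G c a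
  deviation gap Ω = tail (≤ᵇ⇒≤ _ _ gap) Ω

-- The tilt N/M = 1 + 1/3600 is nearly optimal for G = 120, and the four instances then hold numerically with
-- c = 7200.  The definitions are abstract to keep these literals from being unfolded.
abstract
  samples : ℕ
  samples = 7200

  samples≢0 : NonZero samples
  samples≢0 = _

  deviation₄₀ : DeviationBound 120 samples 40
  deviation₄₀ = LargeDeviation.deviation 3600 1 120 7200 40 79 refl tt

  deviation₄₇ : DeviationBound 120 samples 47
  deviation₄₇ = LargeDeviation.deviation 3600 1 120 7200 47 72 refl tt

  deviation₄₉ : DeviationBound 120 samples 49
  deviation₄₉ = LargeDeviation.deviation 3600 1 120 7200 49 70 refl tt

  deviation₅₈ : DeviationBound 120 samples 58
  deviation₅₈ = LargeDeviation.deviation 3600 1 120 7200 58 61 refl tt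

-- Subsampling a free game

module _ {A : Set} (a₀ : A) (f : A → ℕ) where

  argmax : List A → A
  argmax []       = a₀
  argmax (x ∷ xs) = if f (argmax xs) ≤ᵇ f x then x else argmax xs

  argmax-∈ : ∀ {xs ys} → a₀ ∈ ys → (∀ {x} → x ∈ xs → x ∈ ys) → argmax xs ∈ ys
  argmax-∈ {[]}     a₀∈ sub = a₀∈
  argmax-∈ {x ∷ xs} a₀∈ sub with f (argmax xs) ≤ᵇ f x
  ... | true  = sub (here refl)
  ... | false = argmax-∈ {xs} a₀∈ (sub ∘ there)

  argmax-max : ∀ {xs x} → x ∈ xs → f x ≤ f (argmax xs)
  argmax-max {y ∷ xs} x∈ with f (argmax xs) ≤ᵇ f y in eq
  argmax-max {y ∷ xs} (here refl) | true  = ≤-refl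
  argmax-max {y ∷ xs} (there x∈)  | true  = ≤-trans (argmax-max x∈) (≤ᵇ⇒≤ _ _ (subst T (sym eq) tt))
  argmax-max {y ∷ xs} (here refl) | false with ≤-total (f (argmax xs)) (f y)
  ... | inj₁ le = ⊥-elim (subst T eq (≤⇒≤ᵇ le))
  ... | inj₂ ge = ge
  argmax-max {y ∷ xs} (there x∈)  | false = argmax-max x∈

𝟙-true : ∀ {b} → T b → 𝟙 b ≡ 1
𝟙-true {true} _ = refl

𝟙≤1 : ∀ b → 𝟙 b ≤ 1
𝟙≤1 true  = ≤-refl
𝟙≤1 false = z≤n

𝟙-≤ᵇ-mono : ∀ {m n m' n'} → (m ≤ n → m' ≤ n') → 𝟙 (m ≤ᵇ n) ≤ 𝟙 (m' ≤ᵇ n')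
𝟙-≤ᵇ-mono {m} {n} h with m ≤ᵇ n in eq
... | false = z≤n
... | true  = ≤-reflexive (sym (𝟙-true (≤⇒≤ᵇ (h (≤ᵇ⇒≤ _ _ (subst T (sym eq) tt))))))

𝟙-≤ᵇ-0 : ∀ m n → 𝟙 (m ≤ᵇ n) ≡ 0 → n < m
𝟙-≤ᵇ-0 m n e with m ≤? n
... | yes m≤n = ⊥-elim (1+n≢0 (trans (sym (𝟙-true (≤⇒≤ᵇ m≤n))) e))
... | no m≰n  = ≰⇒> m≰n

union-bound : ∀ {A B : Set} (xs : List A) (ys : List B) (p : A → B → ℕ) {h m N} → length ys ≤ 2 ^ m →
              (∀ {y} → y ∈ ys → (∑[ x ∈ xs ] p x y) * 2 ^ (m + h) ≤ N) →
              (∑[ x ∈ xs ] ∑ ys (p x)) * 2 ^ h ≤ N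
union-bound xs ys p {h} {m} {N} l b = *-cancelˡ-≤ (2 ^ m) ⦃ m^n≢0 2 m ⦄ (begin
  2 ^ m * (∑ xs (λ x → ∑ ys (p x)) * 2 ^ h)        ≡⟨ swap (2 ^ m) (∑ xs (λ x → ∑ ys (p x))) (2 ^ h) ⟩
  ∑ xs (λ x → ∑ ys (p x)) * (2 ^ m * 2 ^ h)        ≡⟨ cong₂ _*_ (∑-swap xs ys p) (sym (^-distribˡ-+-* 2 m h)) ⟩
  ∑ ys (λ y → ∑ xs (λ x → p x y)) * 2 ^ (m + h)    ≡⟨ sym (∑-*ʳ (2 ^ (m + h)) ys _) ⟩
  ∑ ys (λ y → ∑ xs (λ x → p x y) * 2 ^ (m + h))    ≤⟨ ∑-bound ys b ⟩
  length ys * N                                    ≤⟨ *-monoˡ-≤ N l ⟩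
  2 ^ m * N                                        ∎)
  where
  open ≤-Reasoning
  swap : ∀ a b c → a * (b * c) ≡ b * (a * c)
  swap = ℕ-Ring.solve-∀

zip-∑₁ : ∀ {A B : Set} (f : A → ℕ) (xs : List A) (ys : List B) → length xs ≡ length ys →
         ∑ (zip xs ys) (f ∘ proj₁) ≡ ∑ xs f
zip-∑₁ f []       []       _ = refl
zip-∑₁ f (x ∷ xs) (y ∷ ys) e = cong (f x +_) (zip-∑₁ f xs ys (suc-injective e))

length-zip : ∀ {A B : Set} (xs : List A) (ys : List B) → length xs ≡ length ys → length (zip xs ys) ≡ length xs
length-zip []       []       _ = refl
length-zip (x ∷ xs) (y ∷ ys) e = cong suc (length-zip xs ys (suc-injective e))

zip-∈ : ∀ {A B : Set} {xs : List A} {ys : List B} {x y} → (x , y) ∈ zip xs ys → x ∈ xs × y ∈ ys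
zip-∈ {xs = _ ∷ _} {_ ∷ _} (here refl) = here refl , here refl
zip-∈ {xs = _ ∷ _} {_ ∷ _} (there p) with zip-∈ p
... | p₁ , p₂ = there p₁ , there p₂

pairs : ∀ {A B : Set} → List A → List B → List (A × B)
pairs xs ys = concatMap (λ x → map (x ,_) ys) xs

∈-pairs : ∀ {A B : Set} {xs : List A} {ys : List B} {x y} → x ∈ xs → y ∈ ys → (x , y) ∈ pairs xs ys
∈-pairs x∈ y∈ = ∈-concatMap⁺ x∈ (∈-map⁺ _ y∈)

length-pairs : ∀ {A B : Set} (xs : List A) (ys : List B) → length (pairs xs ys) ≡ length xs * length ys
length-pairs xs ys = begin
  length (pairs xs ys)                    ≡⟨ length-∑ (pairs xs ys) ⟩
  ∑ (pairs xs ys) (λ _ → 1)               ≡⟨ ∑-concatMap _ xs _ ⟩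
  ∑ xs (λ x → ∑ (map (x ,_) ys) (λ _ → 1)) ≡⟨ ∑-cong xs (λ x → trans (∑-map (x ,_) ys _) (sym (length-∑ ys))) ⟩
  ∑ xs (λ _ → length ys)                  ≡⟨ ∑-const xs (length ys) ⟩
  length xs * length ys                   ∎
  where open ≡-Reasoning

-- Each size is `samples` times the number of bits of confidence wanted: the logarithm of the number
-- of events in the union bound plus 7. Within `kSize` the inner sample has `samples * (q + 7)`
-- pairs, for 2^q replies; `kSize` then allows for all lists of that many pairs, at `q + q` bits a
-- pair, and `lSize` for all answers to the k challenges. The 7 is chosen because 2^7 exceeds 120,
-- so that a failure costs less than one unit.
kSize lSize : ℕ → ℕ
kSize q = samples * ((q + q) * (samples * (q + 7)) + 7)
lSize q = samples * (q * kSize q + 7)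

uSize : ℕ
uSize = samples * 7

-- A sample of k challenges for the first prover and l ≫ k for the second.  With values measured in units of
-- 1/120, a value of at most 40 becomes with high probability at most 42 when the first prover is sampled and
-- the second replies to k₀ of the sampled answers; unrestricted replies gain at most 5 more.  Sampling the second
-- prover leads to 49 and sampling the coins to 51, which is still below the majority threshold 60.
module Subsampling
  {Y A C : Set} (Ys : List Y) (As : List A) (Rs : List C) (w : Y → Y → A → A → C → Bool) (q : ℕ)
  ⦃ n≢0 : NonZero (length Ys) ⦄ ⦃ ρ≢0 : NonZero (length Rs) ⦄
  (|Ys| : length Ys ≤ 2 ^ q) (|As| : length As ≤ 2 ^ q) (a₀ : A) (a₀∈ : a₀ ∈ As)
  where

  n ρ c k₀ k l u : ℕ
  n  = length Ys
  ρ  = length Rs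
  c  = samples
  k₀ = c * (q + 7)
  k  = kSize q
  l  = lSize q
  u  = uSize

  instance
    c≢0 : NonZero c
    c≢0 = samples≢0

    2ρ≢0 : NonZero (2 * ρ)
    2ρ≢0 = m*n≢0 2 ρ

    nρ≢0 : NonZero (n * ρ)
    nρ≢0 = m*n≢0 n ρ

    k≢0 : NonZero k
    k≢0 = m*n≢0 c ((q + q) * k₀ + 7) ⦃ c≢0 ⦄ ⦃ ℕ.>-nonZero (m≤n⇒m≤o+n ((q + q) * k₀) (s≤s z≤n)) ⦄

    l≢0 : NonZero l
    l≢0 = m*n≢0 c (q * k + 7) ⦃ c≢0 ⦄ ⦃ ℕ.>-nonZero (m≤n⇒m≤o+n (q * k) (s≤s z≤n)) ⦄

    kρ≢0 : NonZero (k * ρ)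
    kρ≢0 = m*n≢0 k ρ

    kl≢0 : NonZero (k * l)
    kl≢0 = m*n≢0 k l

  v : Y → Y → A → A → ℕ
  v s t a b = ∑[ r ∈ Rs ] 𝟙 (w s t a b r)

  v≤ρ : ∀ s t a b → v s t a b ≤ ρ
  v≤ρ s t a b = ≤-trans (∑-bound Rs (λ _ → 𝟙≤1 _)) (≤-reflexive (*-identityʳ ρ))

  F : List (Y × A) → Y → A → ℕ
  F P t b = ∑[ sa ∈ P ] v (proj₁ sa) t (proj₂ sa) b

  F≤ : ∀ P t b → F P t b ≤ length P * ρ
  F≤ P t b = ∑-bound P (λ {sa} _ → v≤ρ (proj₁ sa) t (proj₂ sa) b)

  reply : List (Y × A) → Y → A
  reply P t = argmax a₀ (F P t) As

  reply∈ : ∀ P t → reply P t ∈ As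
  reply∈ P t = argmax-∈ a₀ (F P t) a₀∈ id

  value : List (Y × A) → Y → ℕ
  value P t = F P t (reply P t)

  -- On a sample of k₀ elements of P, a reply that loses more than 4/120 is unlikely to look as good as the best one;
  -- the union bound over all replies costs another 1/120.
  module _ (P : List (Y × A)) (t : Y) where

    private
      K : ℕ
      K = length P

      b* : A
      b* = reply P t

      -- Shifted by ρ to be a natural number: its mean reaches ρ only if b is as good as b*.
      gain : A → Y × A → ℕ
      gain b sa = (ρ ∸ v (proj₁ sa) t (proj₂ sa) b*) + v (proj₁ sa) t (proj₂ sa) b

      ∑-gain : ∀ b I → ∑ I (gain b) + F I t b* ≡ length I * ρ + F I t b
      ∑-gain b [] = refl
      ∑-gain b ((s , a) ∷ I) = begin
        (ρ ∸ v s t a b*) + v s t a b + ∑ I (gain b) + (v s t a b* + F I t b*)  ≡⟨ shuffle (ρ ∸ v s t a b*) _ _ _ _ ⟩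
        (ρ ∸ v s t a b* + v s t a b*) + v s t a b + (∑ I (gain b) + F I t b*)  ≡⟨ cong₂ (λ x y → x + v s t a b + y) (m∸n+n≡m (v≤ρ s t a b*)) (∑-gain b I) ⟩
        ρ + v s t a b + (length I * ρ + F I t b)                             ≡⟨ shuffle' ρ _ _ _ ⟩
        (ρ + length I * ρ) + (v s t a b + F I t b)                           ∎
        where
        open ≡-Reasoning
        shuffle : ∀ a b c d e → a + b + c + (d + e) ≡ (a + d) + b + (c + e)
        shuffle = ℕ-Ring.solve-∀
        shuffle' : ∀ a b c d → a + b + (c + d) ≡ a + c + (b + d)
        shuffle' = ℕ-Ring.solve-∀

      poor : A → Bool
      poor b = 120 * F P t b + 4 * (K * ρ) ≤ᵇ 120 * F P t b*

      -- `gain` ranges up to `2 * ρ`, so breaking even, a mean of ρ, is 60/120 of the range. A poor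
      -- reply loses 4/120 of ρ, which puts its mean at 58/120 of the range at most: exactly the gap
      -- of `deviation₅₈`.
      misled : List (Y × A) → A → ℕ
      misled I b = 𝟙 (poor b) * 𝟙 (60 * (2 * ρ * k₀) ≤ᵇ 120 * ∑ I (gain b))

      misled-rare : ∀ b → (∑[ I ∈ tuples P k₀ ] misled I b) * 2 ^ (q + 7) ≤ K ^ k₀
      misled-rare b with poor b in eq
      ... | false = ≤-trans (≤-reflexive (cong (_* 2 ^ (q + 7)) (trans (∑-const (tuples P k₀) 0) (*-zeroʳ (length (tuples P k₀)))))) z≤n
      ... | true  = ≤-trans (≤-reflexive (cong (_* 2 ^ (q + 7)) (∑-cong (tuples P k₀) (λ I → +-identityʳ _))))
                    (deviation₅₈ P (gain b) (2 * ρ)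
                      (λ {sa} _ → +-mono-≤ (m∸n≤m ρ (v (proj₁ sa) t (proj₂ sa) b*)) (≤-trans (v≤ρ _ _ _ _) (≤-reflexive (sym (+-identityʳ ρ)))))
                      (mean (≤ᵇ⇒≤ _ _ (subst T (sym eq) tt))) (q + 7))
        where
        mean : 120 * F P t b + 4 * (K * ρ) ≤ 120 * F P t b* → 120 * ∑ P (gain b) ≤ 58 * (2 * ρ * K)
        mean le = +-cancelʳ-≤ (4 * (K * ρ) + 120 * F P t b*) _ _ (begin
          120 * ∑ P (gain b) + (4 * (K * ρ) + 120 * F P t b*)  ≡⟨ shuffle 120 (∑ P (gain b)) _ _ ⟩
          120 * (∑ P (gain b) + F P t b*) + 4 * (K * ρ)        ≡⟨ cong (λ x → 120 * x + 4 * (K * ρ)) (∑-gain b P) ⟩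
          120 * (K * ρ + F P t b) + 4 * (K * ρ)                ≡⟨ shuffle' 120 (K * ρ) (F P t b) _ ⟩
          120 * (K * ρ) + (120 * F P t b + 4 * (K * ρ))        ≤⟨ +-monoʳ-≤ (120 * (K * ρ)) le ⟩
          120 * (K * ρ) + 120 * F P t b*                       ≡⟨ cong (_+ 120 * F P t b*) (*-distribʳ-+ (K * ρ) 116 4) ⟩
          116 * (K * ρ) + 4 * (K * ρ) + 120 * F P t b*         ≡⟨ +-assoc (116 * (K * ρ)) _ _ ⟩
          116 * (K * ρ) + (4 * (K * ρ) + 120 * F P t b*)       ≡⟨ cong (_+ (4 * (K * ρ) + 120 * F P t b*)) (trans (*-assoc 58 2 (K * ρ)) (cong (58 *_) (swap 2 K ρ))) ⟩
          58 * (2 * ρ * K) + (4 * (K * ρ) + 120 * F P t b*)    ∎)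
          where
          open ≤-Reasoning
          shuffle : ∀ g a b c → g * a + (b + g * c) ≡ g * (a + c) + b
          shuffle = ℕ-Ring.solve-∀
          shuffle' : ∀ g a b c → g * (a + b) + c ≡ g * a + (g * b + c)
          shuffle' = ℕ-Ring.solve-∀
          swap : ∀ a b c → a * (b * c) ≡ a * c * b
          swap = ℕ-Ring.solve-∀

      -- Either the reply chosen on `I` loses at most 4/120, or it is itself one of the misleading
      -- replies, and then the trivial bound `K * ρ` is charged to it.
      pointwise : ∀ {I} → I ∈ tuples P k₀ →
                  120 * value P t ≤ 120 * F P t (reply I t) + 4 * (K * ρ) + 120 * (K * ρ) * ∑ As (misled I)
      pointwise {I} I∈ with ≤-total (120 * value P t) (120 * F P t (reply I t) + 4 * (K * ρ))
      ... | inj₁ le = ≤-trans le (m≤m+n _ _)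
      ... | inj₂ ge = begin
        120 * value P t                     ≤⟨ *-monoʳ-≤ 120 (F≤ P t b*) ⟩
        120 * (K * ρ)                       ≡⟨ sym (*-identityʳ _) ⟩
        120 * (K * ρ) * 1                   ≤⟨ *-monoʳ-≤ (120 * (K * ρ)) certain ⟩
        120 * (K * ρ) * ∑ As (misled I)     ≤⟨ m≤n+m _ _ ⟩
        120 * F P t (reply I t) + 4 * (K * ρ) + 120 * (K * ρ) * ∑ As (misled I) ∎
        where
        open ≤-Reasoning
        b : A
        b = reply I t
        large : k₀ * ρ ≤ ∑ I (gain b)
        large = +-cancelʳ-≤ (F I t b*) _ _ (begin
          k₀ * ρ + F I t b*            ≤⟨ +-monoʳ-≤ (k₀ * ρ) (argmax-max a₀ (F I t) (reply∈ P t)) ⟩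
          k₀ * ρ + F I t b             ≡⟨ cong (λ x → x * ρ + F I t b) (sym (proj₂ (∈-tuples⁻ k₀ I∈))) ⟩
          length I * ρ + F I t b       ≡⟨ sym (∑-gain b I) ⟩
          ∑ I (gain b) + F I t b*      ∎)
        certain : 1 ≤ ∑ As (misled I)
        certain = ≤-trans (≤-reflexive (sym (cong₂ _*_ (𝟙-true (≤⇒≤ᵇ ge)) (𝟙-true (≤⇒≤ᵇ event)))))
                          (∑-term (misled I) (reply∈ I t))
          where
          event : 60 * (2 * ρ * k₀) ≤ 120 * ∑ I (gain b)
          event = ≤-trans (≤-reflexive (trans (cong (60 *_) (swap 2 ρ k₀)) (sym (*-assoc 60 2 (k₀ * ρ)))))
                          (*-monoʳ-≤ 120 large)
            where
            swap : ∀ a b c → a * b * c ≡ a * (c * b)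
            swap = ℕ-Ring.solve-∀

    -- Stated as an average over `I` rather than for some good `I`, because one and the same `I`
    -- later has to serve as a strategy for all t; averaging commutes with the sum over t.
    reply-sampled : K ^ k₀ * (120 * value P t) ≤
                    120 * (∑[ I ∈ tuples P k₀ ] F P t (reply I t)) + K ^ k₀ * (5 * (K * ρ))
    reply-sampled = begin
      K ^ k₀ * (120 * value P t)                       ≡⟨ cong (_* (120 * value P t)) (sym (length-tuples P k₀)) ⟩
      length (tuples P k₀) * (120 * value P t)         ≡⟨ sym (∑-const (tuples P k₀) _) ⟩
      ∑ (tuples P k₀) (λ _ → 120 * value P t)          ≤⟨ ∑-mono-∈ (tuples P k₀) pointwise ⟩
      ∑ (tuples P k₀) (λ I → 120 * F P t (reply I t) + 4 * (K * ρ) + 120 * (K * ρ) * ∑ As (misled I))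
        ≡⟨ trans (∑-+ (tuples P k₀) _ _) (cong₂ _+_ (trans (∑-+ (tuples P k₀) _ _) (cong₂ _+_ (∑-*ˡ 120 (tuples P k₀) _)
             (trans (∑-const (tuples P k₀) _) (cong (_* (4 * (K * ρ))) (length-tuples P k₀))))) (∑-*ˡ (120 * (K * ρ)) (tuples P k₀) _)) ⟩
      120 * good + K ^ k₀ * (4 * (K * ρ)) + 120 * (K * ρ) * bad   ≤⟨ +-monoʳ-≤ (120 * good + K ^ k₀ * (4 * (K * ρ))) few ⟩
      120 * good + K ^ k₀ * (4 * (K * ρ)) + K ^ k₀ * (K * ρ)      ≡⟨ collect (120 * good) (K ^ k₀) (K * ρ) ⟩
      120 * good + K ^ k₀ * (5 * (K * ρ))              ∎
      where
      open ≤-Reasoning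
      good bad : ℕ
      good = ∑[ I ∈ tuples P k₀ ] F P t (reply I t)
      bad  = ∑[ I ∈ tuples P k₀ ] ∑ As (misled I)
      bad≤ : bad * 2 ^ 7 ≤ K ^ k₀
      bad≤ = union-bound (tuples P k₀) As misled {h = 7} {m = q} |As| (λ {b} _ → misled-rare b)
      few : 120 * (K * ρ) * bad ≤ K ^ k₀ * (K * ρ)
      few = begin
        -- The trivial bound of 120 units, suffered with frequency 2^(-7), amounts to at most one
        -- unit: the fifth.
        120 * (K * ρ) * bad     ≤⟨ *-monoˡ-≤ bad (*-monoˡ-≤ (K * ρ) (≤ᵇ⇒≤ 120 128 tt)) ⟩
        2 ^ 7 * (K * ρ) * bad   ≡⟨ swap (2 ^ 7) (K * ρ) bad ⟩
        bad * 2 ^ 7 * (K * ρ)   ≤⟨ *-monoˡ-≤ (K * ρ) bad≤ ⟩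
        K ^ k₀ * (K * ρ)        ∎
        where
        swap : ∀ a b c → a * b * c ≡ c * a * b
        swap = ℕ-Ring.solve-∀
      collect : ∀ g p x → g + p * (4 * x) + p * x ≡ g + p * (5 * x)
      collect = ℕ-Ring.solve-∀

  length-tuples-≤ : ∀ {X : Set} (xs : List X) m j → length xs ≤ 2 ^ m → length (tuples xs j) ≤ 2 ^ (m * j)
  length-tuples-≤ xs m j le = begin
    length (tuples xs j)  ≡⟨ length-tuples xs j ⟩
    length xs ^ j         ≤⟨ ^-monoˡ-≤ j le ⟩
    (2 ^ m) ^ j           ≡⟨ ^-*-assoc 2 m j ⟩
    2 ^ (m * j)           ∎
    where open ≤-Reasoning

  ∑-zero : ∀ {X : Set} {xs : List X} {x} (f : X → ℕ) → ∑ xs f ≡ 0 → x ∈ xs → f x ≡ 0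
  ∑-zero f e x∈ = n≤0⇒n≡0 (≤-trans (∑-term f x∈) (≤-reflexive e))

  -- Soundness of the sampled game

  hits : List Y → List Y → List A → List A → C → ℕ
  hits U V a b r = ∑[ sa ∈ zip U a ] ∑[ tb ∈ zip V b ] 𝟙 (w (proj₁ sa) (proj₁ tb) (proj₂ sa) (proj₂ tb) r)

  module _ (sound : ∀ (β₁ β₂ : Y → A) → (∀ y → β₁ y ∈ As) → (∀ y → β₂ y ∈ As) →
                    3 * (∑[ s ∈ Ys ] ∑[ t ∈ Ys ] v s t (β₁ s) (β₂ t)) ≤ n * (n * ρ)) where

    -- The first prover's best response to the strategy `reply J`. Whatever Merlin answers on U does
    -- no better against `reply J` than this response.
    partner : List (Y × A) → Y → A
    partner J s = argmax a₀ (λ a → ∑[ t ∈ Ys ] v s t a (reply J t)) As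

    H : List (Y × A) → Y → ℕ
    H J s = ∑[ t ∈ Ys ] v s t (partner J s) (reply J t)

    -- All conceivable subsamples with answers, whether or not they come from U. Being independent
    -- of U, the family admits a union bound over the draw of U.
    𝓙 : List (List (Y × A))
    𝓙 = tuples (pairs Ys As) k₀

    bad₁ : List Y → ℕ
    bad₁ U = ∑[ J ∈ 𝓙 ] 𝟙 (42 * (n * ρ * k) ≤ᵇ 120 * ∑ U (H J))

    -- For each J the strategies `partner J` and `reply J` are legal in the original game, so `H J`
    -- has mean at most 1/3, that is 40/120, and the sample mean rarely reaches 42/120. One element
    -- of J takes `q + q` bits.
    bad₁-rare : (∑[ U ∈ tuples Ys k ] bad₁ U) * 2 ^ 7 ≤ n ^ k
    bad₁-rare = union-bound (tuples Ys k) 𝓙 _ {h = 7} {m = (q + q) * k₀}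
      (length-tuples-≤ (pairs Ys As) (q + q) k₀ (≤-trans (≤-reflexive (length-pairs Ys As))
        (≤-trans (*-mono-≤ |Ys| |As|) (≤-reflexive (sym (^-distribˡ-+-* 2 q q))))))
      (λ {J} _ → deviation₄₀ Ys (H J) (n * ρ) (λ _ → ∑-bound Ys (λ _ → v≤ρ _ _ _ _)) (mean J) ((q + q) * k₀ + 7))
      where
      mean : ∀ J → 120 * ∑ Ys (H J) ≤ 40 * (n * ρ * n)
      mean J = begin
        120 * ∑ Ys (H J)       ≡⟨ *-assoc 40 3 (∑ Ys (H J)) ⟩
        40 * (3 * ∑ Ys (H J))  ≤⟨ *-monoʳ-≤ 40 (sound (partner J) (reply J) (λ s → argmax-∈ a₀ _ a₀∈ id) (reply∈ J)) ⟩
        40 * (n * (n * ρ))     ≡⟨ cong (40 *_) (*-comm n (n * ρ)) ⟩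
        40 * (n * ρ * n)       ∎
        where open ≤-Reasoning

    -- Best replies are replaced by `reply I` with I a random subsample of U and its answers, at a
    -- loss of 5. For each I this is a member of the family, and the answers `a` are dominated by
    -- `partner I`, so 42 applies: 42 + 5 = 47.
    value-small : ∀ {U a} → bad₁ U ≡ 0 → U ∈ tuples Ys k → a ∈ tuples As k →
                  120 * ∑ Ys (value (zip U a)) ≤ 47 * (k * ρ * n)
    value-small {U} {a} ok U∈ a∈ = *-cancelˡ-≤ (k ^ k₀) ⦃ m^n≢0 k k₀ ⦄ (begin
      k ^ k₀ * (120 * ∑ Ys (value P))                       ≡⟨ cong (k ^ k₀ *_) (sym (∑-*ˡ 120 Ys _)) ⟩
      k ^ k₀ * ∑ Ys (λ t → 120 * value P t)                 ≡⟨ sym (∑-*ˡ (k ^ k₀) Ys _) ⟩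
      ∑ Ys (λ t → k ^ k₀ * (120 * value P t))               ≤⟨ ∑-mono Ys (λ t → subst (λ K → K ^ k₀ * (120 * value P t) ≤
                                                                 120 * (∑[ I ∈ tuples P k₀ ] F P t (reply I t)) + K ^ k₀ * (5 * (K * ρ)))
                                                                 |P| (reply-sampled P t)) ⟩
      ∑ Ys (λ t → 120 * (∑[ I ∈ tuples P k₀ ] F P t (reply I t)) + k ^ k₀ * (5 * (k * ρ)))
        ≡⟨ trans (∑-+ Ys _ _) (cong₂ _+_ (∑-*ˡ 120 Ys _) (∑-const Ys _)) ⟩
      120 * ∑ Ys (λ t → ∑[ I ∈ tuples P k₀ ] F P t (reply I t)) + n * (k ^ k₀ * (5 * (k * ρ)))
        ≡⟨ cong (λ x → 120 * x + n * (k ^ k₀ * (5 * (k * ρ)))) (∑-swap Ys (tuples P k₀) _) ⟩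
      120 * ∑ (tuples P k₀) (λ I → ∑[ t ∈ Ys ] F P t (reply I t)) + n * (k ^ k₀ * (5 * (k * ρ)))
        ≤⟨ +-monoˡ-≤ _ (≤-trans (≤-reflexive (sym (∑-*ˡ 120 (tuples P k₀) _))) (∑-bound (tuples P k₀) each)) ⟩
      length (tuples P k₀) * (42 * (n * ρ * k)) + n * (k ^ k₀ * (5 * (k * ρ)))
        ≡⟨ cong (λ x → x * (42 * (n * ρ * k)) + n * (k ^ k₀ * (5 * (k * ρ)))) (trans (length-tuples P k₀) (cong (_^ k₀) |P|)) ⟩
      k ^ k₀ * (42 * (n * ρ * k)) + n * (k ^ k₀ * (5 * (k * ρ)))  ≡⟨ collect (k ^ k₀) n k ρ 42 5 ⟩
      k ^ k₀ * (47 * (k * ρ * n))                            ∎)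
      where
      open ≤-Reasoning
      P : List (Y × A)
      P = zip U a
      |U| : length U ≡ k
      |U| = proj₂ (∈-tuples⁻ k U∈)
      |a| : length a ≡ k
      |a| = proj₂ (∈-tuples⁻ k a∈)
      |P| : length P ≡ k
      |P| = trans (length-zip U a (trans |U| (sym |a|))) |U|
      collect : ∀ p n k r x y → p * (x * (n * r * k)) + n * (p * (y * (k * r))) ≡ p * ((x + y) * (k * r * n))
      collect = ℕ-Ring.solve-∀
      P⊆ : ∀ {sa} → sa ∈ P → sa ∈ pairs Ys As
      P⊆ p with zip-∈ p
      ... | s∈ , a'∈ = ∈-pairs (All.lookup (proj₁ (∈-tuples⁻ k U∈)) s∈) (All.lookup (proj₁ (∈-tuples⁻ k a∈)) a'∈)
      each : ∀ {I} → I ∈ tuples P k₀ → 120 * (∑[ t ∈ Ys ] F P t (reply I t)) ≤ 42 * (n * ρ * k)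
      each {I} I∈ with ∈-tuples⁻ k₀ I∈
      ... | I⊆ , |I| = begin
        120 * (∑[ t ∈ Ys ] F P t (reply I t))                                   ≡⟨ cong (120 *_) (∑-swap Ys P _) ⟩
        120 * ∑ P (λ sa → ∑[ t ∈ Ys ] v (proj₁ sa) t (proj₂ sa) (reply I t))    ≤⟨ *-monoʳ-≤ 120 (∑-mono-∈ P (λ {sa} sa∈ →
            argmax-max a₀ (λ a' → ∑[ t ∈ Ys ] v (proj₁ sa) t a' (reply I t)) (All.lookup (proj₁ (∈-tuples⁻ k a∈)) (proj₂ (zip-∈ sa∈))))) ⟩
        120 * ∑ P (H I ∘ proj₁)                                                 ≡⟨ cong (120 *_) (zip-∑₁ (H I) U a (trans |U| (sym |a|))) ⟩
        120 * ∑ U (H I)                                                         ≤⟨ <⇒≤ (𝟙-≤ᵇ-0 _ _ (∑-zero _ ok (subst (λ m → I ∈ tuples (pairs Ys As) m) |I| (∈-tuples⁺ (All.map P⊆ I⊆))))) ⟩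
        42 * (n * ρ * k)                                                        ∎

    bad₂ : List Y → List Y → ℕ
    bad₂ U V = ∑[ a ∈ tuples As k ] 𝟙 (49 * (k * ρ * l) ≤ᵇ 120 * ∑ V (value (zip U a)))

    -- Merlin chooses the answers on U after seeing V, hence the union bound over all of them. For
    -- each fixed choice the best-reply value is a function of t alone, and V is an independent
    -- sample of its arguments.
    bad₂-rare : ∀ {U} → bad₁ U ≡ 0 → U ∈ tuples Ys k → (∑[ V ∈ tuples Ys l ] bad₂ U V) * 2 ^ 7 ≤ n ^ l
    bad₂-rare {U} ok U∈ = union-bound (tuples Ys l) (tuples As k) _ {h = 7} {m = q * k} (length-tuples-≤ As q k |As|)
      (λ {a} a∈ → deviation₄₇ Ys (value (zip U a)) (k * ρ)
        (λ {t} _ → ≤-trans (F≤ (zip U a) t _) (≤-reflexive (cong (_* ρ) (|zip| a∈)))) (value-small {U} {a} ok U∈ a∈) (q * k + 7))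
      where
      |zip| : ∀ {a} → a ∈ tuples As k → length (zip U a) ≡ k
      |zip| {a} a∈ = trans (length-zip U a (trans |U| (sym (proj₂ (∈-tuples⁻ k a∈))))) |U|
        where
        |U| : length U ≡ k
        |U| = proj₂ (∈-tuples⁻ k U∈)

    -- The answers are fixed before the coins are drawn, so a single deviation bound is enough. The
    -- answers `b` are no better than best replies, which transfers the bound for `value` to the
    -- mean number of hits.
    coins-rare : ∀ {U V a b} → bad₂ U V ≡ 0 → U ∈ tuples Ys k → V ∈ tuples Ys l → a ∈ tuples As k → b ∈ tuples As l →
                 (∑[ rs ∈ tuples Rs u ] 𝟙 (k * l * u ≤ᵇ 2 * ∑ rs (hits U V a b))) * 2 ^ 7 ≤ ρ ^ u
    coins-rare {U} {V} {a} {b} ok U∈ V∈ a∈ b∈ = ≤-trans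
      (*-monoˡ-≤ (2 ^ 7) (∑-mono (tuples Rs u) (λ rs → 𝟙-≤ᵇ-mono (majority (∑ rs (hits U V a b))))))
      (deviation₄₉ Rs (hits U V a b) (k * l) bound mean 7)
      where
      open ≤-Reasoning
      |U| : length U ≡ k
      |U| = proj₂ (∈-tuples⁻ k U∈)
      |V| : length V ≡ l
      |V| = proj₂ (∈-tuples⁻ l V∈)
      |Sa| : length (zip U a) ≡ k
      |Sa| = trans (length-zip U a (trans |U| (sym (proj₂ (∈-tuples⁻ k a∈))))) |U|
      |V|≡|b| : length V ≡ length b
      |V|≡|b| = trans |V| (sym (proj₂ (∈-tuples⁻ l b∈)))
      majority : ∀ x → k * l * u ≤ 2 * x → 51 * (k * l * u) ≤ 120 * x
      majority x le = begin
        51 * (k * l * u)   ≤⟨ *-monoˡ-≤ (k * l * u) (≤ᵇ⇒≤ 51 60 tt) ⟩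
        60 * (k * l * u)   ≤⟨ *-monoʳ-≤ 60 le ⟩
        60 * (2 * x)       ≡⟨ sym (*-assoc 60 2 x) ⟩
        120 * x            ∎
      bound : ∀ {r} → r ∈ Rs → hits U V a b r ≤ k * l
      bound _ = ≤-trans (∑-bound (zip U a) (λ _ → ∑-bound (zip V b) (λ _ → 𝟙≤1 _)))
        (≤-reflexive (cong₂ _*_ |Sa| (trans (*-identityʳ _) (trans (length-zip V b |V|≡|b|) |V|))))
      total-hits : ∑ Rs (hits U V a b) ≤ ∑ V (value (zip U a))
      total-hits = begin
        ∑ Rs (hits U V a b)                                          ≡⟨ ∑-swap Rs (zip U a) _ ⟩
        (∑[ sa ∈ zip U a ] ∑[ r ∈ Rs ] ∑[ tb ∈ zip V b ] W sa tb r)  ≡⟨ ∑-cong (zip U a) (λ sa → ∑-swap Rs (zip V b) _) ⟩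
        (∑[ sa ∈ zip U a ] ∑[ tb ∈ zip V b ] ∑[ r ∈ Rs ] W sa tb r)  ≡⟨ ∑-swap (zip U a) (zip V b) _ ⟩
        (∑[ tb ∈ zip V b ] F (zip U a) (proj₁ tb) (proj₂ tb))        ≤⟨ ∑-mono-∈ (zip V b) (λ {tb} tb∈ →
            argmax-max a₀ (F (zip U a) (proj₁ tb)) (All.lookup (proj₁ (∈-tuples⁻ l b∈)) (proj₂ (zip-∈ tb∈)))) ⟩
        ∑ (zip V b) (value (zip U a) ∘ proj₁)                        ≡⟨ zip-∑₁ (value (zip U a)) V b |V|≡|b| ⟩
        ∑ V (value (zip U a))                                        ∎
        where
        W : Y × A → Y × A → C → ℕ
        W sa tb r = 𝟙 (w (proj₁ sa) (proj₁ tb) (proj₂ sa) (proj₂ tb) r)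
      mean : 120 * ∑ Rs (hits U V a b) ≤ 49 * (k * l * ρ)
      mean = begin
        120 * ∑ Rs (hits U V a b)     ≤⟨ *-monoʳ-≤ 120 total-hits ⟩
        120 * ∑ V (value (zip U a))   ≤⟨ <⇒≤ (𝟙-≤ᵇ-0 _ _ (∑-zero _ ok a∈)) ⟩
        49 * (k * ρ * l)              ≡⟨ cong (49 *_) (swap k ρ l) ⟩
        49 * (k * l * ρ)              ∎
        where
        swap : ∀ a b c → a * b * c ≡ a * c * b
        swap = ℕ-Ring.solve-∀

    -- Three failures are possible, a bad U, a bad V for a good U, and unlucky coins, each of
    -- frequency at most 2^(-7); the claim follows from 3 * 3 ≤ 128. Both answers depend on both
    -- samples, since a single Merlin gives them.
    subsampling : (α β : List Y → List Y → List A) →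
      (∀ {U V} → U ∈ tuples Ys k → V ∈ tuples Ys l → α U V ∈ tuples As k × β U V ∈ tuples As l) →
      3 * (∑[ U ∈ tuples Ys k ] ∑[ V ∈ tuples Ys l ] ∑[ rs ∈ tuples Rs u ]
             𝟙 (k * l * u ≤ᵇ 2 * ∑ rs (hits U V (α U V) (β U V)))) ≤ n ^ k * (n ^ l * ρ ^ u)
    subsampling α β legal = *-cancelˡ-≤ (2 ^ 7) (begin
      2 ^ 7 * (3 * ∑ (tuples Ys k) inner₁)                ≡⟨ swap (2 ^ 7) 3 (∑ (tuples Ys k) inner₁) ⟩
      3 * (∑ (tuples Ys k) inner₁ * 2 ^ 7)                ≡⟨ cong (3 *_) (sym (∑-*ʳ (2 ^ 7) (tuples Ys k) inner₁)) ⟩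
      3 * ∑ (tuples Ys k) (λ U → inner₁ U * 2 ^ 7)        ≤⟨ *-monoʳ-≤ 3 (∑-mono-∈ (tuples Ys k) (λ {U} → inner₁-bound {U})) ⟩
      3 * ∑ (tuples Ys k) (λ U → bad₁ U * (m * 2 ^ 7) + 2 * m)
        ≡⟨ cong (3 *_) (trans (∑-+ (tuples Ys k) _ _) (cong₂ _+_ (∑-*ʳ (m * 2 ^ 7) (tuples Ys k) bad₁) (∑-const (tuples Ys k) _))) ⟩
      3 * (∑ (tuples Ys k) bad₁ * (m * 2 ^ 7) + length (tuples Ys k) * (2 * m))
        ≡⟨ cong₂ (λ x y → 3 * (x + y * (2 * m))) (swap' (∑ (tuples Ys k) bad₁) m (2 ^ 7)) (length-tuples Ys k) ⟩
      3 * (∑ (tuples Ys k) bad₁ * 2 ^ 7 * m + n ^ k * (2 * m))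
        ≤⟨ *-monoʳ-≤ 3 (+-monoˡ-≤ (n ^ k * (2 * m)) (*-monoˡ-≤ m bad₁-rare)) ⟩
      3 * (n ^ k * m + n ^ k * (2 * m))                 ≡⟨ collect (n ^ k) m ⟩
      9 * (n ^ k * m)                                   ≤⟨ *-monoˡ-≤ (n ^ k * m) (≤ᵇ⇒≤ 9 128 tt) ⟩
      2 ^ 7 * (n ^ k * (n ^ l * ρ ^ u))                 ∎)
      where
      open ≤-Reasoning
      m : ℕ
      m = n ^ l * ρ ^ u
      inner₂ : List Y → List Y → ℕ
      inner₂ U V = ∑[ rs ∈ tuples Rs u ] 𝟙 (k * l * u ≤ᵇ 2 * ∑ rs (hits U V (α U V) (β U V)))
      inner₁ : List Y → ℕ
      inner₁ U = ∑ (tuples Ys l) (inner₂ U)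
      swap : ∀ a b c → a * (b * c) ≡ b * (c * a)
      swap = ℕ-Ring.solve-∀
      swap' : ∀ a b c → a * (b * c) ≡ a * c * b
      swap' = ℕ-Ring.solve-∀
      collect : ∀ p m → 3 * (p * m + p * (2 * m)) ≡ 9 * (p * m)
      collect = ℕ-Ring.solve-∀
      inner₂-trivial : ∀ U V → inner₂ U V ≤ ρ ^ u
      inner₂-trivial U V = ≤-trans (∑-bound (tuples Rs u) (λ _ → 𝟙≤1 _))
        (≤-reflexive (trans (*-identityʳ _) (length-tuples Rs u)))
      inner₂-bound : ∀ {U V} → U ∈ tuples Ys k → V ∈ tuples Ys l → inner₂ U V * 2 ^ 7 ≤ bad₂ U V * (ρ ^ u * 2 ^ 7) + ρ ^ u
      inner₂-bound {U} {V} U∈ V∈ with bad₂ U V in eq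
      ... | zero  = coins-rare eq U∈ V∈ (proj₁ (legal U∈ V∈)) (proj₂ (legal U∈ V∈))
      ... | suc x = ≤-trans (*-monoˡ-≤ (2 ^ 7) (inner₂-trivial U V)) (≤-trans (m≤m+n _ (x * (ρ ^ u * 2 ^ 7))) (m≤m+n _ (ρ ^ u)))
      inner₁-bound : ∀ {U} → U ∈ tuples Ys k → inner₁ U * 2 ^ 7 ≤ bad₁ U * (m * 2 ^ 7) + 2 * m
      inner₁-bound {U} U∈ with bad₁ U in eq
      -- A bad U is charged the trivial bound; the positive count `bad₁ U` stands in for the
      -- indicator of badness.
      ... | suc x = ≤-trans (*-monoˡ-≤ (2 ^ 7) (≤-trans (∑-bound (tuples Ys l) (λ {V} _ → inner₂-trivial U V))
                      (≤-reflexive (cong (_* ρ ^ u) (length-tuples Ys l)))))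
                      (≤-trans (m≤m+n _ (x * (m * 2 ^ 7))) (m≤m+n _ (2 * m)))
      ... | zero  = begin
        inner₁ U * 2 ^ 7                                                        ≡⟨ sym (∑-*ʳ (2 ^ 7) (tuples Ys l) _) ⟩
        ∑ (tuples Ys l) (λ V → inner₂ U V * 2 ^ 7)                              ≤⟨ ∑-mono-∈ (tuples Ys l) (λ {V} → inner₂-bound {U} {V} U∈) ⟩
        ∑ (tuples Ys l) (λ V → bad₂ U V * (ρ ^ u * 2 ^ 7) + ρ ^ u)
          ≡⟨ trans (∑-+ (tuples Ys l) _ _) (cong₂ _+_ (∑-*ʳ (ρ ^ u * 2 ^ 7) (tuples Ys l) (bad₂ U)) (∑-const (tuples Ys l) _)) ⟩
        ∑ (tuples Ys l) (bad₂ U) * (ρ ^ u * 2 ^ 7) + length (tuples Ys l) * ρ ^ u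
          ≡⟨ cong₂ (λ x y → x + y * ρ ^ u) (swap' (∑ (tuples Ys l) (bad₂ U)) (ρ ^ u) (2 ^ 7)) (length-tuples Ys l) ⟩
        ∑ (tuples Ys l) (bad₂ U) * 2 ^ 7 * ρ ^ u + n ^ l * ρ ^ u
          ≤⟨ +-monoˡ-≤ (n ^ l * ρ ^ u) (*-monoˡ-≤ (ρ ^ u) (bad₂-rare eq U∈)) ⟩
        m + m                                                                 ≡⟨ cong (m +_) (sym (+-identityʳ m)) ⟩
        2 * m                                                                 ∎

-- Subroutines on stacks

-- At variable positions updates do not compute. Together with `mem-ext` this reduces an equation
-- between memories to comparisons of one position r with the updated ones.
get-set-if : ∀ {Γ n} (r i : Fin n) v (σ : Mem Γ n) → get r (set i v σ) ≡ (if ⌊ r Fin.≟ i ⌋ then v else get r σ)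
get-set-if r i v σ with r Fin.≟ i
... | yes refl = get-set r v σ
... | no r≢i   = get-set-≢ r≢i v σ

mem-ext : ∀ {Γ n} {σ τ : Mem Γ n} → (∀ r → get r σ ≡ get r τ) → σ ≡ τ
mem-ext {n = zero}  h = refl
mem-ext {n = suc n} h = cong₂ _,_ (h zero) (mem-ext (h ∘ suc))

module Macros {Γ : Set} (n : ℕ) (TMP CNT : Fin n) where

  open Program {Γ} n public

  ⇒-to : ∀ {c σ τ τ' t} → c ⊢ σ ⇒ τ ⟨ t ⟩ → τ ≡ τ' → c ⊢ σ ⇒ τ' ⟨ t ⟩
  ⇒-to d refl = d

  ⇒-in : ∀ {c σ τ t t'} → c ⊢ σ ⇒ τ ⟨ t ⟩ → t ≡ t' → c ⊢ σ ⇒ τ ⟨ t' ⟩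
  ⇒-in d refl = d

  never : Γ → Bool
  never _ = false

  clear : Fin n → Cmd
  clear i = loop i never (λ _ → skip)

  clear-spec : ∀ i σ → clear i ⊢ σ ⇒ set i [] σ ⟨ 1 + 2 * length (get i σ) ⟩
  clear-spec i σ = go (get i σ) σ refl
    where
    go : ∀ xs σ → get i σ ≡ xs → clear i ⊢ σ ⇒ set i [] σ ⟨ 1 + 2 * length xs ⟩
    go []       σ e = ⇒-to (loop-[] e) (sym (trans (cong (λ v → set i v σ) (sym e)) (set-get i σ)))
    go (g ∷ xs) σ e = ⇒-in (⇒-to (loop-∷ e refl skip (go xs (set i xs σ) (get-set i xs σ))) (set-set i [] xs σ)) (count-up (length xs))
      where
      count-up : ∀ m → suc (1 + (1 + 2 * m)) ≡ 1 + 2 * suc m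
      count-up = ℕ-Ring.solve-∀

  move→ : Fin n → Fin n → Cmd
  move→ i j = loop i never (push j)

  move→-spec : ∀ {i j} → i ≢ j → ∀ σ →
               move→ i j ⊢ σ ⇒ set i [] (set j (get i σ ʳ++ get j σ) σ) ⟨ 1 + 2 * length (get i σ) ⟩
  move→-spec {i} {j} i≢j σ = go (get i σ) σ refl
    where
    go : ∀ xs σ → get i σ ≡ xs → move→ i j ⊢ σ ⇒ set i [] (set j (xs ʳ++ get j σ) σ) ⟨ 1 + 2 * length xs ⟩
    go [] σ e = ⇒-to (loop-[] e) (sym (trans (cong (set i []) (set-get j σ)) (trans (cong (λ v → set i v σ) (sym e)) (set-get i σ))))
    go (g ∷ xs) σ e = ⇒-in (⇒-to (loop-∷ e refl push (go xs _ popped)) final) (count-up (length xs))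
      where
      σ₁ = set i xs σ
      popped : get i (set j (g ∷ get j σ₁) σ₁) ≡ xs
      popped = trans (get-set-≢ i≢j _ σ₁) (get-set i xs σ)
      final : set i [] (set j (xs ʳ++ get j (set j (g ∷ get j σ₁) σ₁)) (set j (g ∷ get j σ₁) σ₁))
              ≡ set i [] (set j ((g ∷ xs) ʳ++ get j σ) σ)
      final rewrite get-set j (g ∷ get j σ₁) σ₁ | set-set j (xs ʳ++ (g ∷ get j σ₁)) (g ∷ get j σ₁) σ₁
                  | get-set-≢ (i≢j ∘ sym) xs σ | set-comm (i≢j ∘ sym) (xs ʳ++ (g ∷ get j σ)) xs σ
                  = set-set i [] xs _
      count-up : ∀ m → suc (1 + (1 + 2 * m)) ≡ 1 + 2 * suc m
      count-up = ℕ-Ring.solve-∀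

  spread : Fin n → Fin n → Cmd
  spread i j = loop TMP never (λ g → push i g ⨾ push j g)

  spread-spec : ∀ {i j} → i ≢ j → i ≢ TMP → j ≢ TMP → ∀ σ →
    spread i j ⊢ σ ⇒ set TMP [] (set i (get TMP σ ʳ++ get i σ) (set j (get TMP σ ʳ++ get j σ) σ)) ⟨ 1 + 3 * length (get TMP σ) ⟩
  spread-spec {i} {j} i≢j i≢t j≢t σ = go (get TMP σ) σ refl
    where
    go : ∀ xs σ → get TMP σ ≡ xs →
         spread i j ⊢ σ ⇒ set TMP [] (set i (xs ʳ++ get i σ) (set j (xs ʳ++ get j σ) σ)) ⟨ 1 + 3 * length xs ⟩
    go [] σ e = ⇒-to (loop-[] e) (sym (begin
      set TMP [] (set i (get i σ) (set j (get j σ) σ))  ≡⟨ cong (λ τ → set TMP [] (set i (get i σ) τ)) (set-get j σ) ⟩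
      set TMP [] (set i (get i σ) σ)                    ≡⟨ cong (set TMP []) (set-get i σ) ⟩
      set TMP [] σ                                      ≡⟨ cong (λ v → set TMP v σ) (sym e) ⟩
      set TMP (get TMP σ) σ                             ≡⟨ set-get TMP σ ⟩
      σ                                                 ∎))
      where open ≡-Reasoning
    go (g ∷ xs) σ e = ⇒-in (⇒-to (loop-∷ e refl (push ⨾ push) (go xs σ₃ popped)) (mem-ext final)) (count-up (length xs))
      where
      σ₁ = set TMP xs σ
      σ₂ = set i (g ∷ get i σ₁) σ₁
      σ₃ = set j (g ∷ get j σ₂) σ₂
      popped : get TMP σ₃ ≡ xs
      popped = trans (get-set-≢ (j≢t ∘ sym) _ σ₂) (trans (get-set-≢ (i≢t ∘ sym) _ σ₁) (get-set TMP xs σ))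
      get-i : get i σ₃ ≡ g ∷ get i σ
      get-i = trans (get-set-≢ i≢j _ σ₂) (trans (get-set i _ σ₁) (cong (g ∷_) (get-set-≢ i≢t xs σ)))
      get-j : get j σ₃ ≡ g ∷ get j σ
      get-j = trans (get-set j _ σ₂) (cong (g ∷_) (trans (get-set-≢ (i≢j ∘ sym) _ σ₁) (get-set-≢ j≢t xs σ)))
      final : ∀ r → get r (set TMP [] (set i (xs ʳ++ get i σ₃) (set j (xs ʳ++ get j σ₃) σ₃)))
                  ≡ get r (set TMP [] (set i ((g ∷ xs) ʳ++ get i σ) (set j ((g ∷ xs) ʳ++ get j σ) σ)))
      final r rewrite get-i | get-j
        | get-set-if r TMP [] (set i (xs ʳ++ (g ∷ get i σ)) (set j (xs ʳ++ (g ∷ get j σ)) σ₃))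
        | get-set-if r TMP [] (set i (xs ʳ++ (g ∷ get i σ)) (set j (xs ʳ++ (g ∷ get j σ)) σ))
        | get-set-if r i (xs ʳ++ (g ∷ get i σ)) (set j (xs ʳ++ (g ∷ get j σ)) σ₃)
        | get-set-if r i (xs ʳ++ (g ∷ get i σ)) (set j (xs ʳ++ (g ∷ get j σ)) σ)
        | get-set-if r j (xs ʳ++ (g ∷ get j σ)) σ₃ | get-set-if r j (xs ʳ++ (g ∷ get j σ)) σ
        | get-set-if r j (g ∷ get j σ₂) σ₂ | get-set-if r i (g ∷ get i σ₁) σ₁ | get-set-if r TMP xs σ
        with ⌊ r Fin.≟ TMP ⌋ | ⌊ r Fin.≟ i ⌋ | ⌊ r Fin.≟ j ⌋
      ... | true  | _     | _     = refl
      ... | false | true  | _     = refl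
      ... | false | false | true  = refl
      ... | false | false | false = refl
      count-up : ∀ m → suc (1 + 1 + (1 + 3 * m)) ≡ 1 + 3 * suc m
      count-up = ℕ-Ring.solve-∀

  -- Reading a stack empties and reverses it. The detour through `TMP` reverses twice, and the
  -- second pass refills the source along with the target.
  copy : Fin n → Fin n → Cmd
  copy i j = move→ i TMP ⨾ spread i j

  copy-spec : ∀ {i j} → i ≢ j → i ≢ TMP → j ≢ TMP → ∀ σ → get TMP σ ≡ [] →
              copy i j ⊢ σ ⇒ set j (get i σ ++ get j σ) σ ⟨ 2 + 5 * length (get i σ) ⟩
  copy-spec {i} {j} i≢j i≢t j≢t σ e =
    ⇒-in (⇒-to (move→-spec i≢t σ ⨾ spread-spec i≢j i≢t j≢t σ₁) (mem-ext final))
         (trans (cong (λ m → 1 + 2 * length xs + (1 + 3 * m)) (trans (cong length get-t) len)) (count-up (length xs)))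
    where
    xs = get i σ
    σ₁ = set i [] (set TMP (xs ʳ++ get TMP σ) σ)
    get-t : get TMP σ₁ ≡ xs ʳ++ []
    get-t = trans (get-set-≢ (i≢t ∘ sym) [] (set TMP (xs ʳ++ get TMP σ) σ)) (trans (get-set TMP _ σ) (cong (xs ʳ++_) e))
    len : length (xs ʳ++ []) ≡ length xs
    len = Listₚ.length-reverse xs
    get-i : get i σ₁ ≡ []
    get-i = get-set i [] (set TMP (xs ʳ++ get TMP σ) σ)
    get-j : get j σ₁ ≡ get j σ
    get-j = trans (get-set-≢ (i≢j ∘ sym) [] (set TMP (xs ʳ++ get TMP σ) σ)) (get-set-≢ j≢t _ σ)
    restored : get TMP σ₁ ʳ++ get i σ₁ ≡ get i σ
    restored = trans (cong₂ _ʳ++_ get-t get-i) (trans (Listₚ.ʳ++-ʳ++ xs) (Listₚ.++-identityʳ xs))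
    copied : get TMP σ₁ ʳ++ get j σ₁ ≡ xs ++ get j σ
    copied = trans (cong₂ _ʳ++_ get-t get-j) (Listₚ.ʳ++-ʳ++ xs)
    final : ∀ r → get r (set TMP [] (set i (get TMP σ₁ ʳ++ get i σ₁) (set j (get TMP σ₁ ʳ++ get j σ₁) σ₁)))
                ≡ get r (set j (xs ++ get j σ) σ)
    final r rewrite restored | copied
      | get-set-if r TMP [] (set i (get i σ) (set j (xs ++ get j σ) σ₁))
      | get-set-if r i (get i σ) (set j (xs ++ get j σ) σ₁)
      | get-set-if r j (xs ++ get j σ) σ₁ | get-set-if r j (xs ++ get j σ) σ
      | get-set-if r i [] (set TMP (xs ʳ++ get TMP σ) σ) | get-set-if r TMP (xs ʳ++ get TMP σ) σ
      with r Fin.≟ TMP | r Fin.≟ i | r Fin.≟ j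
    ... | yes refl | _        | yes r≡j  = ⊥-elim (j≢t (sym r≡j))
    ... | yes refl | _        | no _     = sym e
    ... | no _     | yes refl | yes r≡j  = ⊥-elim (i≢j r≡j)
    ... | no _     | yes refl | no _     = refl
    ... | no _     | no _     | yes refl = refl
    ... | no _     | no _     | no _     = refl
    count-up : ∀ m → 1 + 2 * m + (1 + 3 * m) ≡ 2 + 5 * m
    count-up = ℕ-Ring.solve-∀

  pick : Fin n → Maybe Γ → Cmd
  pick d nothing  = skip
  pick d (just g) = push d g

  -- Popping an empty stack changes nothing, so a stack shorter than the counter just yields a
  -- shorter block. This agrees with `take` and `drop` and keeps the programs total.
  collect : Fin n → Cmd
  collect s = loop CNT never (λ _ → pop s (pick TMP))

  collect-spec : ∀ {s} → s ≢ CNT → s ≢ TMP → CNT ≢ TMP → ∀ σ → let m = length (get CNT σ) in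
    collect s ⊢ σ ⇒ set CNT [] (set s (drop m (get s σ)) (set TMP (take m (get s σ) ʳ++ get TMP σ) σ)) ⟨ 1 + 3 * m ⟩
  collect-spec {s} s≢c s≢t c≢t σ = go (get CNT σ) σ refl
    where
    open ≡-Reasoning
    count-up : ∀ m → suc (2 + (1 + 3 * m)) ≡ 1 + 3 * suc m
    count-up = ℕ-Ring.solve-∀
    go : ∀ cs σ → get CNT σ ≡ cs → let m = length cs in
         collect s ⊢ σ ⇒ set CNT [] (set s (drop m (get s σ)) (set TMP (take m (get s σ) ʳ++ get TMP σ) σ)) ⟨ 1 + 3 * m ⟩
    go [] σ e = ⇒-to (loop-[] e) (sym (begin
      set CNT [] (set s (get s σ) (set TMP (get TMP σ) σ))  ≡⟨ cong (λ τ → set CNT [] (set s (get s σ) τ)) (set-get TMP σ) ⟩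
      set CNT [] (set s (get s σ) σ)                        ≡⟨ cong (set CNT []) (set-get s σ) ⟩
      set CNT [] σ                                          ≡⟨ cong (λ v → set CNT v σ) (sym e) ⟩
      set CNT (get CNT σ) σ                                 ≡⟨ set-get CNT σ ⟩
      σ                                                     ∎))
    go (c ∷ cs) σ e with get s σ in es
    ... | [] = ⇒-in (⇒-to (loop-∷ e refl skip' (go cs σ₁ (get-set CNT cs σ))) (mem-ext final)) (count-up (length cs))
      where
      σ₁ = set CNT cs σ
      get-s : get s σ₁ ≡ []
      get-s = trans (get-set-≢ s≢c cs σ) es
      get-t : get TMP σ₁ ≡ get TMP σ
      get-t = get-set-≢ (c≢t ∘ sym) cs σ
      skip' : pop s (pick TMP) ⊢ σ₁ ⇒ σ₁ ⟨ 2 ⟩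
      skip' = pop-[] get-s skip
      final : ∀ r → get r (set CNT [] (set s (drop (length cs) (get s σ₁)) (set TMP (take (length cs) (get s σ₁) ʳ++ get TMP σ₁) σ₁)))
                  ≡ get r (set CNT [] (set s [] (set TMP (get TMP σ) σ)))
      final r rewrite get-s | get-t | Listₚ.take-[] {A = Γ} (length cs) | Listₚ.drop-[] {A = Γ} (length cs)
        | get-set-if r CNT [] (set s [] (set TMP (get TMP σ) σ₁)) | get-set-if r CNT [] (set s [] (set TMP (get TMP σ) σ))
        | get-set-if r s [] (set TMP (get TMP σ) σ₁) | get-set-if r s [] (set TMP (get TMP σ) σ)
        | get-set-if r TMP (get TMP σ) σ₁ | get-set-if r TMP (get TMP σ) σ | get-set-if r CNT cs σ
        with ⌊ r Fin.≟ CNT ⌋ | ⌊ r Fin.≟ s ⌋ | ⌊ r Fin.≟ TMP ⌋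
      ... | true  | _     | _     = refl
      ... | false | true  | _     = refl
      ... | false | false | true  = refl
      ... | false | false | false = refl
    ... | g ∷ gs = ⇒-in (⇒-to (loop-∷ e refl (pop-∷ get-s₁ push) (go cs σ₃ popped)) (mem-ext final)) (count-up (length cs))
      where
      σ₁ = set CNT cs σ
      σ₂ = set s gs σ₁
      σ₃ = set TMP (g ∷ get TMP σ₂) σ₂
      get-s₁ : get s σ₁ ≡ g ∷ gs
      get-s₁ = trans (get-set-≢ s≢c cs σ) es
      popped : get CNT σ₃ ≡ cs
      popped = trans (get-set-≢ c≢t _ σ₂) (trans (get-set-≢ (s≢c ∘ sym) gs σ₁) (get-set CNT cs σ))
      get-s : get s σ₃ ≡ gs
      get-s = trans (get-set-≢ s≢t _ σ₂) (get-set s gs σ₁)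
      get-t₂ : get TMP σ₂ ≡ get TMP σ
      get-t₂ = trans (get-set-≢ (s≢t ∘ sym) gs σ₁) (get-set-≢ (c≢t ∘ sym) cs σ)
      get-t : get TMP σ₃ ≡ g ∷ get TMP σ
      get-t = trans (get-set TMP _ σ₂) (cong (g ∷_) get-t₂)
      rest : List Γ
      rest = drop (length cs) gs
      taken : List Γ
      taken = take (length cs) gs ʳ++ (g ∷ get TMP σ)
      final : ∀ r → get r (set CNT [] (set s (drop (length cs) (get s σ₃)) (set TMP (take (length cs) (get s σ₃) ʳ++ get TMP σ₃) σ₃)))
                  ≡ get r (set CNT [] (set s rest (set TMP taken σ)))
      final r rewrite get-s | get-t
        | get-set-if r CNT [] (set s rest (set TMP taken σ₃)) | get-set-if r CNT [] (set s rest (set TMP taken σ))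
        | get-set-if r s rest (set TMP taken σ₃) | get-set-if r s rest (set TMP taken σ)
        | get-set-if r TMP taken σ₃ | get-set-if r TMP taken σ
        | get-set-if r TMP (g ∷ get TMP σ₂) σ₂ | get-set-if r s gs σ₁ | get-set-if r CNT cs σ
        with ⌊ r Fin.≟ CNT ⌋ | ⌊ r Fin.≟ s ⌋ | ⌊ r Fin.≟ TMP ⌋
      ... | true  | _     | _     = refl
      ... | false | true  | _     = refl
      ... | false | false | true  = refl
      ... | false | false | false = refl

  chop : Fin n → Fin n → Fin n → Cmd
  chop w s d = copy w CNT ⨾ collect s ⨾ move→ TMP d

  chop-spec : ∀ {w s d} → w ≢ CNT → w ≢ TMP → s ≢ CNT → s ≢ TMP → d ≢ CNT → d ≢ TMP → w ≢ s → s ≢ d → CNT ≢ TMP →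
    ∀ σ → get TMP σ ≡ [] → get CNT σ ≡ [] → let m = length (get w σ) in
    chop w s d ⊢ σ ⇒ set s (drop m (get s σ)) (set d (take m (get s σ) ++ get d σ) σ) ⟨ 4 + 10 * m ⟩
  chop-spec {w} {s} {d} w≢c w≢t s≢c s≢t d≢c d≢t w≢s s≢d c≢t σ et ec =
    ⇒-to (weaken bound (copy-spec w≢c w≢t c≢t σ et ⨾ collect-spec s≢c s≢t c≢t σ₁ ⨾ move→-spec (d≢t ∘ sym) σ₂)) (mem-ext final)
    where
    m = length (get w σ)
    σ₁ = set CNT (get w σ ++ get CNT σ) σ
    m₁ = length (get CNT σ₁)
    σ₂ = set CNT [] (set s (drop m₁ (get s σ₁)) (set TMP (take m₁ (get s σ₁) ʳ++ get TMP σ₁) σ₁))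
    m₁≡m : m₁ ≡ m
    m₁≡m = cong length (trans (get-set CNT _ σ) (trans (cong (get w σ ++_) ec) (Listₚ.++-identityʳ _)))
    get-s₁ : get s σ₁ ≡ get s σ
    get-s₁ = get-set-≢ s≢c _ σ
    get-t₁ : get TMP σ₁ ≡ []
    get-t₁ = trans (get-set-≢ (c≢t ∘ sym) _ σ) et
    block rest : List Γ
    block = take m (get s σ)
    rest  = drop m (get s σ)
    get-t₂ : get TMP σ₂ ≡ block ʳ++ []
    get-t₂ = trans (get-set-≢ (c≢t ∘ sym) [] _) (trans (get-set-≢ (s≢t ∘ sym) _ _) (trans (get-set TMP _ σ₁)
               (cong₂ _ʳ++_ (cong₂ take m₁≡m get-s₁) get-t₁)))
    get-d₂ : get d σ₂ ≡ get d σ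
    get-d₂ = trans (get-set-≢ d≢c [] _) (trans (get-set-≢ (s≢d ∘ sym) _ _) (trans (get-set-≢ d≢t _ σ₁) (get-set-≢ d≢c _ σ)))
    moved : get TMP σ₂ ʳ++ get d σ₂ ≡ block ++ get d σ
    moved = trans (cong₂ _ʳ++_ get-t₂ get-d₂) (Listₚ.ʳ++-ʳ++ block)
    final : ∀ r → get r (set TMP [] (set d (get TMP σ₂ ʳ++ get d σ₂) σ₂)) ≡ get r (set s rest (set d (block ++ get d σ) σ))
    final r rewrite moved
      | get-set-if r TMP [] (set d (block ++ get d σ) σ₂) | get-set-if r d (block ++ get d σ) σ₂
      | get-set-if r s rest (set d (block ++ get d σ) σ) | get-set-if r d (block ++ get d σ) σ
      | get-set-if r CNT [] (set s (drop m₁ (get s σ₁)) (set TMP (take m₁ (get s σ₁) ʳ++ get TMP σ₁) σ₁))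
      | get-set-if r s (drop m₁ (get s σ₁)) (set TMP (take m₁ (get s σ₁) ʳ++ get TMP σ₁) σ₁)
      | get-set-if r TMP (take m₁ (get s σ₁) ʳ++ get TMP σ₁) σ₁ | get-set-if r CNT (get w σ ++ get CNT σ) σ
      with r Fin.≟ TMP | r Fin.≟ d | r Fin.≟ s | r Fin.≟ CNT
    ... | yes refl | _        | yes r≡s  | _        = ⊥-elim (s≢t (sym r≡s))
    ... | yes refl | yes r≡d  | no _     | _        = ⊥-elim (d≢t (sym r≡d))
    ... | yes refl | no _     | no _     | _        = sym et
    ... | no _     | yes refl | yes r≡s  | _        = ⊥-elim (s≢d (sym r≡s))
    ... | no _     | yes refl | no _     | _        = refl
    ... | no _     | no _     | yes refl | yes r≡c  = ⊥-elim (s≢c r≡c)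
    ... | no _     | no _     | yes refl | no _     = cong₂ drop m₁≡m get-s₁
    ... | no _     | no _     | no _     | yes refl = sym ec
    ... | no _     | no _     | no _     | no _     = refl
    bound : 2 + 5 * m + (1 + 3 * m₁ + (1 + 2 * length (get TMP σ₂))) ≤ 4 + 10 * m
    bound = begin
      2 + 5 * m + (1 + 3 * m₁ + (1 + 2 * length (get TMP σ₂)))  ≡⟨ cong₂ (λ a b → 2 + 5 * m + (1 + 3 * a + (1 + 2 * b))) m₁≡m
                                                                      (trans (cong length get-t₂) (Listₚ.length-reverse block)) ⟩
      2 + 5 * m + (1 + 3 * m + (1 + 2 * length block))          ≤⟨ +-monoʳ-≤ (2 + 5 * m) (+-monoʳ-≤ (1 + 3 * m) (+-monoʳ-≤ 1 (*-monoʳ-≤ 2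
                                                                      (≤-trans (≤-reflexive (Listₚ.length-take m (get s σ))) (m⊓n≤m m _))))) ⟩
      2 + 5 * m + (1 + 3 * m + (1 + 2 * m))                     ≡⟨ count-up m ⟩
      4 + 10 * m                                                ∎
      where
      open ≤-Reasoning
      count-up : ∀ m → 2 + 5 * m + (1 + 3 * m + (1 + 2 * m)) ≡ 4 + 10 * m
      count-up = ℕ-Ring.solve-∀

  copy-fresh : ∀ {i j} → i ≢ j → i ≢ TMP → j ≢ TMP → ∀ σ → get TMP σ ≡ [] → get j σ ≡ [] →
               copy i j ⊢ σ ⇒ set j (get i σ) σ ⟨ 2 + 5 * length (get i σ) ⟩
  copy-fresh {i} {j} i≢j i≢t j≢t σ et ej = ⇒-to (copy-spec i≢j i≢t j≢t σ et)
    (cong (λ v → set j v σ) (trans (cong (get i σ ++_) ej) (Listₚ.++-identityʳ (get i σ))))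

  chop-fresh : ∀ {w s d} → w ≢ CNT → w ≢ TMP → s ≢ CNT → s ≢ TMP → d ≢ CNT → d ≢ TMP → w ≢ s → s ≢ d → CNT ≢ TMP →
    ∀ σ → get TMP σ ≡ [] → get CNT σ ≡ [] → get d σ ≡ [] → let m = length (get w σ) in
    chop w s d ⊢ σ ⇒ set s (drop m (get s σ)) (set d (take m (get s σ)) σ) ⟨ 4 + 10 * m ⟩
  chop-fresh {w} {s} {d} a b c e f g h i j σ et ec ed = ⇒-to (chop-spec a b c e f g h i j σ et ec)
    (cong (λ v → set s (drop (length (get w σ)) (get s σ)) (set d v σ))
          (trans (cong (take (length (get w σ)) (get s σ) ++_) ed) (Listₚ.++-identityʳ _)))

-- Running the given verifier

hornerCost : Poly → ℕ → ℕ
hornerCost []       n = 1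
hornerCost (c ∷ cs) n = hornerCost cs n + ((1 + eval cs n * (3 + 5 * n)) + ((c + 1) + (1 + 2 * (c + n * eval cs n))))

testCost : Poly → ℕ → ℕ → ℕ
testCost p k m = (1 + k * 3 + 5 * m) + ((2 + 5 * m) + (hornerCost p m + ((1 + 2 * m) + (2 + (1 +
                 ((1 + eval p m * 8) + (2 + (2 + 2 * (eval p m + (m + 1))))))))))

module Registers (V : TM) (p : Poly) where

  open TM V using (nStates; start; accept; δ)

  -- States of the simulated machine are stack symbols too: the current one is kept on `ST`, and a
  -- pop branches on it.
  Γ : Set
  Γ = Sym V ⊎ Fin nStates

  mark comma : Γ
  mark  = inj₁ (blank V)
  comma = inj₁ (sep V)

  -- States never occur on the tape; they are read as blanks.
  toSym : Γ → Sym V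
  toSym (inj₁ s) = s
  toSym (inj₂ _) = blank V

  -- QC, KC, LC, MC, UC and LQ hold unary numbers; CS, CT, CA, CB, CR are the two challenges, the two answers and the
  -- coins of the current trial; YT and BT are the second prover's parts of the challenge Y and the answer B; WT, WB, WR
  -- are consumable copies of YT, BT and COINS; LN and UN are loop counters.
  INP TMP X Y B COINS QC KC LC MC UC LQ CS CT CA CB CR WT WB WR CNT UU ACC ACC2 LEFT RIGHT ST POS NEG YT BT LN UN : Fin 33
  INP = # 0
  TMP = # 1
  X = # 2
  Y = # 3
  B = # 4
  COINS = # 5
  QC = # 6
  KC = # 7
  LC = # 8
  MC = # 9
  UC = # 10
  LQ = # 11
  CS = # 12
  CT = # 13
  CA = # 14
  CB = # 15
  CR = # 16
  WT = # 17
  WB = # 18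
  WR = # 19
  CNT = # 20
  UU = # 21
  ACC = # 22
  ACC2 = # 23
  LEFT = # 24
  RIGHT = # 25
  ST = # 26
  POS = # 27
  NEG = # 28
  YT = # 29
  BT = # 30
  LN = # 31
  UN = # 32

  open Macros {Γ} 33 TMP CNT public

  State : Set
  State = Mem Γ 33

  -- Specifications run between memories whose scratch registers are visibly empty. Side conditions
  -- such as `get TMP σ ≡ []` then hold by `refl`, and consecutive calls compose without rewriting.
  clean : State → State
  clean σ = set TMP [] (set CNT [] (set UU [] (set ACC [] (set ACC2 [] (set LEFT [] (set RIGHT [] (set ST [] σ)))))))

  addMul : Cmd
  addMul = loop ACC never (λ _ → copy UU ACC2)

  addMul-spec : ∀ xs σ → get ACC σ ≡ xs → get TMP σ ≡ [] → ∃ λ zs →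
    length zs ≡ length xs * length (get UU σ) + length (get ACC2 σ) ×
    addMul ⊢ σ ⇒ set ACC [] (set ACC2 zs σ) ⟨ 1 + length xs * (3 + 5 * length (get UU σ)) ⟩
  addMul-spec [] σ e et = get ACC2 σ , refl , ⇒-to (loop-[] e) (cong (λ v → set ACC v σ) e)
  addMul-spec (g ∷ xs) σ e et with addMul-spec xs (set ACC2 (get UU σ ++ get ACC2 σ) (set ACC xs σ)) refl et
  ... | zs , len , d = zs ,
        trans len (trans (cong (length xs * length (get UU σ) +_) (Listₚ.length-++ (get UU σ))) (shuffle (length xs) (length (get UU σ)) _)) ,
        ⇒-in (loop-∷ e refl (copy-spec (λ ()) (λ ()) (λ ()) (set ACC xs σ) et) d) (count-up (length xs) (5 * length (get UU σ)))
    where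
    shuffle : ∀ a n c → a * n + (n + c) ≡ suc a * n + c
    shuffle = ℕ-Ring.solve-∀
    count-up : ∀ a n → suc (2 + n + (1 + a * (3 + n))) ≡ 1 + suc a * (3 + n)
    count-up = ℕ-Ring.solve-∀

  pushMarks : ℕ → Cmd
  pushMarks zero    = skip
  pushMarks (suc c) = push ACC2 mark ⨾ pushMarks c

  pushMarks-spec : ∀ c σ → ∃ λ zs → length zs ≡ c + length (get ACC2 σ) × pushMarks c ⊢ σ ⇒ set ACC2 zs σ ⟨ c + 1 ⟩
  pushMarks-spec zero    σ = get ACC2 σ , refl , skip
  pushMarks-spec (suc c) σ with pushMarks-spec c (set ACC2 (mark ∷ get ACC2 σ) σ)
  ... | zs , len , d = zs , trans len (+-suc c _) , push ⨾ d

  -- Horner's scheme in unary. Only lengths carry meaning, so any word can serve as the argument and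
  -- the result is specified up to its length.
  horner : Poly → Cmd
  horner []       = skip
  horner (c ∷ cs) = horner cs ⨾ addMul ⨾ pushMarks c ⨾ move→ ACC2 ACC

  horner-spec : ∀ P σ → let σ₀ = set TMP [] (set ACC [] (set ACC2 [] σ)) ; n = length (get UU σ) in ∃ λ ys →
    length ys ≡ eval P n × horner P ⊢ σ₀ ⇒ set ACC ys σ₀ ⟨ hornerCost P n ⟩
  horner-spec []       σ = [] , refl , skip
  horner-spec (c ∷ cs) σ with horner-spec cs σ
  ... | xs , lx , dx with addMul-spec xs (set ACC xs (set TMP [] (set ACC2 [] σ))) refl refl
  ... | ys , ly , dy with pushMarks-spec c (set ACC [] (set ACC2 ys (set TMP [] σ)))
  ... | zs , lz , dz = zs ʳ++ [] ,
        trans (Listₚ.length-reverse zs) |zs| ,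
        ⇒-in (dx ⨾ dy ⨾ dz ⨾ move→-spec (λ ()) (set ACC [] (set ACC2 zs (set TMP [] σ))))
             (cong₂ (λ a b → hornerCost cs n + (1 + a * (3 + 5 * n) + (c + 1 + (1 + 2 * b)))) lx |zs|)
    where
    n = length (get UU σ)
    |zs| : length zs ≡ c + n * eval cs n
    |zs| = trans lz (cong (c +_) (trans ly (trans (+-identityʳ _) (trans (cong (_* n) lx) (*-comm (eval cs n) n)))))

  joinOnto : List (List Γ) → List Γ → List Γ
  joinOnto []           acc = acc
  joinOnto (w ∷ [])     acc = w ++ acc
  joinOnto (w ∷ v ∷ ws) acc = w ++ comma ∷ joinOnto (v ∷ ws) acc

  -- The fields are added from last to first because the top of `RIGHT` is to be the first cell of
  -- the simulated tape.
  build : List (Fin 33) → Cmd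
  build []           = skip
  build (i ∷ [])     = copy i RIGHT
  build (i ∷ j ∷ is) = build (j ∷ is) ⨾ push RIGHT comma ⨾ copy i RIGHT

  contents : List (Fin 33) → State → List (List Γ)
  contents is σ = map (λ i → get i σ) is

  build-spec : ∀ is → All (λ i → i ≢ RIGHT × i ≢ TMP) is → ∀ σ → get TMP σ ≡ [] →
    build is ⊢ σ ⇒ set RIGHT (joinOnto (contents is σ) (get RIGHT σ)) σ ⟨ 1 + length is * 3 + 5 * length (joinOnto (contents is σ) (get RIGHT σ)) ⟩
  build-spec [] [] σ et = weaken (s≤s z≤n) skip
  build-spec (i ∷ []) ((i≢r , i≢t) ∷ []) σ et =
    weaken (+-mono-≤ {2} {4} (s≤s (s≤s z≤n)) (*-monoʳ-≤ 5 (≤-trans (m≤m+n (length (get i σ)) (length (get RIGHT σ))) (≤-reflexive (sym (Listₚ.length-++ (get i σ)))))))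
           (copy-spec i≢r i≢t (λ ()) σ et)
  build-spec (i ∷ j ∷ is) ((i≢r , i≢t) ∷ ne) σ et =
    ⇒-to (weaken bound (build-spec (j ∷ is) ne σ et ⨾ push ⨾ copy-spec i≢r i≢t (λ ()) σ₂ et)) final
    where
    acc : List Γ
    acc = joinOnto (contents (j ∷ is) σ) (get RIGHT σ)
    σ₂ : State
    σ₂ = set RIGHT (comma ∷ acc) σ
    kept : get i σ₂ ≡ get i σ
    kept = get-set-≢ i≢r _ σ
    final : set RIGHT (get i σ₂ ++ comma ∷ acc) σ₂ ≡ set RIGHT (get i σ ++ comma ∷ acc) σ
    final rewrite kept = refl
    bound : 1 + suc (length is) * 3 + 5 * length acc + (1 + (2 + 5 * length (get i σ₂))) ≤
            1 + (2 + length is) * 3 + 5 * length (get i σ ++ comma ∷ acc)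
    bound rewrite kept | Listₚ.length-++ (get i σ) {comma ∷ acc} =
      ≤-trans (m≤m+n _ 5) (≤-reflexive (count-up (length is) (length acc) (length (get i σ))))
      where
      count-up : ∀ a b c → 1 + suc a * 3 + 5 * b + (1 + (2 + 5 * c)) + 5 ≡ 1 + (2 + a) * 3 + 5 * (c + suc b)
      count-up = ℕ-Ring.solve-∀

  tapeMove : Move → Sym V → Cmd
  tapeMove L a = pop LEFT λ where
    nothing  → push RIGHT (inj₁ a) ⨾ push RIGHT mark
    (just b) → push RIGHT (inj₁ a) ⨾ push RIGHT b
  tapeMove R a = push LEFT (inj₁ a) ⨾ pop RIGHT λ where
    nothing  → push RIGHT mark
    (just b) → push RIGHT b
  tapeMove S a = push RIGHT (inj₁ a)

  transition : Sym V → Fin nStates → Cmd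
  transition a q = let (q' , a' , m) = δ q a in tapeMove m a' ⨾ push ST (inj₂ q')

  stepHead : Fin nStates → Maybe Γ → Cmd
  stepHead q nothing  = skip
  stepHead q (just g) = transition (toSym g) q

  stepState : Maybe Γ → Cmd
  stepState (just (inj₂ q)) = if halted V q then push ST (inj₂ q) else pop RIGHT (stepHead q)
  stepState _               = skip

  stepCmd : Cmd
  stepCmd = pop ST stepState

  -- The tops of both stacks face the head: the right stack starts with the scanned cell itself, the
  -- left one with its left neighbour.
  record Represents (C : Config V) (l r : List Γ) : Set where
    constructor represents
    field
      left≡  : map toSym l ≡ Config.left C
      right≡ : map toSym r ≡ Config.head C ∷ Config.right C

  withTape : List Γ → List Γ → Fin nStates → State → State
  withTape l r q σ = set LEFT l (set RIGHT r (set ST (inj₂ q ∷ []) σ))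

  move-state : ∀ m l a r q → Config.state (move V m l a r q) ≡ q
  move-state L []      a r       q = refl
  move-state L (_ ∷ _) a r       q = refl
  move-state R l       a []      q = refl
  move-state R l       a (_ ∷ _) q = refl
  move-state S l       a r       q = refl

  transition-spec : ∀ {q a q' a' m σ σ' t} → δ q a ≡ (q' , a' , m) → tapeMove m a' ⊢ σ ⇒ σ' ⟨ t ⟩ →
                    transition a q ⊢ σ ⇒ set ST (inj₂ q' ∷ get ST σ') σ' ⟨ t + 1 ⟩
  transition-spec {q} {a} e d rewrite e = d ⨾ push

  state-halted : ∀ {q σ σ' t} → halted V q ≡ true → push ST (inj₂ q) ⊢ σ ⇒ σ' ⟨ t ⟩ →
                 stepState (just (inj₂ q)) ⊢ σ ⇒ σ' ⟨ t ⟩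
  state-halted e d rewrite e = d

  state-running : ∀ {q σ σ' t} → halted V q ≡ false → pop RIGHT (stepHead q) ⊢ σ ⇒ σ' ⟨ t ⟩ →
                  stepState (just (inj₂ q)) ⊢ σ ⇒ σ' ⟨ t ⟩
  state-running e d rewrite e = d

  step-spec : ∀ C l r σ → Represents C l r → ∃ λ l' → ∃ λ r' → Represents (step V C) l' r' ×
    length l' + length r' ≤ suc (length l + length r) ×
    stepCmd ⊢ withTape l r (Config.state C) σ ⇒ withTape l' r' (Config.state (step V C)) σ ⟨ 7 ⟩
  step-spec (cfg q cl ch cr) l r σ ρ with halted V q in eq
  ... | true = l , r , ρ , n≤1+n _ , weaken (s≤s (s≤s z≤n)) (pop-∷ refl (state-halted eq push))
  step-spec (cfg q cl ch cr) l (g ∷ r) σ (represents e₁ refl) | false with δ q (toSym g) in eδ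
  ... | q' , a' , m with moved m l r e₁
    where
    moved : ∀ m l r → map toSym l ≡ cl → ∃ λ l' → ∃ λ r' → Represents (move V m cl a' (map toSym r) q') l' r' ×
            length l' + length r' ≤ suc (length l + suc (length r)) ×
            tapeMove m a' ⊢ set LEFT l (set RIGHT r (set ST [] σ)) ⇒ set LEFT l' (set RIGHT r' (set ST [] σ)) ⟨ 3 ⟩
    moved L [] r refl = [] , mark ∷ inj₁ a' ∷ r , represents refl refl , ≤-refl , pop-[] refl (push ⨾ push)
    moved L (b ∷ l) r refl = l , b ∷ inj₁ a' ∷ r , represents refl refl ,
      ≤-trans (≤-reflexive (+-suc (length l) (suc (length r)))) (n≤1+n _) , pop-∷ refl (push ⨾ push)
    moved R l [] refl = inj₁ a' ∷ l , mark ∷ [] , represents refl refl , ≤-refl , push ⨾ pop-[] refl push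
    moved R l (b ∷ r) refl = inj₁ a' ∷ l , b ∷ r , represents refl refl ,
      s≤s (+-monoʳ-≤ (length l) (n≤1+n _)) , push ⨾ pop-∷ refl push
    moved S l r refl = l , inj₁ a' ∷ r , represents refl refl , n≤1+n _ , weaken (s≤s z≤n) push
  ... | l' , r' , ρ' , len , d = l' , r' , ρ' , len ,
        pop-∷ refl (state-running eq (weaken (n≤1+n 5) (pop-∷ refl (transition-spec (trans eδ (cong (_, a' , m) (sym (move-state m cl a' (map toSym r) q')))) d))))

  simulate-spec : ∀ xs C l r σ → Represents C l r → ∃ λ l' → ∃ λ r' → Represents (run V (length xs) C) l' r' ×
    length l' + length r' ≤ length xs + (length l + length r) ×
    loop ACC never (λ _ → stepCmd) ⊢ set ACC xs (withTape l r (Config.state C) σ) ⇒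
      set ACC [] (withTape l' r' (Config.state (run V (length xs) C)) σ) ⟨ 1 + length xs * 8 ⟩
  simulate-spec [] C l r σ ρ = l , r , ρ , ≤-refl , loop-[] refl
  simulate-spec (x ∷ xs) C l r σ ρ with step-spec C l r (set ACC xs σ) ρ
  ... | l₁ , r₁ , ρ₁ , len₁ , d₁ with simulate-spec xs (step V C) l₁ r₁ σ ρ₁
  ... | l₂ , r₂ , ρ₂ , len₂ , d₂ = l₂ , r₂ , ρ₂ ,
        ≤-trans len₂ (≤-trans (+-monoʳ-≤ (length xs) len₁) (≤-reflexive (+-suc (length xs) _))) ,
        ⇒-in (loop-∷ refl refl d₁ d₂) (count-up (length xs))
    where
    count-up : ∀ a → suc (7 + (1 + a * 8)) ≡ 1 + suc a * 8
    count-up = ℕ-Ring.solve-∀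

  firstCell : Maybe Γ → Cmd
  firstCell nothing  = push RIGHT mark
  firstCell (just g) = push RIGHT g

  report : Maybe Γ → Cmd
  report (just (inj₂ q)) = if ⌊ q Fin.≟ accept ⌋ then push POS mark else push NEG mark
  report _               = skip

  -- The clock of `acceptsWithin` is reproduced: `eval p` of the tape length is computed in unary on
  -- `ACC`, from a copy of the tape, and drives the simulation loop. Clearing both sides of the tape
  -- readies the registers for the next trial.
  test : List (Fin 33) → Cmd
  test is = build is ⨾ copy RIGHT UU ⨾ horner p ⨾ clear UU ⨾ pop RIGHT firstCell ⨾ push ST (inj₂ start) ⨾
            loop ACC never (λ _ → stepCmd) ⨾ pop ST report ⨾ clear LEFT ⨾ clear RIGHT

  accepts : List Γ → Bool
  accepts w = ⌊ Config.state (run V (eval p (length w)) (initial V (map toSym w))) Fin.≟ accept ⌋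

  tally : Bool → State → State
  tally b σ = set POS (if b then mark ∷ get POS σ else get POS σ) (set NEG (if b then get NEG σ else mark ∷ get NEG σ) σ)

  joined : List (Fin 33) → State → List Γ
  joined is σ = joinOnto (contents is σ) []

  initial-spec : ∀ w σ → ∃ λ r → Represents (initial V (map toSym w)) [] r × length r ≤ length w + 1 ×
    pop RIGHT firstCell ⊢ set RIGHT w σ ⇒ set RIGHT r σ ⟨ 2 ⟩
  initial-spec []      σ = mark ∷ [] , represents refl refl , ≤-refl , pop-[] refl push
  initial-spec (g ∷ w) σ = g ∷ w , represents refl refl , m≤m+n _ 1 , pop-∷ refl push

  initial-state : ∀ w → Config.state (initial V w) ≡ start
  initial-state []      = refl
  initial-state (_ ∷ _) = refl

  report-spec : ∀ q l r σ → pop ST report ⊢ withTape l r q σ ⇒ tally ⌊ q Fin.≟ accept ⌋ (set LEFT l (set RIGHT r (set ST [] σ))) ⟨ 2 ⟩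
  report-spec q l r σ = pop-∷ refl (chosen ⌊ q Fin.≟ accept ⌋)
    where
    chosen : ∀ b → (if b then push POS mark else push NEG mark) ⊢ set LEFT l (set RIGHT r (set ST [] σ)) ⇒
             tally b (set LEFT l (set RIGHT r (set ST [] σ))) ⟨ 1 ⟩
    chosen true  = push
    chosen false = push

  test-spec : ∀ is → All (λ i → i ≢ RIGHT × i ≢ TMP) is → ∀ σ → let w = joined is (clean σ) in
    test is ⊢ clean σ ⇒ clean (tally (accepts w) σ) ⟨ testCost p (length is) (length w) ⟩
  test-spec is ne σ with joined is (clean σ) | build-spec is ne (clean σ) refl
  ... | w | d₁ with horner-spec p (set UU w (set RIGHT w (clean σ)))
  ... | ys , |ys| , d₂ with initial-spec w (set ACC ys (clean σ))
  ... | r₀ , ρ₀ , len₀ , d₃ with simulate-spec ys (initial V (map toSym w)) [] r₀ (clean σ) ρ₀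
  ... | l , r , ρ , len , d₄ rewrite initial-state (map toSym w) | |ys| =
    weaken (+-monoʳ-≤ (1 + length is * 3 + 5 * m) (+-monoʳ-≤ (2 + 5 * m) (+-monoʳ-≤ (hornerCost p m) (+-monoʳ-≤ (1 + 2 * m)
             (+-monoʳ-≤ 2 (+-monoʳ-≤ 1 (+-monoʳ-≤ (1 + e * 8) (+-monoʳ-≤ 2 clearing))))))))
      (d₁ ⨾ copy-fresh (λ ()) (λ ()) (λ ()) (set RIGHT w (clean σ)) refl refl ⨾ d₂ ⨾
       clear-spec UU (set ACC ys (set UU w (set RIGHT w (clean σ)))) ⨾ d₃ ⨾ push ⨾ d₄ ⨾
       report-spec (Config.state (run V e (initial V (map toSym w)))) l r (clean σ) ⨾
       clear-spec LEFT σ₅ ⨾ clear-spec RIGHT (set LEFT [] σ₅))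
    where
    m e : ℕ
    m = length w
    e = eval p m
    σ₅ : State
    σ₅ = tally (accepts w) (set LEFT l (set RIGHT r (clean σ)))
    -- A simulated step adds at most one cell to the tape, which bounds the length to be cleared by
    -- the clock plus the initial length.
    clearing : (1 + 2 * length l) + (1 + 2 * length r) ≤ 2 + 2 * (e + (m + 1))
    clearing = ≤-trans (≤-reflexive (count-up (length l) (length r)))
                       (+-monoʳ-≤ 2 (*-monoʳ-≤ 2 (≤-trans len (+-monoʳ-≤ e len₀))))
      where
      count-up : ∀ a b → (1 + 2 * a) + (1 + 2 * b) ≡ 2 + 2 * (a + b)
      count-up = ℕ-Ring.solve-∀

-- Polynomials and running times

eval-mono : ∀ P {m n} → m ≤ n → eval P m ≤ eval P n
eval-mono []       le = z≤n
eval-mono (c ∷ cs) le = +-monoʳ-≤ c (*-mono-≤ le (eval-mono cs le))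

infixl 6 _⊞_
infixl 7 _⊠_

_⊞_ : Poly → Poly → Poly
[]       ⊞ Q        = Q
(c ∷ cs) ⊞ []       = c ∷ cs
(c ∷ cs) ⊞ (d ∷ ds) = (c + d) ∷ (cs ⊞ ds)

scale : ℕ → Poly → Poly
scale a []       = []
scale a (c ∷ cs) = a * c ∷ scale a cs

_⊠_ : Poly → Poly → Poly
[]       ⊠ Q = []
(c ∷ cs) ⊠ Q = scale c Q ⊞ (0 ∷ cs ⊠ Q)

_⊙_ : Poly → Poly → Poly
[]       ⊙ Q = []
(c ∷ cs) ⊙ Q = (c ∷ []) ⊞ (Q ⊠ (cs ⊙ Q))

constP : ℕ → Poly
constP c = c ∷ []

eval-⊞ : ∀ P Q n → eval (P ⊞ Q) n ≡ eval P n + eval Q n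
eval-⊞ []       Q        n = refl
eval-⊞ (c ∷ cs) []       n = sym (+-identityʳ _)
eval-⊞ (c ∷ cs) (d ∷ ds) n rewrite eval-⊞ cs ds n = interchange c d n (eval cs n) (eval ds n)
  where
  interchange : ∀ c d n x y → c + d + n * (x + y) ≡ c + n * x + (d + n * y)
  interchange = ℕ-Ring.solve-∀

eval-scale : ∀ a P n → eval (scale a P) n ≡ a * eval P n
eval-scale a []       n = sym (*-zeroʳ a)
eval-scale a (c ∷ cs) n rewrite eval-scale a cs n = factor a c n (eval cs n)
  where
  factor : ∀ a c n x → a * c + n * (a * x) ≡ a * (c + n * x)
  factor = ℕ-Ring.solve-∀

eval-⊠ : ∀ P Q n → eval (P ⊠ Q) n ≡ eval P n * eval Q n
eval-⊠ []       Q n = refl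
eval-⊠ (c ∷ cs) Q n rewrite eval-⊞ (scale c Q) (0 ∷ cs ⊠ Q) n | eval-scale c Q n | eval-⊠ cs Q n =
  factor c n (eval cs n) (eval Q n)
  where
  factor : ∀ c n x y → c * y + n * (x * y) ≡ (c + n * x) * y
  factor = ℕ-Ring.solve-∀

eval-const : ∀ c n → eval (constP c) n ≡ c
eval-const c n = trans (cong (c +_) (*-zeroʳ n)) (+-identityʳ c)

eval-⊙ : ∀ P Q n → eval (P ⊙ Q) n ≡ eval P (eval Q n)
eval-⊙ []       Q n = refl
eval-⊙ (c ∷ cs) Q n rewrite eval-⊞ (c ∷ []) (Q ⊠ (cs ⊙ Q)) n | eval-⊠ Q (cs ⊙ Q) n | eval-⊙ cs Q n =
  cong (_+ eval Q n * eval cs (eval Q n)) (eval-const c n)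

-- An equation and not a bound, since sample sizes and challenge lengths have to be met exactly: the
-- machine computes them with `horner`, and `AM` evaluates the polynomials for challenges and coins.
IsPolynomial : (ℕ → ℕ) → Set
IsPolynomial f = ∃ λ P → ∀ n → f n ≡ eval P n

poly-const : ∀ c → IsPolynomial (λ _ → c)
poly-const c = constP c , λ n → sym (eval-const c n)

poly-id : IsPolynomial (λ n → n)
poly-id = (0 ∷ 1 ∷ []) , λ n → sym (trans (cong (n *_) (eval-const 1 n)) (*-identityʳ n))

poly-+ : ∀ {f g} → IsPolynomial f → IsPolynomial g → IsPolynomial (λ n → f n + g n)
poly-+ (P , e) (Q , h) = P ⊞ Q , λ n → trans (cong₂ _+_ (e n) (h n)) (sym (eval-⊞ P Q n))

poly-* : ∀ {f g} → IsPolynomial f → IsPolynomial g → IsPolynomial (λ n → f n * g n)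
poly-* (P , e) (Q , h) = P ⊠ Q , λ n → trans (cong₂ _*_ (e n) (h n)) (sym (eval-⊠ P Q n))

poly-eval : ∀ P {f} → IsPolynomial f → IsPolynomial (λ n → eval P (f n))
poly-eval P (Q , e) = P ⊙ Q , λ n → trans (cong (eval P) (e n)) (sym (eval-⊙ P Q n))

hornerCost-mono : ∀ P {m n} → m ≤ n → hornerCost P m ≤ hornerCost P n
hornerCost-mono []       le = ≤-refl
hornerCost-mono (c ∷ cs) le =
  +-mono-≤ (hornerCost-mono cs le) (+-mono-≤ (+-monoʳ-≤ 1 (*-mono-≤ (eval-mono cs le) (+-monoʳ-≤ 3 (*-monoʳ-≤ 5 le))))
    (+-monoʳ-≤ (c + 1) (+-monoʳ-≤ 1 (*-monoʳ-≤ 2 (+-monoʳ-≤ c (*-mono-≤ le (eval-mono cs le)))))))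

poly-hornerCost : ∀ P {f} → IsPolynomial f → IsPolynomial (λ n → hornerCost P (f n))
poly-hornerCost []       b = poly-const 1
poly-hornerCost (c ∷ cs) b =
  poly-+ (poly-hornerCost cs b)
    (poly-+ (poly-+ (poly-const 1) (poly-* (poly-eval cs b) (poly-+ (poly-const 3) (poly-* (poly-const 5) b))))
      (poly-+ (poly-const (c + 1)) (poly-+ (poly-const 1) (poly-* (poly-const 2) (poly-+ (poly-const c) (poly-* b (poly-eval cs b)))))))

testCost-mono : ∀ p k {m n} → m ≤ n → testCost p k m ≤ testCost p k n
testCost-mono p k le =
  +-mono-≤ (+-monoʳ-≤ (1 + k * 3) (*-monoʳ-≤ 5 le)) (+-mono-≤ (+-monoʳ-≤ 2 (*-monoʳ-≤ 5 le))
    (+-mono-≤ (hornerCost-mono p le) (+-mono-≤ (+-monoʳ-≤ 1 (*-monoʳ-≤ 2 le)) (+-monoʳ-≤ 2 (+-monoʳ-≤ 1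
      (+-mono-≤ (+-monoʳ-≤ 1 (*-monoˡ-≤ 8 (eval-mono p le))) (+-monoʳ-≤ 2 (+-monoʳ-≤ 2
        (*-monoʳ-≤ 2 (+-mono-≤ (eval-mono p le) (+-monoˡ-≤ 1 le)))))))))))

poly-testCost : ∀ p k {f} → IsPolynomial f → IsPolynomial (λ n → testCost p k (f n))
poly-testCost p k b =
  poly-+ (poly-+ (poly-const (1 + k * 3)) (poly-* (poly-const 5) b)) (poly-+ (poly-+ (poly-const 2) (poly-* (poly-const 5) b))
    (poly-+ (poly-hornerCost p b) (poly-+ (poly-+ (poly-const 1) (poly-* (poly-const 2) b)) (poly-+ (poly-const 2) (poly-+ (poly-const 1)
      (poly-+ (poly-+ (poly-const 1) (poly-* (poly-eval p b) (poly-const 8))) (poly-+ (poly-const 2) (poly-+ (poly-const 2)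
        (poly-* (poly-const 2) (poly-+ (poly-eval p b) (poly-+ b (poly-const 1))))))))))))

-- Iterated trials

module _ {A : Set} where

  drops : ℕ → ℕ → List A → List A
  drops q zero    w = w
  drops q (suc k) w = drops q k (drop q w)

  length-drops : ∀ q k w → length (drops q k w) ≤ length w
  length-drops q zero    w = ≤-refl
  length-drops q (suc k) w = ≤-trans (length-drops q k (drop q w)) (≤-trans (≤-reflexive (Listₚ.length-drop q w)) (m∸n≤m _ q))

  rounds : (List A → Bool) → ℕ → ℕ → List A → List Bool
  rounds D q zero    w = []
  rounds D q (suc k) w = D (take q w) ∷ rounds D q k (drop q w)

  -- Blocks are cut off with `take` and `drop`, as `chop` does, so the outcome of the loops is
  -- described exactly for words of every length.
  rounds₂ : (List A → List A → List Bool) → ℕ → ℕ → List A → List A → List Bool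
  rounds₂ E q zero    v w = []
  rounds₂ E q (suc k) v w = E (take q v) (take q w) ++ rounds₂ E q k (drop q v) (drop q w)

  length-rounds : ∀ (E : List A → Bool) q k v → length (rounds E q k v) ≡ k
  length-rounds E q zero    v = refl
  length-rounds E q (suc k) v = cong suc (length-rounds E q k (drop q v))

  length-rounds₂ : ∀ (E : List A → List A → List Bool) q k v v' {c} → (∀ s a → length (E s a) ≡ c) →
                   length (rounds₂ E q k v v') ≡ k * c
  length-rounds₂ E q zero    v v' h = refl
  length-rounds₂ E q (suc k) v v' h =
    trans (Listₚ.length-++ (E (take q v) (take q v'))) (cong₂ _+_ (h _ _) (length-rounds₂ E q k (drop q v) (drop q v') h))

  length-take-≤ : ∀ q (w : List A) {N} → length w ≤ N → length (take q w) ≤ N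
  length-take-≤ q w le = ≤-trans (≤-reflexive (Listₚ.length-take q w)) (≤-trans (m⊓n≤n q _) le)

  length-drop-≤ : ∀ q (w : List A) {N} → length w ≤ N → length (drop q w) ≤ N
  length-drop-≤ q w le = ≤-trans (≤-reflexive (Listₚ.length-drop q w)) (≤-trans (m∸n≤m _ q) le)

module Loops (V : TM) (p : Poly) where

  open Registers V p public

  poss negs : List Bool → List Γ → List Γ
  poss []       l = l
  poss (b ∷ bs) l = poss bs (if b then mark ∷ l else l)
  negs []       l = l
  negs (b ∷ bs) l = negs bs (if b then l else mark ∷ l)

  poss-++ : ∀ bs cs l → poss cs (poss bs l) ≡ poss (bs ++ cs) l
  poss-++ []       cs l = refl
  poss-++ (b ∷ bs) cs l = poss-++ bs cs _

  negs-++ : ∀ bs cs l → negs cs (negs bs l) ≡ negs (bs ++ cs) l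
  negs-++ []       cs l = refl
  negs-++ (b ∷ bs) cs l = negs-++ bs cs _

  tallies : List Bool → State → State
  tallies bs σ = set POS (poss bs (get POS σ)) (set NEG (negs bs (get NEG σ)) σ)

  isComma : Γ → Bool
  isComma (inj₁ s) = ⌊ s Fin.≟ sep V ⌋
  isComma (inj₂ _) = false

  -- Input symbols are popped last first, so pushing them onto a register restores their order.
  field₁ field₂ : List Γ → List Γ → List Γ
  field₁ acc []      = acc
  field₁ acc (g ∷ w) = if isComma g then acc else field₁ (g ∷ acc) w
  field₂ acc []      = []
  field₂ acc (g ∷ w) = if isComma g then w else field₂ (g ∷ acc) w

  length-field₁ : ∀ acc w → length (field₁ acc w) ≤ length acc + length w
  length-field₁ acc [] = m≤m+n _ 0
  length-field₁ acc (g ∷ w) with isComma g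
  ... | true  = m≤m+n _ _
  ... | false = ≤-trans (length-field₁ (g ∷ acc) w) (≤-reflexive (sym (+-suc (length acc) (length w))))

  length-field₂ : ∀ acc w → length (field₂ acc w) ≤ length w
  length-field₂ acc [] = z≤n
  length-field₂ acc (g ∷ w) with isComma g
  ... | true  = n≤1+n _
  ... | false = ≤-trans (length-field₂ (g ∷ acc) w) (n≤1+n _)

  readField : Fin 33 → Cmd
  readField i = loop INP isComma (push i)

  readField-spec : ∀ {i} → i ≢ INP → ∀ σ →
    readField i ⊢ σ ⇒ set INP (field₂ (get i σ) (get INP σ)) (set i (field₁ (get i σ) (get INP σ)) σ) ⟨ 1 + 2 * length (get INP σ) ⟩
  readField-spec {i} i≢ σ = go (get INP σ) σ refl
    where
    count-up : ∀ m → suc (1 + (1 + 2 * m)) ≡ 1 + 2 * suc m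
    count-up = ℕ-Ring.solve-∀
    go : ∀ w σ → get INP σ ≡ w →
      readField i ⊢ σ ⇒ set INP (field₂ (get i σ) w) (set i (field₁ (get i σ) w) σ) ⟨ 1 + 2 * length w ⟩
    go [] σ e = ⇒-to (loop-[] e) (sym (trans (cong (set INP []) (set-get i σ)) (trans (cong (λ v → set INP v σ) (sym e)) (set-get INP σ))))
    go (g ∷ w) σ e with isComma g in eq
    ... | true  = weaken (s≤s z≤n) (⇒-to (loop-stop e eq) (sym (cong (set INP w) (set-get i σ))))
    ... | false = ⇒-in (⇒-to (loop-∷ e eq push (go w σ₂ popped)) final) (count-up (length w))
      where
      σ₁ σ₂ : State
      σ₁ = set INP w σ
      σ₂ = set i (g ∷ get i σ₁) σ₁
      popped : get INP σ₂ ≡ w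
      popped = trans (get-set-≢ (i≢ ∘ sym) _ σ₁) (get-set INP w σ)
      get-i : get i σ₂ ≡ g ∷ get i σ
      get-i = trans (get-set i _ σ₁) (cong (g ∷_) (get-set-≢ i≢ w σ))
      final : set INP (field₂ (get i σ₂) w) (set i (field₁ (get i σ₂) w) σ₂) ≡
              set INP (field₂ (g ∷ get i σ) w) (set i (field₁ (g ∷ get i σ) w) σ)
      final rewrite get-i | set-set i (field₁ (g ∷ get i σ) w) (g ∷ get i σ₁) σ₁ | set-comm i≢ (field₁ (g ∷ get i σ) w) w σ = refl

  setPoly : Poly → Fin 33 → Cmd
  setPoly P d = copy X UU ⨾ horner P ⨾ clear UU ⨾ move→ ACC d

  polyCost : Poly → ℕ → ℕ
  polyCost P n = (2 + 5 * n) + (hornerCost P n + ((1 + 2 * n) + (1 + 2 * eval P n)))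

  setPoly-spec : ∀ P {d} → d ≢ ACC → ∀ σ {N} → length (get X σ) ≤ N → get d (clean σ) ≡ [] → ∃ λ ys →
    length ys ≡ eval P (length (get X σ)) × setPoly P d ⊢ clean σ ⇒ set d ys (clean σ) ⟨ polyCost P N ⟩
  setPoly-spec P {d} d≢ σ {N} le ed with horner-spec P (set UU (get X σ) (clean σ))
  ... | ys , |ys| , dh = ys ʳ++ [] , trans (Listₚ.length-reverse ys) |ys| ,
        weaken (≤-trans (≤-reflexive (cong (λ e → (2 + 5 * n) + (hornerCost P n + ((1 + 2 * n) + (1 + 2 * e)))) |ys|))
                 (+-mono-≤ (+-monoʳ-≤ 2 (*-monoʳ-≤ 5 le)) (+-mono-≤ (hornerCost-mono P le)
                   (+-mono-≤ (+-monoʳ-≤ 1 (*-monoʳ-≤ 2 le)) (+-monoʳ-≤ 1 (*-monoʳ-≤ 2 (eval-mono P le)))))))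
          (⇒-to (copy-fresh (λ ()) (λ ()) (λ ()) (clean σ) refl refl ⨾ dh ⨾
                 clear-spec UU (set ACC ys (set UU (get X σ) (clean σ))) ⨾ move→-spec (d≢ ∘ sym) (set ACC ys (clean σ))) final)
    where
    n = length (get X σ)
    final : set ACC [] (set d (ys ʳ++ get d (set ACC ys (clean σ))) (set ACC ys (clean σ))) ≡ set d (ys ʳ++ []) (clean σ)
    final rewrite get-set-≢ d≢ ys (clean σ) | ed | set-comm d≢ (ys ʳ++ []) ys (clean σ)
                | set-set ACC [] ys (set d (ys ʳ++ []) (clean σ)) = sym (set-comm d≢ (ys ʳ++ []) [] (clean σ))

  six four : List (Fin 33)
  six  = X ∷ CS ∷ CT ∷ CA ∷ CB ∷ CR ∷ []
  four = X ∷ CS ∷ CA ∷ CR ∷ []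

  six-ok : All (λ i → i ≢ RIGHT × i ≢ TMP) six
  six-ok = ((λ ()) , λ ()) ∷ ((λ ()) , λ ()) ∷ ((λ ()) , λ ()) ∷ ((λ ()) , λ ()) ∷ ((λ ()) , λ ()) ∷ ((λ ()) , λ ()) ∷ []

  four-ok : All (λ i → i ≢ RIGHT × i ≢ TMP) four
  four-ok = ((λ ()) , λ ()) ∷ ((λ ()) , λ ()) ∷ ((λ ()) , λ ()) ∷ ((λ ()) , λ ()) ∷ []

  length-joinOnto : ∀ ws {N} → All (λ w → length w ≤ N) ws → length (joinOnto ws []) ≤ length ws * suc N
  length-joinOnto [] [] = z≤n
  length-joinOnto (w ∷ []) {N} (le ∷ []) =
    ≤-trans (≤-reflexive (cong length (Listₚ.++-identityʳ w))) (≤-trans le (≤-trans (n≤1+n N) (m≤m+n (suc N) 0)))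
  length-joinOnto (w ∷ v ∷ ws) {N} (le ∷ les) = begin
    length (w ++ comma ∷ joinOnto (v ∷ ws) [])     ≡⟨ Listₚ.length-++ w ⟩
    length w + suc (length (joinOnto (v ∷ ws) [])) ≡⟨ +-suc (length w) _ ⟩
    suc (length w + length (joinOnto (v ∷ ws) [])) ≤⟨ s≤s (+-mono-≤ le (length-joinOnto (v ∷ ws) les)) ⟩
    suc N + (suc N + length ws * suc N)            ∎
    where open ≤-Reasoning

  -- Nested loops over challenges and coins

  D : List Γ → List Γ → List Γ → List Γ → List Γ → List Γ → Bool
  D x s t a b r = accepts (joinOnto (x ∷ s ∷ t ∷ a ∷ b ∷ r ∷ []) [])

  body₃ : Cmd
  body₃ = chop MC WR CR ⨾ test six ⨾ clear CR

  cost₃ : ℕ → ℕ → ℕ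
  cost₃ N m = (4 + 10 * m) + (testCost p 6 (6 * suc N) + (1 + 2 * N))

  inner-spec : ∀ us σ {N} → let m = length (get MC σ) ; D' = D (get X σ) (get CS σ) (get CT σ) (get CA σ) (get CB σ) in
    All (λ i → length (get i σ) ≤ N) (X ∷ CS ∷ CT ∷ CA ∷ CB ∷ WR ∷ []) →
    loop UN never (λ _ → body₃) ⊢ set UN us (set CR [] (clean σ)) ⇒
      set UN [] (set CR [] (clean (set WR (drops m (length us) (get WR σ)) (tallies (rounds D' m (length us) (get WR σ)) σ))))
      ⟨ 1 + length us * suc (cost₃ N m) ⟩
  inner-spec [] σ les = loop-[] refl
  inner-spec (u ∷ us) σ {N} (lx ∷ ls ∷ lt ∷ la ∷ lb ∷ lw ∷ []) =
    ⇒-in (loop-∷ refl refl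
      (weaken (+-monoʳ-≤ (4 + 10 * m) (+-mono-≤ (testCost-mono p 6 short) (+-monoʳ-≤ 1 (*-monoʳ-≤ 2 lr))))
        (chop-fresh (λ ()) (λ ()) (λ ()) (λ ()) (λ ()) (λ ()) (λ ()) (λ ()) (λ ()) σ₁ refl refl refl ⨾
         test-spec six six-ok σ₂ ⨾ clear-spec CR (clean (tally ok σ₂))))
      (inner-spec us σ₃ (lx ∷ ls ∷ lt ∷ la ∷ lb ∷ length-drop-≤ m (get WR σ) lw ∷ [])))
      (count-up (length us) (cost₃ N m))
    where
    m : ℕ
    m = length (get MC σ)
    r : List Γ
    r = take m (get WR σ)
    lr : length r ≤ N
    lr = length-take-≤ m (get WR σ) lw
    short : length (joinOnto (get X σ ∷ get CS σ ∷ get CT σ ∷ get CA σ ∷ get CB σ ∷ r ∷ []) []) ≤ 6 * suc N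
    short = length-joinOnto (get X σ ∷ get CS σ ∷ get CT σ ∷ get CA σ ∷ get CB σ ∷ r ∷ []) (lx ∷ ls ∷ lt ∷ la ∷ lb ∷ lr ∷ [])
    ok : Bool
    ok = D (get X σ) (get CS σ) (get CT σ) (get CA σ) (get CB σ) r
    σ₁ σ₂ σ₃ : State
    σ₁ = set UN us (set CR [] (clean σ))
    σ₂ = set WR (drop m (get WR σ)) (set CR r σ₁)
    σ₃ = set WR (drop m (get WR σ)) (tally ok σ)
    count-up : ∀ a c → suc (c + (1 + a * suc c)) ≡ 1 + suc a * suc c
    count-up = ℕ-Ring.solve-∀

  body₂ : Cmd
  body₂ = chop QC WT CT ⨾ chop QC WB CB ⨾ copy COINS WR ⨾ copy UC UN ⨾ loop UN never (λ _ → body₃) ⨾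
          clear WR ⨾ clear CT ⨾ clear CB

  cost₂ : ℕ → ℕ → ℕ → ℕ → ℕ
  cost₂ N q u m = (4 + 10 * q) + ((4 + 10 * q) + ((2 + 5 * N) + ((2 + 5 * u) + ((1 + u * suc (cost₃ N m)) +
                  ((1 + 2 * N) + ((1 + 2 * N) + (1 + 2 * N)))))))

  -- Extends `clean` by the registers that the inner loops own, for the same reason; `outer` does so
  -- for the next level.
  mid : State → State
  mid σ = set UN [] (set CT [] (set CB [] (set CR [] (set WR [] (clean σ)))))

  -- The form to which two successive tallies compute, that of one iteration and that of the
  -- remaining ones; `tallied-++` merges them.
  tallied : List Bool → List Bool → State → State
  tallied bs cs σ = set POS (poss cs (poss bs (get POS σ))) (set NEG (negs cs (negs bs (get NEG σ))) σ)

  tallied-++ : ∀ bs cs σ → tallied bs cs σ ≡ tallies (bs ++ cs) σ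
  tallied-++ bs cs σ = cong₂ (λ a b → set POS a (set NEG b σ)) (poss-++ bs cs _) (negs-++ bs cs _)

  E₂ : State → List Γ → List Γ → List Bool
  E₂ σ t b = rounds (D (get X σ) (get CS σ) t (get CA σ) b) (length (get MC σ)) (length (get UC σ)) (get COINS σ)

  mid-spec : ∀ ls σ {N} → let q = length (get QC σ) in
    All (λ i → length (get i σ) ≤ N) (X ∷ CS ∷ CA ∷ COINS ∷ WT ∷ WB ∷ []) →
    loop LN never (λ _ → body₂) ⊢ set LN ls (mid σ) ⇒
      set LN [] (mid (set WT (drops q (length ls) (get WT σ)) (set WB (drops q (length ls) (get WB σ))
        (tallies (rounds₂ (E₂ σ) q (length ls) (get WT σ) (get WB σ)) σ))))
      ⟨ 1 + length ls * suc (cost₂ N q (length (get UC σ)) (length (get MC σ))) ⟩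
  mid-spec [] σ les = loop-[] refl
  mid-spec (x ∷ ls) σ {N} (lx ∷ ls' ∷ la ∷ lc ∷ lt ∷ lb ∷ []) =
    ⇒-to (⇒-in (loop-∷ refl refl
      (weaken (+-monoʳ-≤ (4 + 10 * q) (+-monoʳ-≤ (4 + 10 * q) (+-mono-≤ (+-monoʳ-≤ 2 (*-monoʳ-≤ 5 lc))
                (+-monoʳ-≤ (2 + 5 * u) (+-monoʳ-≤ (1 + u * suc (cost₃ N m))
                  (+-mono-≤ (+-monoʳ-≤ 1 (*-monoʳ-≤ 2 (≤-trans (length-drops m u (get COINS σ)) lc)))
                    (+-mono-≤ (+-monoʳ-≤ 1 (*-monoʳ-≤ 2 lt')) (+-monoʳ-≤ 1 (*-monoʳ-≤ 2 lb')))))))))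
        (chop-fresh (λ ()) (λ ()) (λ ()) (λ ()) (λ ()) (λ ()) (λ ()) (λ ()) (λ ()) σ₁ refl refl refl ⨾
         chop-fresh (λ ()) (λ ()) (λ ()) (λ ()) (λ ()) (λ ()) (λ ()) (λ ()) (λ ()) σ₂ refl refl refl ⨾
         copy-fresh (λ ()) (λ ()) (λ ()) σ₃ refl refl ⨾ copy-fresh (λ ()) (λ ()) (λ ()) σ₄ refl refl ⨾
         inner-spec (get UC σ) σ₄ (lx ∷ ls' ∷ lt' ∷ la ∷ lb' ∷ lc ∷ []) ⨾
         clear-spec WR σ₅ ⨾ clear-spec CT (set WR [] σ₅) ⨾ clear-spec CB (set CT [] (set WR [] σ₅))))
      (mid-spec ls σ₆ (lx ∷ ls' ∷ la ∷ lc ∷ length-drop-≤ q (get WT σ) lt ∷ length-drop-≤ q (get WB σ) lb ∷ [])))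
      (count-up (length ls) (cost₂ N q u m)))
      (cong (λ τ → set LN [] (mid (set WT (drops q (length ls) (drop q (get WT σ))) (set WB (drops q (length ls) (drop q (get WB σ))) τ))))
            (tallied-++ bs (rounds₂ (E₂ σ) q (length ls) (drop q (get WT σ)) (drop q (get WB σ))) σ))
    where
    q m u : ℕ
    q = length (get QC σ)
    m = length (get MC σ)
    u = length (get UC σ)
    t b : List Γ
    t = take q (get WT σ)
    b = take q (get WB σ)
    lt' : length t ≤ N
    lt' = length-take-≤ q (get WT σ) lt
    lb' : length b ≤ N
    lb' = length-take-≤ q (get WB σ) lb
    bs : List Bool
    bs = E₂ σ t b
    σ₁ σ₂ σ₃ σ₄ σ₅ σ₆ : State
    σ₁ = set LN ls (mid σ)
    σ₂ = set WT (drop q (get WT σ)) (set CT t σ₁)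
    σ₃ = set WB (drop q (get WB σ)) (set CB b σ₂)
    σ₄ = set WR (get COINS σ) σ₃
    σ₅ = set UN [] (set WR (drops m u (get COINS σ)) (tallies bs σ₃))
    σ₆ = set WT (drop q (get WT σ)) (set WB (drop q (get WB σ)) (tallies bs σ))
    count-up : ∀ a c → suc (c + (1 + a * suc c)) ≡ 1 + suc a * suc c
    count-up = ℕ-Ring.solve-∀

  body₁ : Cmd
  body₁ = chop QC Y CS ⨾ chop QC B CA ⨾ copy YT WT ⨾ copy BT WB ⨾ copy LC LN ⨾ loop LN never (λ _ → body₂) ⨾
          clear WT ⨾ clear WB ⨾ clear CS ⨾ clear CA

  cost₁ : ℕ → ℕ → ℕ → ℕ → ℕ → ℕ
  cost₁ N q l u m = (4 + 10 * q) + ((4 + 10 * q) + ((2 + 5 * N) + ((2 + 5 * N) + ((2 + 5 * l) +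
                    ((1 + l * suc (cost₂ N q u m)) + ((1 + 2 * N) + ((1 + 2 * N) + ((1 + 2 * N) + (1 + 2 * N)))))))))

  outer : State → State
  outer σ = set LN [] (set WT [] (set WB [] (set CS [] (set CA [] (mid σ)))))

  E₁ : State → List Γ → List Γ → List Bool
  E₁ σ s a = rounds₂ (λ t b → rounds (D (get X σ) s t a b) (length (get MC σ)) (length (get UC σ)) (get COINS σ))
                     (length (get QC σ)) (length (get LC σ)) (get YT σ) (get BT σ)

  outer-spec : ∀ ks σ {N} → let q = length (get QC σ) in
    All (λ i → length (get i σ) ≤ N) (X ∷ Y ∷ B ∷ COINS ∷ YT ∷ BT ∷ []) →
    loop KC never (λ _ → body₁) ⊢ set KC ks (outer σ) ⇒
      set KC [] (outer (set Y (drops q (length ks) (get Y σ)) (set B (drops q (length ks) (get B σ))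
        (tallies (rounds₂ (E₁ σ) q (length ks) (get Y σ) (get B σ)) σ))))
      ⟨ 1 + length ks * suc (cost₁ N q (length (get LC σ)) (length (get UC σ)) (length (get MC σ))) ⟩
  outer-spec [] σ les = loop-[] refl
  outer-spec (x ∷ ks) σ {N} (lx ∷ ly ∷ lb ∷ lc ∷ lt ∷ lu ∷ []) =
    ⇒-to (⇒-in (loop-∷ refl refl
      (weaken (+-monoʳ-≤ (4 + 10 * q) (+-monoʳ-≤ (4 + 10 * q) (+-mono-≤ (+-monoʳ-≤ 2 (*-monoʳ-≤ 5 lt)) (+-mono-≤ (+-monoʳ-≤ 2 (*-monoʳ-≤ 5 lu))
                (+-monoʳ-≤ (2 + 5 * l) (+-monoʳ-≤ (1 + l * suc (cost₂ N q (length (get UC σ)) (length (get MC σ))))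
                  (+-mono-≤ (+-monoʳ-≤ 1 (*-monoʳ-≤ 2 (≤-trans (length-drops q l (get YT σ)) lt)))
                    (+-mono-≤ (+-monoʳ-≤ 1 (*-monoʳ-≤ 2 (≤-trans (length-drops q l (get BT σ)) lu)))
                      (+-mono-≤ (+-monoʳ-≤ 1 (*-monoʳ-≤ 2 ls')) (+-monoʳ-≤ 1 (*-monoʳ-≤ 2 la')))))))))))
        (chop-fresh (λ ()) (λ ()) (λ ()) (λ ()) (λ ()) (λ ()) (λ ()) (λ ()) (λ ()) σ₁ refl refl refl ⨾
         chop-fresh (λ ()) (λ ()) (λ ()) (λ ()) (λ ()) (λ ()) (λ ()) (λ ()) (λ ()) σ₂ refl refl refl ⨾
         copy-fresh (λ ()) (λ ()) (λ ()) σ₃ refl refl ⨾ copy-fresh (λ ()) (λ ()) (λ ()) σ₄ refl refl ⨾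
         copy-fresh (λ ()) (λ ()) (λ ()) σ₅ refl refl ⨾
         mid-spec (get LC σ) σ₅ (lx ∷ ls' ∷ la' ∷ lc ∷ lt ∷ lu ∷ []) ⨾
         clear-spec WT σ₆ ⨾ clear-spec WB (set WT [] σ₆) ⨾ clear-spec CS (set WB [] (set WT [] σ₆)) ⨾
         clear-spec CA (set CS [] (set WB [] (set WT [] σ₆)))))
      (outer-spec ks σ₇ (lx ∷ length-drop-≤ q (get Y σ) ly ∷ length-drop-≤ q (get B σ) lb ∷ lc ∷ lt ∷ lu ∷ [])))
      (count-up (length ks) (cost₁ N q l (length (get UC σ)) (length (get MC σ)))))
      (cong (λ τ → set KC [] (outer (set Y (drops q (length ks) (drop q (get Y σ))) (set B (drops q (length ks) (drop q (get B σ))) τ))))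
            (tallied-++ bs (rounds₂ (E₁ σ) q (length ks) (drop q (get Y σ)) (drop q (get B σ))) σ))
    where
    q l : ℕ
    q = length (get QC σ)
    l = length (get LC σ)
    s a : List Γ
    s = take q (get Y σ)
    a = take q (get B σ)
    ls' : length s ≤ N
    ls' = length-take-≤ q (get Y σ) ly
    la' : length a ≤ N
    la' = length-take-≤ q (get B σ) lb
    bs : List Bool
    bs = E₁ σ s a
    σ₁ σ₂ σ₃ σ₄ σ₅ σ₆ σ₇ : State
    σ₁ = set KC ks (outer σ)
    σ₂ = set Y (drop q (get Y σ)) (set CS s σ₁)
    σ₃ = set B (drop q (get B σ)) (set CA a σ₂)
    σ₄ = set WT (get YT σ) σ₃
    σ₅ = set WB (get BT σ) σ₄
    σ₆ = set LN [] (set WT (drops q l (get YT σ)) (set WB (drops q l (get BT σ)) (tallies bs σ₃)))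
    σ₇ = set Y (drop q (get Y σ)) (set B (drop q (get B σ)) (tallies bs σ))
    count-up : ∀ a c → suc (c + (1 + a * suc c)) ≡ 1 + suc a * suc c
    count-up = ℕ-Ring.solve-∀

  -- Every accepting trial cancels a rejecting one, so NEG ends empty exactly if the accepting trials are a majority.
  decide : Cmd
  decide = loop POS never (λ _ → pop NEG (λ _ → skip))

  decide-spec : ∀ ps σ → ∃ λ τ → get NEG τ ≡ drop (length ps) (get NEG σ) ×
    decide ⊢ set POS ps σ ⇒ τ ⟨ 1 + length ps * 3 ⟩
  decide-spec []       σ = set POS [] σ , refl , loop-[] refl
  decide-spec (g ∷ ps) σ with get NEG σ in eq
  ... | [] with decide-spec ps σ
  ...   | τ , e , d = τ , trans e (trans (cong (drop (length ps)) eq) (Listₚ.drop-[] (length ps))) ,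
          loop-∷ refl refl (pop-[] {σ = set POS ps σ} eq skip) d
  decide-spec (g ∷ ps) σ | h ∷ ns with decide-spec ps (set NEG ns σ)
  ...   | τ , e , d = τ , e , loop-∷ refl refl (pop-∷ {σ = set POS ps σ} eq skip) d

-- Tape alphabets depend on the machine. Spelling inputs in three common letters lets the input of
-- the constructed machine be related to that of the given one.
rawEncode : List (List Bool) → List (Fin 3)
rawEncode []           = []
rawEncode (w ∷ [])     = map (λ b → if b then # 1 else # 0) w
rawEncode (w ∷ v ∷ ws) = map (λ b → if b then # 1 else # 0) w ++ # 2 ∷ rawEncode (v ∷ ws)

map-bitSym : ∀ (M : TM) w → map (bitSym M) w ≡ map (λ i → suc i Fin.↑ˡ TM.extra M) (map (λ b → if b then # 1 else # 0) w)
map-bitSym M []          = refl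
map-bitSym M (false ∷ w) = cong (_ ∷_) (map-bitSym M w)
map-bitSym M (true ∷ w)  = cong (_ ∷_) (map-bitSym M w)

encode-raw : ∀ (M : TM) ws → encode M ws ≡ map (λ i → suc i Fin.↑ˡ TM.extra M) (rawEncode ws)
encode-raw M []           = refl
encode-raw M (w ∷ [])     = map-bitSym M w
encode-raw M (w ∷ v ∷ ws) = trans (cong₂ (λ a b → a ++ sep M ∷ b) (map-bitSym M w) (encode-raw M (v ∷ ws)))
  (sym (Listₚ.map-++ (λ i → suc i Fin.↑ˡ TM.extra M) (map (λ b → if b then # 1 else # 0) w) (# 2 ∷ rawEncode (v ∷ ws))))

PolyTime : (List (Fin 3) → Bool) → Set
PolyTime f = Σ TM λ M → Σ Poly λ P → RunsInTime M P × (∀ ws → acceptsWithin M P ws ≡ f (rawEncode ws))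

module _ {Γ : Set} (F : Finite Γ) (k : ℕ) (inp : Fin 3 → Γ) where

  open Program {Γ} (suc k)
  open Compile F k inp using (machine; machine-run; phase; halt; halt-halted; answer; runtime; inputMem; fin-Phase)

  compiled : ∀ c res (f : List (Fin 3) → Bool) {cost} → IsPolynomial cost →
             (∀ w → ∃ λ τ → answer (get res τ) ≡ f w × c ⊢ inputMem w ⇒ τ ⟨ cost (length w) ⟩) → PolyTime f
  compiled c res f {cost} bounded correct = M , P , runs , λ ws → trans (cong (λ q → ⌊ q Fin.≟ TM.accept M ⌋) (final ws)) (verdict (f (rawEncode ws)))
    where
    M : TM
    M = machine c res
    time : IsPolynomial (λ N → runtime c res N (cost N))
    time = poly-+ (poly-const 2) (poly-* (poly-+ bounded (poly-const 1))
             (poly-+ (poly-const 6) (poly-* (poly-const 2) (poly-+ poly-id (poly-+ bounded (poly-const 1))))))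
    P : Poly
    P = proj₁ time
    final : ∀ ws → stateAfter M ws (eval P (inputLength M ws)) ≡ phase c res (halt (f (rawEncode ws)))
    final ws with correct (rawEncode ws)
    ... | τ , e , d rewrite encode-raw M ws =
          trans (machine-run c res d (≤-reflexive (trans (proj₂ time (length (rawEncode ws))) (cong (eval P) (sym (Listₚ.length-map _ (rawEncode ws)))))))
                (cong (phase c res ∘ halt) e)
    runs : RunsInTime M P
    runs ws = trans (cong (halted M) (final ws)) (halt-halted c res (f (rawEncode ws)))
    verdict : ∀ b → ⌊ phase c res (halt b) Fin.≟ TM.accept M ⌋ ≡ b
    verdict true  = ⌊≟⌋-refl (phase c res (halt true))
    verdict false = ⌊≟⌋-≢ λ e → false≢true (enc-injective (fin-Phase c res) e)
      where
      false≢true : halt {c = c} {res} false ≢ halt true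
      false≢true ()

-- The two decision programs

module Deciders (V : TM) (p : Poly) where

  open Loops V p

  finΓ : Finite Γ
  finΓ = fin-⊎ (fin-Fin (4 + TM.extra V)) (fin-Fin (TM.nStates V))

  inp : Fin 3 → Γ
  inp i = inj₁ (suc i Fin.↑ˡ TM.extra V)

  begin-with : List Γ → State
  begin-with w = w , emptyMem 32

  decided : List Bool → Bool
  decided bs = Compile.answer finΓ 32 inp (drop (length (poss bs [])) (negs bs []))

  -- The input stack after i fields have been read. Fields are therefore numbered from the end of
  -- the input, with the coins as number 0.
  rest : ℕ → List Γ → List Γ
  rest zero    w = w
  rest (suc i) w = field₂ [] (rest i w)

  part : ℕ → List Γ → List Γ
  part i w = field₁ [] (rest i w)

  length-rest : ∀ i w → length (rest i w) ≤ length w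
  length-rest zero    w = ≤-refl
  length-rest (suc i) w = ≤-trans (length-field₂ [] (rest i w)) (length-rest i w)

  length-part : ∀ i w → length (part i w) ≤ length w
  length-part i w = ≤-trans (length-field₁ [] (rest i w)) (length-rest i w)

  read-spec : ∀ {i} j w σ → i ≢ INP → get i σ ≡ [] → get INP σ ≡ rest j w →
              readField i ⊢ σ ⇒ set INP (rest (suc j) w) (set i (part j w) σ) ⟨ 1 + 2 * length w ⟩
  read-spec {i} j w σ i≢ e h =
    weaken (+-monoʳ-≤ 1 (*-monoʳ-≤ 2 (≤-trans (≤-reflexive (cong length h)) (length-rest j w))))
      (⇒-to (readField-spec i≢ σ) (cong₂ (λ a v → set INP (field₂ a v) (set i (field₁ a v) σ)) e h))

  prog₁ : Cmd
  prog₁ = readField CR ⨾ readField CB ⨾ readField CA ⨾ readField CT ⨾ readField CS ⨾ readField X ⨾ test four ⨾ decide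

  verdicts₁ : List Γ → List Bool
  verdicts₁ w = accepts (joinOnto (part 5 w ∷ part 4 w ∷ part 2 w ∷ part 0 w ∷ []) []) ∷ []

  readCost : ℕ → ℕ
  readCost N = 1 + 2 * N

  total₁ : ℕ → ℕ
  total₁ N = readCost N + (readCost N + (readCost N + (readCost N + (readCost N + (readCost N +
             (testCost p 4 (4 * suc N) + 4))))))

  prog₁-spec : ∀ w → ∃ λ τ → get NEG τ ≡ drop (length (poss (verdicts₁ w) [])) (negs (verdicts₁ w) []) ×
               prog₁ ⊢ begin-with w ⇒ τ ⟨ total₁ (length w) ⟩
  prog₁-spec w with decide-spec (poss (verdicts₁ w) []) (tallies (verdicts₁ w) σ₆)
    where
    σ₆ : State
    σ₆ = set INP (rest 6 w) (set X (part 5 w) (set CS (part 4 w) (set CT (part 3 w) (set CA (part 2 w) (set CB (part 1 w)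
           (set CR (part 0 w) (begin-with w)))))))
  ... | τ , e , d = τ , e ,
        read-spec 0 w (begin-with w) (λ ()) refl refl ⨾ read-spec 1 w σ₁ (λ ()) refl refl ⨾
        read-spec 2 w σ₂ (λ ()) refl refl ⨾ read-spec 3 w σ₃ (λ ()) refl refl ⨾ read-spec 4 w σ₄ (λ ()) refl refl ⨾
        read-spec 5 w σ₅ (λ ()) refl refl ⨾
        weaken (+-mono-≤ (testCost-mono p 4 (length-joinOnto (part 5 w ∷ part 4 w ∷ part 2 w ∷ part 0 w ∷ [])
                 (length-part 5 w ∷ length-part 4 w ∷ length-part 2 w ∷ length-part 0 w ∷ [])))
                 (+-monoʳ-≤ 1 (*-monoˡ-≤ 3 (at-most-one (verdicts₁ w) refl))))
          (test-spec four four-ok σ₆ ⨾ d)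
    where
    σ₁ σ₂ σ₃ σ₄ σ₅ σ₆ : State
    σ₁ = set INP (rest 1 w) (set CR (part 0 w) (begin-with w))
    σ₂ = set INP (rest 2 w) (set CB (part 1 w) σ₁)
    σ₃ = set INP (rest 3 w) (set CA (part 2 w) σ₂)
    σ₄ = set INP (rest 4 w) (set CT (part 3 w) σ₃)
    σ₅ = set INP (rest 5 w) (set CS (part 4 w) σ₄)
    σ₆ = set INP (rest 6 w) (set X (part 5 w) σ₅)
    at-most-one : ∀ bs → length bs ≡ 1 → length (poss bs []) ≤ 1
    at-most-one (true ∷ [])  _ = ≤-refl
    at-most-one (false ∷ []) _ = z≤n

  -- The challenge consists of l blocks for the second prover followed by k blocks for the first, and so does the answer.
  bundle : (q k l m u lq : ℕ) → List Γ → List Bool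
  bundle q k l m u lq w =
    rounds₂ (λ s a → rounds₂ (λ t b → rounds (D (part 3 w) s t a b) m u (part 0 w))
                             q l (take lq (part 2 w)) (take lq (part 1 w)))
            q k (drop lq (part 2 w)) (drop lq (part 1 w))

  length-bundle : ∀ q k l m u lq w → length (bundle q k l m u lq w) ≡ k * (l * u)
  length-bundle q k l m u lq w = length-rounds₂ _ q k _ _ λ s a → length-rounds₂ _ q l _ _ λ t b → length-rounds _ m u _

  length-poss : ∀ bs l → length (poss bs l) ≤ length bs + length l
  length-poss []           l = ≤-refl
  length-poss (true ∷ bs)  l = ≤-trans (length-poss bs (mark ∷ l)) (≤-reflexive (+-suc (length bs) (length l)))
  length-poss (false ∷ bs) l = ≤-trans (length-poss bs l) (n≤1+n _)

  cost₃-mono : ∀ N {m m'} → m ≤ m' → cost₃ N m ≤ cost₃ N m'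
  cost₃-mono N le = +-monoˡ-≤ _ (+-monoʳ-≤ 4 (*-monoʳ-≤ 10 le))

  cost₂-mono : ∀ N {q q' u u' m m'} → q ≤ q' → u ≤ u' → m ≤ m' → cost₂ N q u m ≤ cost₂ N q' u' m'
  cost₂-mono N lq lu lm = +-mono-≤ (+-monoʳ-≤ 4 (*-monoʳ-≤ 10 lq)) (+-mono-≤ (+-monoʳ-≤ 4 (*-monoʳ-≤ 10 lq))
    (+-monoʳ-≤ (2 + 5 * N) (+-mono-≤ (+-monoʳ-≤ 2 (*-monoʳ-≤ 5 lu)) (+-monoˡ-≤ _ (+-monoʳ-≤ 1 (*-mono-≤ lu (s≤s (cost₃-mono N lm))))))))

  cost₁-mono : ∀ N {q q' l l' u u' m m'} → q ≤ q' → l ≤ l' → u ≤ u' → m ≤ m' → cost₁ N q l u m ≤ cost₁ N q' l' u' m'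
  cost₁-mono N lq ll lu lm = +-mono-≤ (+-monoʳ-≤ 4 (*-monoʳ-≤ 10 lq)) (+-mono-≤ (+-monoʳ-≤ 4 (*-monoʳ-≤ 10 lq))
    (+-monoʳ-≤ (2 + 5 * N) (+-monoʳ-≤ (2 + 5 * N) (+-mono-≤ (+-monoʳ-≤ 2 (*-monoʳ-≤ 5 ll))
      (+-monoˡ-≤ _ (+-monoʳ-≤ 1 (*-mono-≤ ll (s≤s (cost₂-mono N lq lu lm)))))))))

  mainLoop : Cmd
  mainLoop = chop LQ Y YT ⨾ chop LQ B BT ⨾ loop KC never (λ _ → body₁)

  mainCost : (N q k l m u lq : ℕ) → ℕ
  mainCost N q k l m u lq = (4 + 10 * lq) + ((4 + 10 * lq) + (1 + k * suc (cost₁ N q l u m)))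

  mainCost-mono : ∀ N {q k l m u lq q' k' l' m' u' lq'} → q ≤ q' → k ≤ k' → l ≤ l' → m ≤ m' → u ≤ u' → lq ≤ lq' →
                  mainCost N q k l m u lq ≤ mainCost N q' k' l' m' u' lq'
  mainCost-mono N hq hk hl hm hu hlq = +-mono-≤ (+-monoʳ-≤ 4 (*-monoʳ-≤ 10 hlq)) (+-mono-≤ (+-monoʳ-≤ 4 (*-monoʳ-≤ 10 hlq))
    (+-monoʳ-≤ 1 (*-mono-≤ hk (s≤s (cost₁-mono N hq hl hu hm)))))

  parsed : List Γ → State
  parsed w = set INP (rest 4 w) (set X (part 3 w) (set Y (part 2 w) (set B (part 1 w) (set COINS (part 0 w) (begin-with w)))))

  configured : (w qs ks ls ms us lqs : List Γ) → State
  configured w qs ks ls ms us lqs = set LQ lqs (set UC us (set MC ms (set LC ls (set KC ks (set QC qs (parsed w))))))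

  halved : (w qs ks ls ms us lqs : List Γ) → State
  halved w qs ks ls ms us lqs =
    set B (drop lq (part 1 w)) (set BT (take lq (part 1 w)) (set Y (drop lq (part 2 w)) (set YT (take lq (part 2 w))
      (configured w qs ks ls ms us lqs))))
    where
    lq : ℕ
    lq = length lqs

  mainLoop-spec : ∀ w qs ks ls ms us lqs → ∃ λ τ →
    let bs = bundle (length qs) (length ks) (length ls) (length ms) (length us) (length lqs) w in
    mainLoop ⊢ configured w qs ks ls ms us lqs ⇒ set POS (poss bs []) (set NEG (negs bs []) τ)
      ⟨ mainCost (length w) (length qs) (length ks) (length ls) (length ms) (length us) (length lqs) ⟩
  mainLoop-spec w qs ks ls ms us lqs = τ ,
    (chop-fresh (λ ()) (λ ()) (λ ()) (λ ()) (λ ()) (λ ()) (λ ()) (λ ()) (λ ()) (configured w qs ks ls ms us lqs) refl refl refl ⨾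
     chop-fresh (λ ()) (λ ()) (λ ()) (λ ()) (λ ()) (λ ()) (λ ()) (λ ()) (λ ())
       (set Y (drop lq (part 2 w)) (set YT (take lq (part 2 w)) (configured w qs ks ls ms us lqs))) refl refl refl ⨾
     outer-spec ks (halved w qs ks ls ms us lqs) {length w} (length-part 3 w ∷ length-drop-≤ lq (part 2 w) (length-part 2 w) ∷
       length-drop-≤ lq (part 1 w) (length-part 1 w) ∷ length-part 0 w ∷ length-take-≤ lq (part 2 w) (length-part 2 w) ∷
       length-take-≤ lq (part 1 w) (length-part 1 w) ∷ []))
    where
    lq : ℕ
    lq = length lqs
    τ : State
    τ = set KC [] (set Y (drops (length qs) (length ks) (drop lq (part 2 w))) (set B (drops (length qs) (length ks) (drop lq (part 1 w)))
          (halved w qs ks ls ms us lqs)))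

  decider : ∀ c (verdicts : List Γ → List Bool) {cost} → IsPolynomial cost →
    (∀ w → ∃ λ τ → get NEG τ ≡ drop (length (poss (verdicts w) [])) (negs (verdicts w) []) × c ⊢ begin-with w ⇒ τ ⟨ cost (length w) ⟩) →
    PolyTime (λ w → decided (verdicts (reverse (map inp w))))
  decider c verdicts {cost} bounded spec = compiled finΓ 32 inp c NEG _ bounded run-on
    where
    run-on : ∀ w → ∃ λ τ → Compile.answer finΓ 32 inp (get NEG τ) ≡ decided (verdicts (reverse (map inp w))) ×
             c ⊢ Compile.inputMem finΓ 32 inp w ⇒ τ ⟨ cost (length w) ⟩
    run-on w with spec (reverse (map inp w))
    ... | τ , e , d = τ , cong (Compile.answer finΓ 32 inp) e ,
          ⇒-in d (cong cost (trans (Listₚ.length-reverse (map inp w)) (Listₚ.length-map inp w)))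

  finish : ∀ {c N} σ ps ns {σ₀ t} → length ps ≤ N → c ⊢ σ₀ ⇒ set POS ps (set NEG ns σ) ⟨ t ⟩ →
           ∃ λ τ → get NEG τ ≡ drop (length ps) ns × (c ⨾ decide) ⊢ σ₀ ⇒ τ ⟨ t + (1 + N * 3) ⟩
  finish σ ps ns le d with decide-spec ps (set NEG ns σ)
  ... | τ , e , d' = τ , e , (d ⨾ weaken (+-monoʳ-≤ 1 (*-monoˡ-≤ 3 le)) d')

  -- Continuation-passing form: the computed register is known only up to its length, so the
  -- remaining program is verified for every such content.
  setPoly-then : ∀ {Φ : State → Set} P {d c N t} σ → d ≢ ACC → length (get X σ) ≤ N → get d (clean σ) ≡ [] →
    (∀ ys → length ys ≡ eval P (length (get X σ)) → ∃ λ τ → Φ τ × c ⊢ set d ys (clean σ) ⇒ τ ⟨ t ⟩) →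
    ∃ λ τ → Φ τ × (setPoly P d ⨾ c) ⊢ clean σ ⇒ τ ⟨ polyCost P N + t ⟩
  setPoly-then P σ d≢ le e next with setPoly-spec P d≢ σ le e
  ... | ys , |ys| , d₁ with next ys |ys|
  ... | τ , φ , d₂ = τ , φ , (d₁ ⨾ d₂)

  module _ (qP kP lP mP uP lqP : Poly) where

    verdicts₂ : List Γ → List Bool
    verdicts₂ w = let n = length (part 3 w) in bundle (eval qP n) (eval kP n) (eval lP n) (eval mP n) (eval uP n) (eval lqP n) w

    -- The parameters are evaluated at the length of the field x, but the time may depend only on
    -- the length N of the entire input. Monotonicity permits evaluating everything at N.
    tailCost : ℕ → ℕ
    tailCost N = mainCost N (eval qP N) (eval kP N) (eval lP N) (eval mP N) (eval uP N) (eval lqP N) +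
                 (1 + eval kP N * (eval lP N * eval uP N) * 3)

    total₂ : ℕ → ℕ
    total₂ N = (readCost N + (readCost N + (readCost N + readCost N))) +
               (polyCost qP N + (polyCost kP N + (polyCost lP N + (polyCost mP N + (polyCost uP N + (polyCost lqP N + tailCost N))))))

    Decides : List Γ → State → Set
    Decides w τ = get NEG τ ≡ drop (length (poss (verdicts₂ w) [])) (negs (verdicts₂ w) [])

    tail-spec : ∀ w qs ks ls ms us lqs → let n = length (part 3 w) in
      length qs ≡ eval qP n → length ks ≡ eval kP n → length ls ≡ eval lP n →
      length ms ≡ eval mP n → length us ≡ eval uP n → length lqs ≡ eval lqP n →
      ∃ λ τ → Decides w τ × (mainLoop ⨾ decide) ⊢ configured w qs ks ls ms us lqs ⇒ τ ⟨ tailCost (length w) ⟩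
    tail-spec w qs ks ls ms us lqs |qs| |ks| |ls| |ms| |us| |lqs| =
      transfer (finish (proj₁ main) (poss bs []) (negs bs [])
        (≤-trans (length-poss bs []) (≤-trans (≤-reflexive (trans (+-identityʳ _)
          (length-bundle (length qs) (length ks) (length ls) (length ms) (length us) (length lqs) w)))
          (*-mono-≤ (bound kP ks |ks|) (*-mono-≤ (bound lP ls |ls|) (bound uP us |us|)))))
        (weaken (mainCost-mono (length w) (bound qP qs |qs|) (bound kP ks |ks|) (bound lP ls |ls|) (bound mP ms |ms|) (bound uP us |us|) (bound lqP lqs |lqs|))
                (proj₂ main)))
      where
      n : ℕ
      n = length (part 3 w)
      bs : List Bool
      bs = bundle (length qs) (length ks) (length ls) (length ms) (length us) (length lqs) w
      main = mainLoop-spec w qs ks ls ms us lqs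
      same : bs ≡ verdicts₂ w
      same rewrite |qs| | |ks| | |ls| | |ms| | |us| | |lqs| = refl
      bound : ∀ P (ys : List Γ) → length ys ≡ eval P n → length ys ≤ eval P (length w)
      bound P ys e = ≤-trans (≤-reflexive e) (eval-mono P (length-part 3 w))
      transfer : ∀ {t} {σ} → ∃ (λ τ → get NEG τ ≡ drop (length (poss bs [])) (negs bs []) × (mainLoop ⨾ decide) ⊢ σ ⇒ τ ⟨ t ⟩) →
                 ∃ (λ τ → Decides w τ × (mainLoop ⨾ decide) ⊢ σ ⇒ τ ⟨ t ⟩)
      transfer (τ , e , d) = τ , trans e (cong (λ bs → drop (length (poss bs [])) (negs bs [])) same) , d

    configure : Cmd
    configure = setPoly qP QC ⨾ setPoly kP KC ⨾ setPoly lP LC ⨾ setPoly mP MC ⨾ setPoly uP UC ⨾ setPoly lqP LQ ⨾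
                mainLoop ⨾ decide

    configure-spec : ∀ w → ∃ λ τ → Decides w τ × configure ⊢ parsed w ⇒ τ
      ⟨ polyCost qP (length w) + (polyCost kP (length w) + (polyCost lP (length w) + (polyCost mP (length w) +
        (polyCost uP (length w) + (polyCost lqP (length w) + tailCost (length w)))))) ⟩
    configure-spec w =
      setPoly-then {Decides w} qP (parsed w) (λ ()) n≤ refl λ qs |qs| →
      setPoly-then {Decides w} kP (set QC qs (parsed w)) (λ ()) n≤ refl λ ks |ks| →
      setPoly-then {Decides w} lP (set KC ks (set QC qs (parsed w))) (λ ()) n≤ refl λ ls |ls| →
      setPoly-then {Decides w} mP (set LC ls (set KC ks (set QC qs (parsed w)))) (λ ()) n≤ refl λ ms |ms| →
      setPoly-then {Decides w} uP (set MC ms (set LC ls (set KC ks (set QC qs (parsed w))))) (λ ()) n≤ refl λ us |us| →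
      setPoly-then {Decides w} lqP (set UC us (set MC ms (set LC ls (set KC ks (set QC qs (parsed w)))))) (λ ()) n≤ refl λ lqs |lqs| →
      tail-spec w qs ks ls ms us lqs |qs| |ks| |ls| |ms| |us| |lqs|
      where
      n≤ : length (part 3 w) ≤ length w
      n≤ = length-part 3 w

    prog₂ : Cmd
    prog₂ = (readField COINS ⨾ readField B ⨾ readField Y ⨾ readField X) ⨾ configure

    prog₂-spec : ∀ w → ∃ λ τ → Decides w τ × prog₂ ⊢ begin-with w ⇒ τ ⟨ total₂ (length w) ⟩
    prog₂-spec w = glue (configure-spec w)
      where
      σ₁ σ₂ σ₃ : State
      σ₁ = set INP (rest 1 w) (set COINS (part 0 w) (begin-with w))
      σ₂ = set INP (rest 2 w) (set B (part 1 w) σ₁)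
      σ₃ = set INP (rest 3 w) (set Y (part 2 w) σ₂)
      reads : (readField COINS ⨾ readField B ⨾ readField Y ⨾ readField X) ⊢ begin-with w ⇒ parsed w
                ⟨ readCost (length w) + (readCost (length w) + (readCost (length w) + readCost (length w))) ⟩
      reads = read-spec 0 w (begin-with w) (λ ()) refl refl ⨾ read-spec 1 w σ₁ (λ ()) refl refl ⨾
              read-spec 2 w σ₂ (λ ()) refl refl ⨾ read-spec 3 w σ₃ (λ ()) refl refl
      glue : ∀ {t} → ∃ (λ τ → Decides w τ × configure ⊢ parsed w ⇒ τ ⟨ t ⟩) → ∃ λ τ → Decides w τ ×
             prog₂ ⊢ begin-with w ⇒ τ ⟨ readCost (length w) + (readCost (length w) + (readCost (length w) + readCost (length w))) + t ⟩
      glue (τ , φ , d) = τ , φ , (reads ⨾ d)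

    poly-polyCost : ∀ P → IsPolynomial (polyCost P)
    poly-polyCost P = poly-+ (poly-+ (poly-const 2) (poly-* (poly-const 5) poly-id)) (poly-+ (poly-hornerCost P poly-id)
      (poly-+ (poly-+ (poly-const 1) (poly-* (poly-const 2) poly-id)) (poly-+ (poly-const 1) (poly-* (poly-const 2) (poly-eval P poly-id)))))

    poly-total₂ : IsPolynomial total₂
    poly-total₂ = poly-+ (poly-+ readN (poly-+ readN (poly-+ readN readN)))
      (poly-+ (poly-polyCost qP) (poly-+ (poly-polyCost kP) (poly-+ (poly-polyCost lP) (poly-+ (poly-polyCost mP) (poly-+ (poly-polyCost uP)
        (poly-+ (poly-polyCost lqP) (poly-+ (poly-+ (blocks (at lqP)) (poly-+ (blocks (at lqP)) (loops (at kP) poly-cost₁)))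
          (poly-+ (poly-const 1) (poly-* (poly-* (at kP) (poly-* (at lP) (at uP))) (poly-const 3))))))))))
      where
      at : ∀ P → IsPolynomial (eval P)
      at P = poly-eval P poly-id
      readN : IsPolynomial (λ N → 1 + 2 * N)
      readN = poly-+ (poly-const 1) (poly-* (poly-const 2) poly-id)
      blocks : ∀ {f} → IsPolynomial f → IsPolynomial (λ N → 4 + 10 * f N)
      blocks b = poly-+ (poly-const 4) (poly-* (poly-const 10) b)
      copies : ∀ {f} → IsPolynomial f → IsPolynomial (λ N → 2 + 5 * f N)
      copies b = poly-+ (poly-const 2) (poly-* (poly-const 5) b)
      loops : ∀ {f g} → IsPolynomial f → IsPolynomial g → IsPolynomial (λ N → 1 + f N * suc (g N))
      loops b c = poly-+ (poly-const 1) (poly-* b (poly-+ (poly-const 1) c))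
      poly-cost₃ : IsPolynomial (λ N → cost₃ N (eval mP N))
      poly-cost₃ = poly-+ (blocks (at mP)) (poly-+ (poly-testCost p 6 (poly-* (poly-const 6) (poly-+ (poly-const 1) poly-id))) readN)
      poly-cost₂ : IsPolynomial (λ N → cost₂ N (eval qP N) (eval uP N) (eval mP N))
      poly-cost₂ = poly-+ (blocks (at qP)) (poly-+ (blocks (at qP)) (poly-+ (copies poly-id) (poly-+ (copies (at uP))
        (poly-+ (loops (at uP) poly-cost₃) (poly-+ readN (poly-+ readN readN))))))
      poly-cost₁ : IsPolynomial (λ N → cost₁ N (eval qP N) (eval lP N) (eval uP N) (eval mP N))
      poly-cost₁ = poly-+ (blocks (at qP)) (poly-+ (blocks (at qP)) (poly-+ (copies poly-id) (poly-+ (copies poly-id) (poly-+ (copies (at lP))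
        (poly-+ (loops (at lP) poly-cost₂) (poly-+ readN (poly-+ readN (poly-+ readN readN))))))))

    decider₂ : PolyTime (λ w → decided (verdicts₂ (reverse (map inp w))))
    decider₂ = decider prog₂ verdicts₂ poly-total₂ prog₂-spec

  decider₁ : PolyTime (λ w → decided (verdicts₁ (reverse (map inp w))))
  decider₁ = decider prog₁ verdicts₁ poly-total₁ prog₁-spec
    where
    readN : IsPolynomial (λ N → 1 + 2 * N)
    readN = poly-+ (poly-const 1) (poly-* (poly-const 2) poly-id)
    poly-total₁ : IsPolynomial total₁
    poly-total₁ = poly-+ readN (poly-+ readN (poly-+ readN (poly-+ readN (poly-+ readN (poly-+ readN
      (poly-+ (poly-testCost p 4 (poly-* (poly-const 4) (poly-+ (poly-const 1) poly-id))) (poly-const 4)))))))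

-- Meaning of the verdicts on well-formed inputs

chunks : ∀ {A : Set} → ℕ → ℕ → List A → List (List A)
chunks q zero    v = []
chunks q (suc k) v = take q v ∷ chunks q k (drop q v)

module _ {A B : Set} (f : A → B) where

  rounds-map : ∀ (E : List B → Bool) (E' : List A → Bool) → (∀ v → E (map f v) ≡ E' v) →
               ∀ q k v → rounds E q k (map f v) ≡ rounds E' q k v
  rounds-map E E' h q zero    v = refl
  rounds-map E E' h q (suc k) v rewrite Listₚ.take-map {f = f} q v | Listₚ.drop-map {f = f} q v =
    cong₂ _∷_ (h (take q v)) (rounds-map E E' h q k (drop q v))

  rounds₂-map : ∀ (E : List B → List B → List Bool) (E' : List A → List A → List Bool) → (∀ v w → E (map f v) (map f w) ≡ E' v w) →
                ∀ q k v w → rounds₂ E q k (map f v) (map f w) ≡ rounds₂ E' q k v w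
  rounds₂-map E E' h q zero    v w = refl
  rounds₂-map E E' h q (suc k) v w rewrite Listₚ.take-map {f = f} q v | Listₚ.drop-map {f = f} q v
                                         | Listₚ.take-map {f = f} q w | Listₚ.drop-map {f = f} q w =
    cong₂ _++_ (h (take q v) (take q w)) (rounds₂-map E E' h q k (drop q v) (drop q w))

∑-rounds : ∀ {A : Set} (g : Bool → ℕ) (E : List A → Bool) q k v → ∑ (rounds E q k v) g ≡ ∑ (chunks q k v) (g ∘ E)
∑-rounds g E q zero    v = refl
∑-rounds g E q (suc k) v = cong (g (E (take q v)) +_) (∑-rounds g E q k (drop q v))

∑-rounds₂ : ∀ {A : Set} (g : Bool → ℕ) (E : List A → List A → List Bool) q k v w →
            ∑ (rounds₂ E q k v w) g ≡ ∑ (zip (chunks q k v) (chunks q k w)) (λ vw → ∑ (E (proj₁ vw) (proj₂ vw)) g)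
∑-rounds₂ g E q zero    v w = refl
∑-rounds₂ g E q (suc k) v w = trans (∑-++ (E (take q v) (take q w)) _ g)
  (cong (∑ (E (take q v) (take q w)) g +_) (∑-rounds₂ g E q k (drop q v) (drop q w)))

take-prefix : ∀ {A : Set} (v w : List A) → take (length v) (v ++ w) ≡ v
take-prefix []      w = refl
take-prefix (x ∷ v) w = cong (x ∷_) (take-prefix v w)

drop-prefix : ∀ {A : Set} (v w : List A) → drop (length v) (v ++ w) ≡ w
drop-prefix []      w = refl
drop-prefix (x ∷ v) w = drop-prefix v w

chunks-concat : ∀ {A : Set} q (vs : List (List A)) → All (λ v → length v ≡ q) vs → chunks q (length vs) (concat vs) ≡ vs
chunks-concat q []       []       = refl
chunks-concat q (v ∷ vs) (refl ∷ h) rewrite take-prefix v (concat vs) | drop-prefix v (concat vs) =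
  cong (v ∷_) (chunks-concat q vs h)

length-chunks : ∀ {A : Set} q k (v : List A) → length (chunks q k v) ≡ k
length-chunks q zero    v = refl
length-chunks q (suc k) v = cong suc (length-chunks q k (drop q v))

chunk-lengths : ∀ {A : Set} q k (v : List A) → length v ≡ k * q → All (λ c → length c ≡ q) (chunks q k v)
chunk-lengths q zero    v e = []
chunk-lengths q (suc k) v e =
  trans (Listₚ.length-take q v) (m≤n⇒m⊓n≡m (≤-trans (m≤m+n q (k * q)) (≤-reflexive (sym e)))) ∷
  chunk-lengths q k (drop q v) (trans (Listₚ.length-drop q v) (trans (cong (_∸ q) e) (m+n∸m≡n q (k * q))))

length-concat : ∀ {A : Set} q (vs : List (List A)) → All (λ v → length v ≡ q) vs → length (concat vs) ≡ length vs * q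
length-concat q []       []      = refl
length-concat q (v ∷ vs) (e ∷ h) = trans (Listₚ.length-++ v) (cong₂ _+_ e (length-concat q vs h))

-- A tie accepts, as it does in `decide`. The threshold `k * l * u ≤ 2 * hits` of the sampled game
-- includes ties, so it covers false acceptance and false rejection alike.
majority : List Bool → Bool
majority bs = ∑ bs (𝟙 ∘ not) ≤ᵇ ∑ bs 𝟙

module _ (V : TM) (p : Poly) where

  trial : List Bool → List Bool → List Bool → List Bool → List Bool → List Bool → Bool
  trial x s t a b r = acceptsWithin V p (x ∷ s ∷ t ∷ a ∷ b ∷ r ∷ [])

  trials : (q k l m u lq : ℕ) → (x y b c : List Bool) → List Bool
  trials q k l m u lq x y b c =
    rounds₂ (λ s a → rounds₂ (λ t b → rounds (trial x s t a b) m u c) q l (take lq y) (take lq b)) q k (drop lq y) (drop lq b)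

module Outcomes (V : TM) (p : Poly) where

  open Deciders V p public
  open Loops V p

  decided-majority : ∀ bs → decided bs ≡ majority bs
  decided-majority bs = trans (answer-drop (length (poss bs [])) (negs bs []))
    (cong₂ _≤ᵇ_ (trans (length-negs bs []) (+-identityʳ _)) (trans (length-poss' bs []) (+-identityʳ _)))
    where
    ≤ᵇ-suc : ∀ a b → (suc a ≤ᵇ suc b) ≡ (a ≤ᵇ b)
    ≤ᵇ-suc zero    b = refl
    ≤ᵇ-suc (suc a) b = refl
    answer-drop : ∀ m (ns : List Γ) → Compile.answer finΓ 32 inp (drop m ns) ≡ (length ns ≤ᵇ m)
    answer-drop zero    []       = refl
    answer-drop zero    (_ ∷ _)  = refl
    answer-drop (suc m) []       = refl
    answer-drop (suc m) (_ ∷ ns) = trans (answer-drop m ns) (sym (≤ᵇ-suc (length ns) m))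
    length-poss' : ∀ bs l → length (poss bs l) ≡ ∑ bs 𝟙 + length l
    length-poss' []           l = refl
    length-poss' (true ∷ bs)  l = trans (length-poss' bs (mark ∷ l)) (+-suc (∑ bs 𝟙) (length l))
    length-poss' (false ∷ bs) l = length-poss' bs l
    length-negs : ∀ bs l → length (negs bs l) ≡ ∑ bs (𝟙 ∘ not) + length l
    length-negs []           l = refl
    length-negs (true ∷ bs)  l = length-negs bs l
    length-negs (false ∷ bs) l = trans (length-negs bs (mark ∷ l)) (+-suc (∑ bs (𝟙 ∘ not)) (length l))

  letter : Bool → Γ
  letter b = inp (if b then # 1 else # 0)

  word : List Bool → List Γ
  word = map letter

  -- The input stack as the program finds it: the last word on top, and every word reversed.
  pile : List (List Bool) → List Γ → List Γ
  pile []           acc = acc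
  pile (w ∷ [])     acc = word w ʳ++ acc
  pile (w ∷ v ∷ ws) acc = pile (v ∷ ws) (comma ∷ (word w ʳ++ acc))

  pile-encode : ∀ ws acc → map inp (rawEncode ws) ʳ++ acc ≡ pile ws acc
  pile-encode []           acc = refl
  pile-encode (w ∷ [])     acc = cong (_ʳ++ acc) (sym (Listₚ.map-∘ w))
  pile-encode (w ∷ v ∷ ws) acc = begin
    map inp (map (λ b → if b then # 1 else # 0) w ++ # 2 ∷ rawEncode (v ∷ ws)) ʳ++ acc
      ≡⟨ cong (_ʳ++ acc) (Listₚ.map-++ inp (map (λ b → if b then # 1 else # 0) w) _) ⟩
    (map inp (map (λ b → if b then # 1 else # 0) w) ++ comma ∷ map inp (rawEncode (v ∷ ws))) ʳ++ acc
      ≡⟨ cong (λ u → (u ++ comma ∷ map inp (rawEncode (v ∷ ws))) ʳ++ acc) (sym (Listₚ.map-∘ w)) ⟩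
    (word w ++ comma ∷ map inp (rawEncode (v ∷ ws))) ʳ++ acc
      ≡⟨ Listₚ.++-ʳ++ (word w) ⟩
    map inp (rawEncode (v ∷ ws)) ʳ++ (comma ∷ (word w ʳ++ acc))
      ≡⟨ pile-encode (v ∷ ws) _ ⟩
    pile (v ∷ ws) (comma ∷ (word w ʳ++ acc)) ∎
    where open ≡-Reasoning

  letter-not-comma : ∀ b → isComma (letter b) ≡ false
  letter-not-comma false = refl
  letter-not-comma true  = refl

  NoComma : List Γ → Set
  NoComma = All (λ g → isComma g ≡ false)

  field₁-prefix : ∀ zs acc t → NoComma zs → field₁ acc (zs ++ comma ∷ t) ≡ zs ʳ++ acc
  field₁-prefix []       acc t [] = refl
  field₁-prefix (z ∷ zs) acc t (e ∷ es) rewrite e = field₁-prefix zs (z ∷ acc) t es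

  field₂-prefix : ∀ zs acc t → NoComma zs → field₂ acc (zs ++ comma ∷ t) ≡ t
  field₂-prefix []       acc t [] = refl
  field₂-prefix (z ∷ zs) acc t (e ∷ es) rewrite e = field₂-prefix zs (z ∷ acc) t es

  field₁-all : ∀ zs acc → NoComma zs → field₁ acc zs ≡ zs ʳ++ acc
  field₁-all []       acc [] = refl
  field₁-all (z ∷ zs) acc (e ∷ es) rewrite e = field₁-all zs (z ∷ acc) es

  noComma-word : ∀ w → NoComma (reverse (word w))
  noComma-word w = subst NoComma (Listₚ.reverse-map letter w) (Allₚ.map⁺ (All.universal letter-not-comma (reverse w)))

  field₁-word : ∀ w t → field₁ [] (word w ʳ++ (comma ∷ t)) ≡ word w
  field₁-word w t = trans (cong (field₁ []) (Listₚ.ʳ++-defn (word w)))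
    (trans (field₁-prefix (reverse (word w)) [] t (noComma-word w)) (Listₚ.reverse-involutive (word w)))

  field₂-word : ∀ w t → field₂ [] (word w ʳ++ (comma ∷ t)) ≡ t
  field₂-word w t = trans (cong (field₂ []) (Listₚ.ʳ++-defn (word w))) (field₂-prefix (reverse (word w)) [] t (noComma-word w))

  field₁-last : ∀ w → field₁ [] (word w ʳ++ []) ≡ word w
  field₁-last w = trans (field₁-all (reverse (word w)) [] (noComma-word w)) (Listₚ.reverse-involutive (word w))

  rest-step : ∀ i w v t → rest i w ≡ word v ʳ++ (comma ∷ t) → rest (suc i) w ≡ t
  rest-step i w v t e = trans (cong (field₂ []) e) (field₂-word v t)

  part-step : ∀ i w v t → rest i w ≡ word v ʳ++ (comma ∷ t) → part i w ≡ word v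
  part-step i w v t e = trans (cong (field₁ []) e) (field₁-word v t)

  part-last : ∀ i w v → rest i w ≡ word v ʳ++ [] → part i w ≡ word v
  part-last i w v e = trans (cong (field₁ []) e) (field₁-last v)

  joinOnto-encode : ∀ ws → joinOnto (map word ws) [] ≡ map inp (rawEncode ws)
  joinOnto-encode []           = refl
  joinOnto-encode (w ∷ [])     = trans (Listₚ.++-identityʳ (word w)) (Listₚ.map-∘ w)
  joinOnto-encode (w ∷ v ∷ ws) = trans (cong₂ (λ a b → a ++ comma ∷ b) (Listₚ.map-∘ w) (joinOnto-encode (v ∷ ws)))
    (sym (Listₚ.map-++ inp (map (λ b → if b then # 1 else # 0) w) _))

  accepts-encode : ∀ ws → accepts (joinOnto (map word ws) []) ≡ acceptsWithin V p ws
  accepts-encode ws = cong₂ (λ t w → ⌊ Config.state (run V (eval p t) (initial V w)) Fin.≟ TM.accept V ⌋) lengths tapes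
    where
    tapes : map toSym (joinOnto (map word ws) []) ≡ encode V ws
    tapes = trans (cong (map toSym) (joinOnto-encode ws)) (trans (sym (Listₚ.map-∘ (rawEncode ws))) (sym (encode-raw V ws)))
    lengths : length (joinOnto (map word ws) []) ≡ length (encode V ws)
    lengths = trans (sym (Listₚ.length-map toSym (joinOnto (map word ws) []))) (cong length tapes)

  outcome₁ : ∀ x y₁ y₂ b₁ b₂ r → decided (verdicts₁ (reverse (map inp (rawEncode (x ∷ y₁ ∷ y₂ ∷ b₁ ∷ b₂ ∷ r ∷ []))))) ≡
             acceptsWithin V p (x ∷ y₁ ∷ b₁ ∷ r ∷ [])
  outcome₁ x y₁ y₂ b₁ b₂ r = begin
    decided (accepts (joinOnto (part 5 w ∷ part 4 w ∷ part 2 w ∷ part 0 w ∷ []) []) ∷ [])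
      ≡⟨ decided-singleton _ ⟩
    accepts (joinOnto (part 5 w ∷ part 4 w ∷ part 2 w ∷ part 0 w ∷ []) [])
      ≡⟨ cong₂ (λ a b → accepts (joinOnto (a ∷ b ∷ part 2 w ∷ part 0 w ∷ []) [])) (part-last 5 w x r₅) (part-step 4 w y₁ t₅ r₄) ⟩
    accepts (joinOnto (word x ∷ word y₁ ∷ part 2 w ∷ part 0 w ∷ []) [])
      ≡⟨ cong₂ (λ a b → accepts (joinOnto (word x ∷ word y₁ ∷ a ∷ b ∷ []) [])) (part-step 2 w b₁ t₃ r₂) (part-step 0 w r t₁ r₀) ⟩
    accepts (joinOnto (map word (x ∷ y₁ ∷ b₁ ∷ r ∷ [])) [])
      ≡⟨ accepts-encode (x ∷ y₁ ∷ b₁ ∷ r ∷ []) ⟩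
    acceptsWithin V p (x ∷ y₁ ∷ b₁ ∷ r ∷ []) ∎
    where
    open ≡-Reasoning
    ws : List (List Bool)
    ws = x ∷ y₁ ∷ y₂ ∷ b₁ ∷ b₂ ∷ r ∷ []
    w : List Γ
    w = reverse (map inp (rawEncode ws))
    t₁ t₂ t₃ t₄ t₅ : List Γ
    t₅ = word x ʳ++ []
    t₄ = word y₁ ʳ++ (comma ∷ t₅)
    t₃ = word y₂ ʳ++ (comma ∷ t₄)
    t₂ = word b₁ ʳ++ (comma ∷ t₃)
    t₁ = word b₂ ʳ++ (comma ∷ t₂)
    r₀ : rest 0 w ≡ word r ʳ++ (comma ∷ t₁)
    r₀ = pile-encode ws []
    r₁ : rest 1 w ≡ t₁
    r₁ = rest-step 0 w r t₁ r₀
    r₂ : rest 2 w ≡ t₂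
    r₂ = rest-step 1 w b₂ t₂ r₁
    r₃ : rest 3 w ≡ t₃
    r₃ = rest-step 2 w b₁ t₃ r₂
    r₄ : rest 4 w ≡ t₄
    r₄ = rest-step 3 w y₂ t₄ r₃
    r₅ : rest 5 w ≡ t₅
    r₅ = rest-step 4 w y₁ t₅ r₄
    decided-singleton : ∀ b → decided (b ∷ []) ≡ b
    decided-singleton false = refl
    decided-singleton true  = refl

  bundle-trials : ∀ q k l m u lq w {x y b c} → part 3 w ≡ word x → part 2 w ≡ word y → part 1 w ≡ word b → part 0 w ≡ word c →
                  bundle q k l m u lq w ≡ trials V p q k l m u lq x y b c
  bundle-trials q k l m u lq w {x} {y} {b} {c} ex ey eb ec rewrite ex | ey | eb | ec
    | Listₚ.take-map {f = letter} lq y | Listₚ.drop-map {f = letter} lq y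
    | Listₚ.take-map {f = letter} lq b | Listₚ.drop-map {f = letter} lq b =
    rounds₂-map letter _ _ (λ s a → rounds₂-map letter _ _ (λ t b' → rounds-map letter _ _
      (λ r → accepts-encode (x ∷ s ∷ t ∷ a ∷ b' ∷ r ∷ [])) m u c) q l (take lq y) (take lq b)) q k (drop lq y) (drop lq b)

  outcome₂ : ∀ qP kP lP mP uP lqP x y b c → let n = length x in
    decided (verdicts₂ qP kP lP mP uP lqP (reverse (map inp (rawEncode (x ∷ y ∷ b ∷ c ∷ []))))) ≡
    majority (trials V p (eval qP n) (eval kP n) (eval lP n) (eval mP n) (eval uP n) (eval lqP n) x y b c)
  outcome₂ qP kP lP mP uP lqP x y b c = trans (decided-majority (verdicts₂ qP kP lP mP uP lqP w)) (cong majority (begin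
    verdicts₂ qP kP lP mP uP lqP w   ≡⟨ cong (λ n → bundle (eval qP n) (eval kP n) (eval lP n) (eval mP n) (eval uP n) (eval lqP n) w)
                                            (trans (cong length (part-last 3 w x r₃)) (Listₚ.length-map letter x)) ⟩
    bundle (eval qP n) (eval kP n) (eval lP n) (eval mP n) (eval uP n) (eval lqP n) w
      ≡⟨ bundle-trials (eval qP n) (eval kP n) (eval lP n) (eval mP n) (eval uP n) (eval lqP n) w {x} {y} {b} {c}
           (part-last 3 w x r₃) (part-step 2 w y t₃ r₂) (part-step 1 w b t₂ r₁) (part-step 0 w c t₁ r₀) ⟩
    trials V p (eval qP n) (eval kP n) (eval lP n) (eval mP n) (eval uP n) (eval lqP n) x y b c ∎))
    where
    open ≡-Reasoning
    n : ℕ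
    n = length x
    ws : List (List Bool)
    ws = x ∷ y ∷ b ∷ c ∷ []
    w : List Γ
    w = reverse (map inp (rawEncode ws))
    t₁ t₂ t₃ : List Γ
    t₃ = word x ʳ++ []
    t₂ = word y ʳ++ (comma ∷ t₃)
    t₁ = word b ʳ++ (comma ∷ t₂)
    r₀ : rest 0 w ≡ word c ʳ++ (comma ∷ t₁)
    r₀ = pile-encode ws []
    r₁ : rest 1 w ≡ t₁
    r₁ = rest-step 0 w c t₁ r₀
    r₂ : rest 2 w ≡ t₂
    r₂ = rest-step 1 w b t₂ r₁
    r₃ : rest 3 w ≡ t₃
    r₃ = rest-step 2 w y t₃ r₂

-- Acceptance probabilities and the two inclusions

-- Lists in place of vectors, so that challenges can be split into blocks and rejoined without
-- transport along length equations.
bits : ℕ → List (List Bool)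
bits n = tuples (false ∷ true ∷ []) n

length-bits : ∀ n → length (bits n) ≡ 2 ^ n
length-bits n = length-tuples (false ∷ true ∷ []) n

∈-bits⁻ : ∀ {n w} → w ∈ bits n → length w ≡ n
∈-bits⁻ {n} p = proj₂ (∈-tuples⁻ n p)

∈-bits⁺ : ∀ {n w} → length w ≡ n → w ∈ bits n
∈-bits⁺ refl = ∈-tuples⁺ (All.universal (λ { false → here refl ; true → there (here refl) }) _)

∑-allVecs : ∀ n (F : List Bool → ℕ) → ∑[ v ∈ allVecs n ] F (Vec.toList v) ≡ ∑ (bits n) F
∑-allVecs zero    F = refl
∑-allVecs (suc n) F = begin
  ∑[ v ∈ allVecs (suc n) ] F (Vec.toList v)
    ≡⟨ ∑-concatMap _ (allVecs n) _ ⟩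
  ∑[ v ∈ allVecs n ] (F (false ∷ Vec.toList v) + (F (true ∷ Vec.toList v) + 0))
    ≡⟨ ∑-allVecs n (λ w → F (false ∷ w) + (F (true ∷ w) + 0)) ⟩
  ∑[ w ∈ bits n ] (F (false ∷ w) + (F (true ∷ w) + 0))
    ≡⟨ trans (∑-+ (bits n) _ _) (cong (∑ (bits n) (F ∘ (false ∷_)) +_)
         (trans (∑-cong (bits n) (λ w → +-identityʳ (F (true ∷ w)))) (sym (+-identityʳ _)))) ⟩
  ∑ (bits n) (F ∘ (false ∷_)) + (∑ (bits n) (F ∘ (true ∷_)) + 0)
    ≡⟨ sym (∑-tuples-suc (false ∷ true ∷ []) n F) ⟩
  ∑ (bits (suc n)) F ∎
  where open ≡-Reasoning

length-allVecs : ∀ n → length (allVecs n) ≡ 2 ^ n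
length-allVecs n = trans (length-∑ (allVecs n)) (trans (∑-allVecs n (λ _ → 1)) (trans (sym (length-∑ (bits n))) (length-bits n)))

-- Padding and truncation make a prover on vectors into a strategy on all lists whose answers always
-- have the right length.
vecOf : ∀ n → List Bool → Vec Bool n
vecOf zero    w       = []
vecOf (suc n) []      = false ∷ vecOf n []
vecOf (suc n) (b ∷ w) = b ∷ vecOf n w

toList-vecOf : ∀ {n} w → length w ≡ n → Vec.toList (vecOf n w) ≡ w
toList-vecOf []      refl = refl
toList-vecOf (b ∷ w) refl = cong (b ∷_) (toList-vecOf w refl)

vecOf-toList : ∀ {n} (v : Vec Bool n) → vecOf n (Vec.toList v) ≡ v
vecOf-toList []      = refl
vecOf-toList (b ∷ v) = cong (b ∷_) (vecOf-toList v)

count-∑ : ∀ {A : Set} (f : A → Bool) xs → count f xs ≡ ∑ xs (𝟙 ∘ f)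
count-∑ f []       = refl
count-∑ f (x ∷ xs) = cong (𝟙 (f x) +_) (count-∑ f xs)

∑-𝟙-not : ∀ {A : Set} (xs : List A) (f : A → Bool) → ∑ xs (𝟙 ∘ f) + ∑ xs (𝟙 ∘ not ∘ f) ≡ length xs
∑-𝟙-not []       f = refl
∑-𝟙-not (x ∷ xs) f with f x
... | true  = cong suc (∑-𝟙-not xs f)
... | false = trans (+-suc _ _) (cong suc (∑-𝟙-not xs f))

module _ (V : TM) (p q m : Poly) (x : List Bool) where

  private
    Q = eval q (length x)
    M = eval m (length x)

  ∑-coins : (k : ℕ) → (Vec (Vec Bool Q) k → Vec Bool M → ℕ) → ℕ
  ∑-coins k F = ∑[ ys ∈ allTuples k Q ] ∑[ r ∈ allVecs M ] F ys r

  message : ∀ k → Provers k Q → Vec (Vec Bool Q) k → Vec Bool M → List (List Bool)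
  message k b ys r = x ∷ (map toBits (Vec.toList ys) ++ map toBits (Vec.toList (vmapFin b ys)) ++ (toBits r ∷ []))

  accCount-∑ : ∀ k (b : Provers k Q) → accCount k V p q m x b ≡
    ∑-coins k (λ ys r → 𝟙 (acceptsWithin V p (message k b ys r)))
  accCount-∑ k b = begin
    accCount k V p q m x b                                        ≡⟨ count-∑ f (concatMap pairUp (allTuples k Q)) ⟩
    ∑ (concatMap pairUp (allTuples k Q)) (𝟙 ∘ f)                  ≡⟨ ∑-concatMap pairUp (allTuples k Q) (𝟙 ∘ f) ⟩
    ∑ (allTuples k Q) (λ ys → ∑ (pairUp ys) (𝟙 ∘ f))              ≡⟨ ∑-cong (allTuples k Q) (λ ys → ∑-map (ys ,_) (allVecs M) (𝟙 ∘ f)) ⟩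
    ∑-coins k (λ ys r → 𝟙 (acceptsWithin V p (message k b ys r))) ∎
    where
    open ≡-Reasoning
    f : Vec (Vec Bool Q) k × Vec Bool M → Bool
    f yr = acceptsWithin V p (message k b (proj₁ yr) (proj₂ yr))
    pairUp : Vec (Vec Bool Q) k → List (Vec (Vec Bool Q) k × Vec Bool M)
    pairUp ys = map (ys ,_) (allVecs M)

  ∑-allTuples-suc : ∀ k (F : Vec (Vec Bool Q) (suc k) → ℕ) →
    ∑ (allTuples (suc k) Q) F ≡ ∑[ y ∈ allVecs Q ] ∑[ ys ∈ allTuples k Q ] F (y ∷ ys)
  ∑-allTuples-suc k F = trans (∑-concatMap (λ y → map (y ∷_) (allTuples k Q)) (allVecs Q) F)
    (∑-cong (allVecs Q) (λ y → ∑-map (y ∷_) (allTuples k Q) F))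

  accCount-1 : ∀ (b : Provers 1 Q) → accCount 1 V p q m x b ≡
    ∑[ y ∈ allVecs Q ] ∑[ r ∈ allVecs M ] 𝟙 (acceptsWithin V p (x ∷ toBits y ∷ toBits (b zero y) ∷ toBits r ∷ []))
  accCount-1 b = trans (accCount-∑ 1 b) (trans (∑-allTuples-suc 0 F) (∑-cong (allVecs Q) (λ y → +-identityʳ (F (y ∷ [])))))
    where
    F : Vec (Vec Bool Q) 1 → ℕ
    F ys = ∑[ r ∈ allVecs M ] 𝟙 (acceptsWithin V p (message 1 b ys r))

  accCount-2 : ∀ (b : Provers 2 Q) → accCount 2 V p q m x b ≡
    ∑[ y₁ ∈ allVecs Q ] ∑[ y₂ ∈ allVecs Q ] ∑[ r ∈ allVecs M ]
      𝟙 (acceptsWithin V p (x ∷ toBits y₁ ∷ toBits y₂ ∷ toBits (b zero y₁) ∷ toBits (b (suc zero) y₂) ∷ toBits r ∷ []))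
  accCount-2 b = trans (accCount-∑ 2 b) (trans (∑-allTuples-suc 1 F) (∑-cong (allVecs Q) (λ y₁ →
    trans (∑-allTuples-suc 0 (λ ys → F (y₁ ∷ ys))) (∑-cong (allVecs Q) (λ y₂ → +-identityʳ (F (y₁ ∷ y₂ ∷ [])))))))
    where
    F : Vec (Vec Bool Q) 2 → ℕ
    F ys = ∑[ r ∈ allVecs M ] 𝟙 (acceptsWithin V p (message 2 b ys r))

-- All that the two inclusions see of a machine: its time bound and its verdict on a family of
-- inputs. The instances are abstract, so the compiled machines are never unfolded.
PolyTimeOn : {I : Set} → (I → List (List Bool)) → (I → Bool) → Set
PolyTimeOn inputs f = Σ TM λ M → Σ Poly λ P → RunsInTime M P × (∀ i → acceptsWithin M P (inputs i) ≡ f i)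

restrict : ∀ {I : Set} f → PolyTime f → (inputs : I → List (List Bool)) (g : I → Bool) →
           (∀ i → f (rawEncode (inputs i)) ≡ g i) → PolyTimeOn inputs g
restrict f (M , P , runs , meaning) inputs g e = M , P , runs , λ i → trans (meaning (inputs i)) (e i)

-- From one prover to two

record Transcript : Set where
  constructor transcript
  field x y₁ y₂ b₁ b₂ r : List Bool

full short : Transcript → List (List Bool)
full  (transcript x y₁ y₂ b₁ b₂ r) = x ∷ y₁ ∷ y₂ ∷ b₁ ∷ b₂ ∷ r ∷ []
short (transcript x y₁ y₂ b₁ b₂ r) = x ∷ y₁ ∷ b₁ ∷ r ∷ []

abstract
  ignoringSecond : ∀ V p → PolyTimeOn full (acceptsWithin V p ∘ short)
  ignoringSecond V p = restrict (λ w → Deciders.decided V p (Deciders.verdicts₁ V p (reverse (map (Deciders.inp V p) w)))) (Outcomes.decider₁ V p) full (acceptsWithin V p ∘ short)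
    (λ (transcript x y₁ y₂ b₁ b₂ r) → Outcomes.outcome₁ V p x y₁ y₂ b₁ b₂ r)

AM1⇒AM2 : ∀ Lang → AM 1 Lang → AM 2 Lang
AM1⇒AM2 Lang (q , m , V , p , _ , spec) = build (ignoringSecond V p)
  where
  scaled : ∀ a c N t u → a * t ≤ c * u → a * (N * t) ≤ c * (N * u)
  scaled a c N t u le = begin
    a * (N * t)  ≡⟨ swap a N t ⟩
    N * (a * t)  ≤⟨ *-monoʳ-≤ N le ⟩
    N * (c * u)  ≡⟨ swap N c u ⟩
    c * (N * u)  ∎
    where
    open ≤-Reasoning
    swap : ∀ a b c → a * (b * c) ≡ b * (a * c)
    swap = ℕ-Ring.solve-∀
  build : PolyTimeOn full (acceptsWithin V p ∘ short) → AM 2 Lang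
  build (M , P , runs , meaning) = q , m , M , P , runs , λ x → complete x , sound x
    where
    module _ (x : List Bool) where
      Q : ℕ
      Q = eval q (length x)
      total-2 : total 2 q m x ≡ 2 ^ Q * total 1 q m x
      total-2 = trans (cong (2 ^_) (shape Q (eval m (length x)))) (^-distribˡ-+-* 2 Q (1 * Q + eval m (length x)))
        where
        shape : ∀ a b → 2 * a + b ≡ a + (1 * a + b)
        shape = ℕ-Ring.solve-∀
      accepted : ∀ b → accCount 2 M P q m x b ≡ 2 ^ Q * accCount 1 V p q m x (λ _ → b zero)
      accepted b = begin
        accCount 2 M P q m x b
          ≡⟨ accCount-2 M P q m x b ⟩
        (∑[ y₁ ∈ allVecs Q ] ∑[ y₂ ∈ allVecs Q ] ∑[ r ∈ allVecs (eval m (length x)) ] 𝟙 (acceptsWithin M P (full (play y₁ y₂ r))))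
          ≡⟨ ∑-cong (allVecs Q) (λ y₁ → ∑-cong (allVecs Q) (λ y₂ → ∑-cong (allVecs (eval m (length x))) (λ r →
               cong 𝟙 (meaning (play y₁ y₂ r))))) ⟩
        (∑[ y₁ ∈ allVecs Q ] ∑[ y₂ ∈ allVecs Q ] single y₁)
          ≡⟨ ∑-cong (allVecs Q) (λ y₁ → trans (∑-const (allVecs Q) (single y₁)) (cong (_* single y₁) (length-allVecs Q))) ⟩
        (∑[ y₁ ∈ allVecs Q ] 2 ^ Q * single y₁)
          ≡⟨ ∑-*ˡ (2 ^ Q) (allVecs Q) single ⟩
        2 ^ Q * ∑ (allVecs Q) single
          ≡⟨ cong (2 ^ Q *_) (sym (accCount-1 V p q m x (λ _ → b zero))) ⟩
        2 ^ Q * accCount 1 V p q m x (λ _ → b zero) ∎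
        where
        open ≡-Reasoning
        play : Vec Bool Q → Vec Bool Q → Vec Bool (eval m (length x)) → Transcript
        play y₁ y₂ r = transcript x (toBits y₁) (toBits y₂) (toBits (b zero y₁)) (toBits (b (suc zero) y₂)) (toBits r)
        single : Vec Bool Q → ℕ
        single y₁ = ∑[ r ∈ allVecs (eval m (length x)) ] 𝟙 (acceptsWithin V p (x ∷ toBits y₁ ∷ toBits (b zero y₁) ∷ toBits r ∷ []))
      -- A family over `Fin 1` equals the constant family of its only member just pointwise; the
      -- counts agree because both reduce to `b zero`.
      ignore-index : ∀ b → accCount 1 V p q m x b ≡ accCount 1 V p q m x (λ _ → b zero)
      ignore-index b = trans (accCount-1 V p q m x b) (sym (accCount-1 V p q m x (λ _ → b zero)))
      complete : Lang x → Σ (Provers 2 Q) λ b → 2 * total 2 q m x ≤ 3 * accCount 2 M P q m x b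
      complete x∈ = let (b , good) = proj₁ (spec x) x∈ in (λ _ → b zero) , (begin
        2 * total 2 q m x                                     ≡⟨ cong (2 *_) total-2 ⟩
        2 * (2 ^ Q * total 1 q m x)                           ≤⟨ scaled 2 3 (2 ^ Q) (total 1 q m x) (accCount 1 V p q m x b) good ⟩
        3 * (2 ^ Q * accCount 1 V p q m x b)                  ≡⟨ cong (λ a → 3 * (2 ^ Q * a)) (ignore-index b) ⟩
        3 * (2 ^ Q * accCount 1 V p q m x (λ _ → b zero))     ≡⟨ cong (3 *_) (sym (accepted (λ _ → b zero))) ⟩
        3 * accCount 2 M P q m x (λ _ → b zero)               ∎)
        where open ≤-Reasoning
      sound : ¬ Lang x → ∀ (b : Provers 2 Q) → 3 * accCount 2 M P q m x b ≤ total 2 q m x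
      sound x∉ b = begin
        3 * accCount 2 M P q m x b                            ≡⟨ cong (3 *_) (accepted b) ⟩
        3 * (2 ^ Q * accCount 1 V p q m x (λ _ → b zero))     ≤⟨ scaled 3 1 (2 ^ Q) (accCount 1 V p q m x (λ _ → b zero)) (total 1 q m x) (≤-trans (proj₂ (spec x) x∉ (λ _ → b zero)) (≤-reflexive (sym (*-identityˡ _)))) ⟩
        1 * (2 ^ Q * total 1 q m x)                           ≡⟨ *-identityˡ _ ⟩
        2 ^ Q * total 1 q m x                                 ≡⟨ sym total-2 ⟩
        total 2 q m x                                         ∎
        where open ≤-Reasoning

-- From two provers to one

record Exam : Set where
  constructor exam
  field x y b c : List Bool

fields : Exam → List (List Bool)
fields (exam x y b c) = x ∷ y ∷ b ∷ c ∷ []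

module _ (V : TM) (p qP kP lP mP uP lqP : Poly) where

  repeatedly : Exam → Bool
  repeatedly (exam x y b c) = let n = length x in
    majority (trials V p (eval qP n) (eval kP n) (eval lP n) (eval mP n) (eval uP n) (eval lqP n) x y b c)

  abstract
    repeated : PolyTimeOn fields repeatedly
    repeated = restrict (λ w → Deciders.decided V p (Deciders.verdicts₂ V p qP kP lP mP uP lqP (reverse (map (Deciders.inp V p) w))))
      (Outcomes.decider₂ V p qP kP lP mP uP lqP) fields repeatedly
      (λ (exam x y b c) → Outcomes.outcome₂ V p qP kP lP mP uP lqP x y b c)

majority-hits : ∀ bs {N} → length bs ≡ N → 𝟙 (majority bs) ≤ 𝟙 (N ≤ᵇ 2 * ∑ bs 𝟙)
majority-hits bs refl = 𝟙-≤ᵇ-mono λ le → begin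
  length bs                          ≡⟨ sym (∑-𝟙-not bs id) ⟩
  ∑ bs 𝟙 + ∑ bs (𝟙 ∘ not)            ≤⟨ +-monoʳ-≤ (∑ bs 𝟙) le ⟩
  ∑ bs 𝟙 + ∑ bs 𝟙                    ≡⟨ cong (∑ bs 𝟙 +_) (sym (+-identityʳ _)) ⟩
  2 * ∑ bs 𝟙                         ∎
  where open ≤-Reasoning

majority-misses : ∀ bs {N} → length bs ≡ N → 𝟙 (not (majority bs)) ≤ 𝟙 (N ≤ᵇ 2 * ∑ bs (𝟙 ∘ not))
majority-misses bs refl with majority bs in eq
... | true  = z≤n
... | false = ≤-reflexive (sym (𝟙-true (≤⇒≤ᵇ (begin
  length bs                              ≡⟨ sym (∑-𝟙-not bs id) ⟩
  ∑ bs 𝟙 + ∑ bs (𝟙 ∘ not)                ≤⟨ +-monoˡ-≤ (∑ bs (𝟙 ∘ not)) fewer ⟩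
  ∑ bs (𝟙 ∘ not) + ∑ bs (𝟙 ∘ not)        ≡⟨ cong (∑ bs (𝟙 ∘ not) +_) (sym (+-identityʳ _)) ⟩
  2 * ∑ bs (𝟙 ∘ not)                     ∎))))
  where
  open ≤-Reasoning
  fewer : ∑ bs 𝟙 ≤ ∑ bs (𝟙 ∘ not)
  fewer with ≤-total (∑ bs (𝟙 ∘ not)) (∑ bs 𝟙)
  ... | inj₂ le = le
  ... | inj₁ le = ⊥-elim (subst T eq (≤⇒≤ᵇ le))

zip-map-∑ : ∀ {A B : Set} (f : A → B) (g : A × B → ℕ) xs → ∑ (zip xs (map f xs)) g ≡ ∑ xs (λ x → g (x , f x))
zip-map-∑ f g []       = refl
zip-map-∑ f g (x ∷ xs) = cong (g (x , f x) +_) (zip-map-∑ f g xs)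

∈-tuples-bits : ∀ q k {w} → w ∈ tuples (bits q) k → All (λ v → length v ≡ q) w × length w ≡ k
∈-tuples-bits q k w∈ = All.map ∈-bits⁻ (proj₁ (∈-tuples⁻ k w∈)) , proj₂ (∈-tuples⁻ k w∈)

module Repetition (V : TM) (p : Poly) (x : List Bool) (Q M : ℕ) where

  k l u : ℕ
  k = kSize Q
  l = lSize Q
  u = uSize

  answers₁ answers₂ : List Bool → List (List Bool)
  answers₁ B = chunks Q k (drop (l * Q) B)
  answers₂ B = chunks Q l (take (l * Q) B)

  ballot : List (List Bool) → List (List Bool) → List (List Bool) → List Bool → List Bool
  ballot U W C B = trials V p Q k l M u (l * Q) x (concat W ++ concat U) B (concat C)

  length-ballot : ∀ U W C B → length (ballot U W C B) ≡ k * l * u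
  length-ballot U W C B = trans
    (length-rounds₂ _ Q k _ _ λ s a → length-rounds₂ _ Q l _ _ λ t b → length-rounds _ M u _) (sym (*-assoc k l u))

  length-blocks : ∀ q j {ws} → ws ∈ tuples (bits q) j → length (concat ws) ≡ j * q
  length-blocks q j {ws} ws∈ = trans (length-concat q ws (proj₁ (∈-tuples-bits q j ws∈))) (cong (_* q) (proj₂ (∈-tuples-bits q j ws∈)))

  take-blocks : ∀ q j {ws} → ws ∈ tuples (bits q) j → ∀ v → take (j * q) (concat ws ++ v) ≡ concat ws
  take-blocks q j {ws} ws∈ v = subst (λ n → take n (concat ws ++ v) ≡ concat ws) (length-blocks q j ws∈) (take-prefix (concat ws) v)

  drop-blocks : ∀ q j {ws} → ws ∈ tuples (bits q) j → ∀ v → drop (j * q) (concat ws ++ v) ≡ v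
  drop-blocks q j {ws} ws∈ v = subst (λ n → drop n (concat ws ++ v) ≡ v) (length-blocks q j ws∈) (drop-prefix (concat ws) v)

  chunks-whole : ∀ q j {ws} → ws ∈ tuples (bits q) j → chunks q j (concat ws) ≡ ws
  chunks-whole q j {ws} ws∈ = subst (λ i → chunks q i (concat ws) ≡ ws) (proj₂ (∈-tuples-bits q j ws∈))
    (chunks-concat q ws (proj₁ (∈-tuples-bits q j ws∈)))

  -- Kept general in g because soundness counts accepting trials and completeness rejecting ones.
  ballot-∑ : ∀ (g : Bool → ℕ) {U W C} B → U ∈ tuples (bits Q) k → W ∈ tuples (bits Q) l → C ∈ tuples (bits M) u →
    ∑ (ballot U W C B) g ≡
    ∑[ sa ∈ zip U (answers₁ B) ] ∑[ tb ∈ zip W (answers₂ B) ] ∑[ r ∈ C ]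
      g (trial V p x (proj₁ sa) (proj₁ tb) (proj₂ sa) (proj₂ tb) r)
  ballot-∑ g {U} {W} {C} B U∈ W∈ C∈ = begin
    ∑ (ballot U W C B) g
      ≡⟨ ∑-rounds₂ g E₁ Q k (drop lq y) (drop lq B) ⟩
    ∑ (zip (chunks Q k (drop lq y)) (answers₁ B)) (λ sa → ∑ (E₁ (proj₁ sa) (proj₂ sa)) g)
      ≡⟨ cong (λ us → ∑ (zip us (answers₁ B)) (λ sa → ∑ (E₁ (proj₁ sa) (proj₂ sa)) g)) chunksU ⟩
    ∑ (zip U (answers₁ B)) (λ sa → ∑ (E₁ (proj₁ sa) (proj₂ sa)) g)
      ≡⟨ ∑-cong (zip U (answers₁ B)) (λ sa → trans (∑-rounds₂ g (E₂ sa) Q l (take lq y) (take lq B))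
           (trans (cong (λ ws → ∑ (zip ws (answers₂ B)) (λ tb → ∑ (E₂ sa (proj₁ tb) (proj₂ tb)) g)) chunksW)
             (∑-cong (zip W (answers₂ B)) (λ tb → trans (∑-rounds g _ M u (concat C)) (cong (λ cs → ∑ cs _) chunksC))))) ⟩
    ∑[ sa ∈ zip U (answers₁ B) ] ∑[ tb ∈ zip W (answers₂ B) ] ∑[ r ∈ C ]
      g (trial V p x (proj₁ sa) (proj₁ tb) (proj₂ sa) (proj₂ tb) r) ∎
    where
    open ≡-Reasoning
    lq : ℕ
    lq = l * Q
    y : List Bool
    y = concat W ++ concat U
    E₂ : List Bool × List Bool → List Bool → List Bool → List Bool
    E₂ sa t b = rounds (trial V p x (proj₁ sa) t (proj₂ sa) b) M u (concat C)
    E₁ : List Bool → List Bool → List Bool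
    E₁ s a = rounds₂ (E₂ (s , a)) Q l (take lq y) (take lq B)
    chunksU : chunks Q k (drop lq y) ≡ U
    chunksU = trans (cong (chunks Q k) (drop-blocks Q l W∈ (concat U))) (chunks-whole Q k U∈)
    chunksW : chunks Q l (take lq y) ≡ W
    chunksW = trans (cong (chunks Q l) (take-blocks Q l W∈ (concat U))) (chunks-whole Q l W∈)
    chunksC : chunks M u (concat C) ≡ C
    chunksC = chunks-whole M u C∈

  -- The letters of a uniform string are independent, so it splits into independent blocks. The
  -- lengths enter through equations because they will be values of polynomials, which match the
  -- block lengths only propositionally.
  ∑-blocks : ∀ {q' m'} → q' ≡ l * Q + k * Q → m' ≡ u * M → (F : List Bool → List Bool → ℕ) →
    (∑[ y ∈ allVecs q' ] ∑[ r ∈ allVecs m' ] F (Vec.toList y) (Vec.toList r)) ≡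
    (∑[ U ∈ tuples (bits Q) k ] ∑[ W ∈ tuples (bits Q) l ] ∑[ C ∈ tuples (bits M) u ] F (concat W ++ concat U) (concat C))
  ∑-blocks refl refl F = begin
    (∑[ y ∈ allVecs (l * Q + k * Q) ] ∑[ r ∈ allVecs (u * M) ] F (Vec.toList y) (Vec.toList r))
      ≡⟨ ∑-cong (allVecs (l * Q + k * Q)) (λ y → trans (∑-allVecs (u * M) (F (Vec.toList y))) (∑-tuples-* _ u M (F (Vec.toList y)))) ⟩
    (∑[ y ∈ allVecs (l * Q + k * Q) ] G (Vec.toList y))
      ≡⟨ ∑-allVecs (l * Q + k * Q) G ⟩
    ∑ (bits (l * Q + k * Q)) G
      ≡⟨ ∑-tuples-+ _ (l * Q) (k * Q) G ⟩
    (∑[ v ∈ bits (l * Q) ] ∑[ w ∈ bits (k * Q) ] G (v ++ w))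
      ≡⟨ ∑-tuples-* _ l Q (λ v → ∑[ w ∈ bits (k * Q) ] G (v ++ w)) ⟩
    (∑[ W ∈ tuples (bits Q) l ] ∑[ w ∈ bits (k * Q) ] G (concat W ++ w))
      ≡⟨ ∑-cong (tuples (bits Q) l) (λ W → ∑-tuples-* _ k Q (λ w → G (concat W ++ w))) ⟩
    (∑[ W ∈ tuples (bits Q) l ] ∑[ U ∈ tuples (bits Q) k ] G (concat W ++ concat U))
      ≡⟨ ∑-swap (tuples (bits Q) l) (tuples (bits Q) k) _ ⟩
    (∑[ U ∈ tuples (bits Q) k ] ∑[ W ∈ tuples (bits Q) l ] G (concat W ++ concat U)) ∎
    where
    open ≡-Reasoning
    G : List Bool → ℕ
    G Y = ∑[ C ∈ tuples (bits M) u ] F Y (concat C)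

  rotate : ∀ {X Y Z : Set} (xs : List X) (ys : List Y) (zs : List Z) (f : X → Y → Z → ℕ) →
    (∑[ a ∈ xs ] ∑[ b ∈ ys ] ∑[ c ∈ zs ] f a b c) ≡ (∑[ c ∈ zs ] ∑[ a ∈ xs ] ∑[ b ∈ ys ] f a b c)
  rotate xs ys zs f = trans (∑-cong xs (λ a → ∑-swap ys zs (f a))) (∑-swap xs zs (λ a c → ∑[ b ∈ ys ] f a b c))

  allQ allM : ℕ
  allQ = length (bits Q)
  allM = length (bits M)

  instance
    allQ≢0 : NonZero allQ
    allQ≢0 = subst NonZero (sym (length-bits Q)) (m^n≢0 2 Q)

    allM≢0 : NonZero allM
    allM≢0 = subst NonZero (sym (length-bits M)) (m^n≢0 2 M)

  -- The answer `B` is a function of both samples but not of the coins C: Merlin sees the entire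
  -- challenge and none of the verifier's coins.
  soundness : (∀ (β₁ β₂ : List Bool → List Bool) → (∀ y → β₁ y ∈ bits Q) → (∀ y → β₂ y ∈ bits Q) →
      3 * (∑[ s ∈ bits Q ] ∑[ t ∈ bits Q ] ∑[ r ∈ bits M ] 𝟙 (trial V p x s t (β₁ s) (β₂ t) r)) ≤ allQ * (allQ * allM)) →
    (B : List (List Bool) → List (List Bool) → List Bool) → (∀ U W → length (B U W) ≡ l * Q + k * Q) →
    3 * (∑[ U ∈ tuples (bits Q) k ] ∑[ W ∈ tuples (bits Q) l ] ∑[ C ∈ tuples (bits M) u ] 𝟙 (majority (ballot U W C (B U W))))
      ≤ allQ ^ k * (allQ ^ l * allM ^ u)
  soundness sound B |B| = ≤-trans
    (*-monoʳ-≤ 3 (∑-mono-∈ (tuples (bits Q) k) λ {U} U∈ → ∑-mono-∈ (tuples (bits Q) l) λ {W} W∈ → ∑-mono-∈ (tuples (bits M) u) λ {C} C∈ →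
      ≤-trans (majority-hits (ballot U W C (B U W)) (length-ballot U W C (B U W)))
              (≤-reflexive (cong (λ h → 𝟙 (k * l * u ≤ᵇ 2 * h)) (trans (ballot-∑ 𝟙 (B U W) U∈ W∈ C∈)
                (rotate (zip U (answers₁ (B U W))) (zip W (answers₂ (B U W))) C _))))))
    (Game.subsampling sound (λ U W → answers₁ (B U W)) (λ U W → answers₂ (B U W)) legal)
    where
    module Game = Subsampling (bits Q) (bits Q) (bits M) (λ s t a b r → trial V p x s t a b r) Q
      (≤-reflexive (length-bits Q)) (≤-reflexive (length-bits Q)) (Vec.toList (Vec.replicate Q false))
      (∈-bits⁺ (Vecₚ.length-toList (Vec.replicate Q false)))
    in-tuples : ∀ j v → length v ≡ j * Q → chunks Q j v ∈ tuples (bits Q) j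
    in-tuples j v e = subst (λ i → chunks Q j v ∈ tuples (bits Q) i) (length-chunks Q j v) (∈-tuples⁺ (All.map ∈-bits⁺ (chunk-lengths Q j v e)))
    legal : ∀ {U W} → U ∈ tuples (bits Q) k → W ∈ tuples (bits Q) l →
            answers₁ (B U W) ∈ tuples (bits Q) k × answers₂ (B U W) ∈ tuples (bits Q) l
    legal {U} {W} _ _ =
      in-tuples k _ (trans (Listₚ.length-drop (l * Q) (B U W)) (trans (cong (_∸ l * Q) (|B| U W)) (m+n∸m≡n (l * Q) (k * Q)))) ,
      in-tuples l _ (trans (Listₚ.length-take (l * Q) (B U W)) (m≤n⇒m⊓n≡m (≤-trans (m≤m+n (l * Q) (k * Q)) (≤-reflexive (sym (|B| U W))))))

  module _ (β₁ β₂ : List Bool → List Bool) (legal₁ : ∀ y → length (β₁ y) ≡ Q) (legal₂ : ∀ y → length (β₂ y) ≡ Q) where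

    honest : List Bool → List Bool
    honest Y = concat (map β₂ (chunks Q l (take (l * Q) Y))) ++ concat (map β₁ (chunks Q k (drop (l * Q) Y)))

    length-part-honest : ∀ j (β : List Bool → List Bool) → (∀ y → length (β y) ≡ Q) → ∀ Y → length (concat (map β (chunks Q j Y))) ≡ j * Q
    length-part-honest j β legal Y = trans (length-concat Q _ (Allₚ.map⁺ (All.universal legal (chunks Q j Y))))
      (cong (_* Q) (trans (Listₚ.length-map β (chunks Q j Y)) (length-chunks Q j Y)))

    length-honest : ∀ Y → length (honest Y) ≡ l * Q + k * Q
    length-honest Y = trans (Listₚ.length-++ (concat (map β₂ (chunks Q l (take (l * Q) Y)))))
      (cong₂ _+_ (length-part-honest l β₂ legal₂ (take (l * Q) Y)) (length-part-honest k β₁ legal₁ (drop (l * Q) Y)))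

    all-legal : ∀ {β : List Bool → List Bool} → (∀ y → length (β y) ≡ Q) → ∀ {j ws} → length ws ≡ j →
                chunks Q j (concat (map β ws)) ≡ map β ws
    all-legal {β} legal {ws = ws} refl = subst (λ i → chunks Q i (concat (map β ws)) ≡ map β ws) (Listₚ.length-map β ws)
      (chunks-concat Q (map β ws) (Allₚ.map⁺ (All.universal legal ws)))

    module _ {U W : List (List Bool)} (U∈ : U ∈ tuples (bits Q) k) (W∈ : W ∈ tuples (bits Q) l) where

      honest-blocks : honest (concat W ++ concat U) ≡ concat (map β₂ W) ++ concat (map β₁ U)
      honest-blocks = cong₂ (λ a b → concat (map β₂ a) ++ concat (map β₁ b))
        (trans (cong (chunks Q l) (take-blocks Q l W∈ (concat U))) (chunks-whole Q l W∈))
        (trans (cong (chunks Q k) (drop-blocks Q l W∈ (concat U))) (chunks-whole Q k U∈))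

      |W| : length W ≡ l
      |W| = proj₂ (∈-tuples-bits Q l W∈)

      |β₂W| : length (concat (map β₂ W)) ≡ l * Q
      |β₂W| = trans (length-concat Q _ (Allₚ.map⁺ (All.universal legal₂ W)))
        (cong (_* Q) (trans (Listₚ.length-map β₂ W) |W|))

      honest-answers₁ : answers₁ (honest (concat W ++ concat U)) ≡ map β₁ U
      honest-answers₁ = trans (cong answers₁ honest-blocks) (trans
        (cong (chunks Q k) (subst (λ n → drop n (concat (map β₂ W) ++ concat (map β₁ U)) ≡ concat (map β₁ U)) |β₂W| (drop-prefix (concat (map β₂ W)) _)))
        (all-legal legal₁ (proj₂ (∈-tuples-bits Q k U∈))))

      honest-answers₂ : answers₂ (honest (concat W ++ concat U)) ≡ map β₂ W
      honest-answers₂ = trans (cong answers₂ honest-blocks) (trans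
        (cong (chunks Q l) (subst (λ n → take n (concat (map β₂ W) ++ concat (map β₁ U)) ≡ concat (map β₂ W)) |β₂W| (take-prefix (concat (map β₂ W)) _)))
        (all-legal legal₂ |W|))

    fails : List Bool → List Bool → List Bool → ℕ
    fails s t r = 𝟙 (not (trial V p x s t (β₁ s) (β₂ t) r))

    -- Once the provers are fixed, a rejecting trial is a win in a game with trivial answers, to which the soundness
    -- bound applies.
    completeness : 3 * (∑[ s ∈ bits Q ] ∑[ t ∈ bits Q ] ∑[ r ∈ bits M ] fails s t r) ≤ allQ * (allQ * allM) →
      3 * (∑[ U ∈ tuples (bits Q) k ] ∑[ W ∈ tuples (bits Q) l ] ∑[ C ∈ tuples (bits M) u ]
             𝟙 (not (majority (ballot U W C (honest (concat W ++ concat U)))))) ≤ allQ ^ k * (allQ ^ l * allM ^ u)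
    completeness few = ≤-trans
      (*-monoʳ-≤ 3 (∑-mono-∈ (tuples (bits Q) k) λ {U} U∈ → ∑-mono-∈ (tuples (bits Q) l) λ {W} W∈ → ∑-mono-∈ (tuples (bits M) u) λ {C} C∈ →
        ≤-trans (majority-misses (ballot U W C (honest (concat W ++ concat U))) (length-ballot U W C (honest (concat W ++ concat U))))
                (≤-reflexive (cong (λ h → 𝟙 (k * l * u ≤ᵇ 2 * h)) (misses U∈ W∈ C∈)))))
      (Game.subsampling (λ _ _ _ _ → few) (λ U _ → map (λ _ → tt) U) (λ _ W → map (λ _ → tt) W)
        (λ U∈ W∈ → trivial k (proj₂ (∈-tuples-bits Q k U∈)) , trivial l (proj₂ (∈-tuples-bits Q l W∈))))
      where
      module Game = Subsampling (bits Q) (tt ∷ []) (bits M) (λ s t _ _ r → not (trial V p x s t (β₁ s) (β₂ t) r)) Q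
        (≤-reflexive (length-bits Q)) (m^n>0 2 Q) tt (here refl)
      trivial : ∀ j {ws : List (List Bool)} → length ws ≡ j → map (λ _ → tt) ws ∈ tuples (tt ∷ []) j
      trivial j {ws} refl = subst (λ i → map (λ _ → tt) ws ∈ tuples (tt ∷ []) i) (Listₚ.length-map (λ _ → tt) ws)
        (∈-tuples⁺ (All.universal (λ _ → here refl) _))
      misses : ∀ {U W C} → U ∈ tuples (bits Q) k → W ∈ tuples (bits Q) l → C ∈ tuples (bits M) u →
        ∑ (ballot U W C (honest (concat W ++ concat U))) (𝟙 ∘ not) ≡ ∑ C (Game.hits U W (map (λ _ → tt) U) (map (λ _ → tt) W))
      misses {U} {W} {C} U∈ W∈ C∈ = begin
        ∑ (ballot U W C B) (𝟙 ∘ not)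
          ≡⟨ ballot-∑ (𝟙 ∘ not) B U∈ W∈ C∈ ⟩
        ∑ (zip U (answers₁ B)) (λ sa → ∑ (zip W (answers₂ B)) (λ tb → miss sa tb))
          ≡⟨ cong₂ (λ as bs → ∑ (zip U as) (λ sa → ∑ (zip W bs) (λ tb → miss sa tb))) (honest-answers₁ U∈ W∈) (honest-answers₂ U∈ W∈) ⟩
        ∑ (zip U (map β₁ U)) (λ sa → ∑ (zip W (map β₂ W)) (λ tb → miss sa tb))
          ≡⟨ trans (zip-map-∑ β₁ (λ sa → ∑ (zip W (map β₂ W)) (miss sa)) U) (∑-cong U (λ s → zip-map-∑ β₂ (miss (s , β₁ s)) W)) ⟩
        (∑[ s ∈ U ] ∑[ t ∈ W ] ∑[ r ∈ C ] fails s t r)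
          ≡⟨ rotate U W C fails ⟩
        (∑[ r ∈ C ] ∑[ s ∈ U ] ∑[ t ∈ W ] fails s t r)
          ≡⟨ ∑-cong C (λ r → sym (trans (zip-map-∑ (λ _ → tt) (λ sa → ∑ (zip W (map (λ _ → tt) W)) (λ tb → fails (proj₁ sa) (proj₁ tb) r)) U)
               (∑-cong U (λ s → zip-map-∑ (λ _ → tt) (λ tb → fails s (proj₁ tb) r) W)))) ⟩
        ∑ C (Game.hits U W (map (λ _ → tt) U) (map (λ _ → tt) W)) ∎
        where
        open ≡-Reasoning
        B : List Bool
        B = honest (concat W ++ concat U)
        miss : List Bool × List Bool → List Bool × List Bool → ℕ
        miss sa tb = ∑[ r ∈ C ] 𝟙 (not (trial V p x (proj₁ sa) (proj₁ tb) (proj₂ sa) (proj₂ tb) r))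

∑³-complement : ∀ {A B C : Set} (xs : List A) (ys : List B) (zs : List C) (f : A → B → C → Bool) →
  (∑[ x ∈ xs ] ∑[ y ∈ ys ] ∑[ z ∈ zs ] 𝟙 (f x y z)) + (∑[ x ∈ xs ] ∑[ y ∈ ys ] ∑[ z ∈ zs ] 𝟙 (not (f x y z))) ≡
  length xs * (length ys * length zs)
∑³-complement xs ys zs f = trans (sym (∑-+ xs _ _)) (trans (∑-cong xs (λ x → trans (sym (∑-+ ys _ _))
  (trans (∑-cong ys (λ y → ∑-𝟙-not zs (f x y))) (∑-const ys (length zs))))) (∑-const xs _))

-- The game estimate bounds frequencies from above. Acceptance with probability 2/3 is therefore
-- turned into failure with probability 1/3 before the repetition, and `many-successes` turns it
-- back afterwards.
few-failures : ∀ a f {t} → a + f ≡ t → 2 * t ≤ 3 * a → 3 * f ≤ t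
few-failures a f refl le = +-cancelʳ-≤ (2 * (a + f)) _ _ (begin
  3 * f + 2 * (a + f)        ≤⟨ +-monoʳ-≤ (3 * f) le ⟩
  3 * f + 3 * a              ≡⟨ collect a f ⟩
  a + f + 2 * (a + f)        ∎)
  where
  open ≤-Reasoning
  collect : ∀ a f → 3 * f + 3 * a ≡ a + f + 2 * (a + f)
  collect = ℕ-Ring.solve-∀

many-successes : ∀ a f {t} → a + f ≡ t → 3 * f ≤ t → 2 * t ≤ 3 * a
many-successes a f refl le = +-cancelʳ-≤ (3 * f) _ _ (begin
  2 * (a + f) + 3 * f        ≤⟨ +-monoʳ-≤ (2 * (a + f)) le ⟩
  2 * (a + f) + (a + f)      ≡⟨ collect a f ⟩
  3 * a + 3 * f              ∎)
  where
  open ≤-Reasoning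
  collect : ∀ a f → 2 * (a + f) + (a + f) ≡ 3 * a + 3 * f
  collect = ℕ-Ring.solve-∀

AM2⇒AM1 : ∀ Lang → AM 2 Lang → AM 1 Lang
AM2⇒AM1 Lang (q , m , V , p , _ , spec) = reduce (repeated V p q kP lP m uP lqP)
  where
  at : ∀ P → IsPolynomial (eval P)
  at P = poly-eval P poly-id

  poly-k : IsPolynomial (λ n → kSize (eval q n))
  poly-k = poly-* (poly-const samples) (poly-+ (poly-* (poly-+ (at q) (at q)) (poly-* (poly-const samples) (poly-+ (at q) (poly-const 7)))) (poly-const 7))

  poly-l : IsPolynomial (λ n → lSize (eval q n))
  poly-l = poly-* (poly-const samples) (poly-+ (poly-* (at q) poly-k) (poly-const 7))

  poly-u : IsPolynomial (λ _ → uSize)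
  poly-u = poly-const uSize

  poly-lq : IsPolynomial (λ n → lSize (eval q n) * eval q n)
  poly-lq = poly-* poly-l (at q)

  poly-challenge : IsPolynomial (λ n → lSize (eval q n) * eval q n + kSize (eval q n) * eval q n)
  poly-challenge = poly-+ poly-lq (poly-* poly-k (at q))

  poly-coins : IsPolynomial (λ n → uSize * eval m n)
  poly-coins = poly-* poly-u (at m)

  kP lP uP lqP q'P m'P : Poly
  kP = proj₁ poly-k
  lP = proj₁ poly-l
  uP = proj₁ poly-u
  lqP = proj₁ poly-lq
  q'P = proj₁ poly-challenge
  m'P = proj₁ poly-coins

  reduce : PolyTimeOn fields (repeatedly V p q kP lP m uP lqP) → AM 1 Lang
  reduce (M' , P' , runs , meaning) = q'P , m'P , M' , P' , runs , λ x → complete x , sound x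
    where
    module _ (x : List Bool) where

      n Q M q' m' : ℕ
      n = length x
      Q = eval q n
      M = eval m n
      q' = eval q'P n
      m' = eval m'P n

      open Repetition V p x Q M

      q'≡ : q' ≡ l * Q + k * Q
      q'≡ = sym (proj₂ poly-challenge n)

      m'≡ : m' ≡ u * M
      m'≡ = sym (proj₂ poly-coins n)

      total-1 : total 1 q'P m'P x ≡ allQ ^ k * (allQ ^ l * allM ^ u)
      total-1 = begin
        2 ^ (1 * q' + m')                               ≡⟨ cong₂ (λ a b → 2 ^ (1 * a + b)) q'≡ m'≡ ⟩
        2 ^ (1 * (l * Q + k * Q) + u * M)               ≡⟨ cong (2 ^_) (shape l k u Q M) ⟩
        2 ^ (Q * k + (Q * l + M * u))                   ≡⟨ trans (^-distribˡ-+-* 2 (Q * k) _) (cong (2 ^ (Q * k) *_) (^-distribˡ-+-* 2 (Q * l) (M * u))) ⟩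
        2 ^ (Q * k) * (2 ^ (Q * l) * 2 ^ (M * u))       ≡⟨ cong₂ _*_ (powers Q k) (cong₂ _*_ (powers Q l) (powers M u)) ⟩
        allQ ^ k * (allQ ^ l * allM ^ u)                ∎
        where
        open ≡-Reasoning
        shape : ∀ l k u a b → 1 * (l * a + k * a) + u * b ≡ a * k + (a * l + b * u)
        shape = ℕ-Ring.solve-∀
        powers : ∀ a j → 2 ^ (a * j) ≡ length (bits a) ^ j
        powers a j = trans (sym (^-*-assoc 2 a j)) (cong (_^ j) (sym (length-bits a)))

      total-2 : total 2 q m x ≡ allQ * (allQ * allM)
      total-2 = begin
        2 ^ (2 * Q + M)           ≡⟨ cong (2 ^_) (shape Q M) ⟩
        2 ^ (Q + (Q + M))         ≡⟨ trans (^-distribˡ-+-* 2 Q (Q + M)) (cong (2 ^ Q *_) (^-distribˡ-+-* 2 Q M)) ⟩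
        2 ^ Q * (2 ^ Q * 2 ^ M)   ≡⟨ sym (cong₂ _*_ (length-bits Q) (cong₂ _*_ (length-bits Q) (length-bits M))) ⟩
        allQ * (allQ * allM)      ∎
        where
        open ≡-Reasoning
        shape : ∀ a b → 2 * a + b ≡ a + (a + b)
        shape = ℕ-Ring.solve-∀

      accepted-2 : ∀ (b : Provers 2 Q) (β₁ β₂ : List Bool → List Bool) →
        (∀ v → toBits (b zero v) ≡ β₁ (toBits v)) → (∀ v → toBits (b (suc zero) v) ≡ β₂ (toBits v)) →
        accCount 2 V p q m x b ≡ ∑[ s ∈ bits Q ] ∑[ t ∈ bits Q ] ∑[ r ∈ bits M ] 𝟙 (trial V p x s t (β₁ s) (β₂ t) r)
      accepted-2 b β₁ β₂ e₁ e₂ = begin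
        accCount 2 V p q m x b
          ≡⟨ accCount-2 V p q m x b ⟩
        (∑[ y₁ ∈ allVecs Q ] ∑[ y₂ ∈ allVecs Q ] ∑[ r ∈ allVecs M ] 𝟙 (trial V p x (toBits y₁) (toBits y₂) (toBits (b zero y₁)) (toBits (b (suc zero) y₂)) (toBits r)))
          ≡⟨ ∑-cong (allVecs Q) (λ y₁ → ∑-cong (allVecs Q) (λ y₂ → ∑-cong (allVecs M) (λ r →
               cong₂ (λ a c → 𝟙 (trial V p x (toBits y₁) (toBits y₂) a c (toBits r))) (e₁ y₁) (e₂ y₂)))) ⟩
        (∑[ y₁ ∈ allVecs Q ] ∑[ y₂ ∈ allVecs Q ] ∑[ r ∈ allVecs M ] G (toBits y₁) (toBits y₂) (toBits r))
          ≡⟨ ∑-cong (allVecs Q) (λ y₁ → trans (∑-cong (allVecs Q) (λ y₂ → ∑-allVecs M (G (toBits y₁) (toBits y₂))))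
               (∑-allVecs Q (λ t → ∑ (bits M) (G (toBits y₁) t)))) ⟩
        (∑[ y₁ ∈ allVecs Q ] ∑[ t ∈ bits Q ] ∑[ r ∈ bits M ] G (toBits y₁) t r)
          ≡⟨ ∑-allVecs Q (λ s → ∑[ t ∈ bits Q ] ∑[ r ∈ bits M ] G s t r) ⟩
        (∑[ s ∈ bits Q ] ∑[ t ∈ bits Q ] ∑[ r ∈ bits M ] G s t r) ∎
        where
        open ≡-Reasoning
        G : List Bool → List Bool → List Bool → ℕ
        G s t r = 𝟙 (trial V p x s t (β₁ s) (β₂ t) r)

      reply : Provers 1 q' → List Bool → List Bool
      reply b Y = toBits (b zero (vecOf q' Y))

      outcome : Provers 1 q' → List (List Bool) → List (List Bool) → List (List Bool) → Bool
      outcome b U W C = majority (ballot U W C (reply b (concat W ++ concat U)))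

      accepted-1 : ∀ b → accCount 1 M' P' q'P m'P x b ≡
        ∑[ U ∈ tuples (bits Q) k ] ∑[ W ∈ tuples (bits Q) l ] ∑[ C ∈ tuples (bits M) u ] 𝟙 (outcome b U W C)
      accepted-1 b = begin
        accCount 1 M' P' q'P m'P x b
          ≡⟨ accCount-1 M' P' q'P m'P x b ⟩
        (∑[ y ∈ allVecs q' ] ∑[ r ∈ allVecs m' ] 𝟙 (acceptsWithin M' P' (fields (exam x (toBits y) (toBits (b zero y)) (toBits r)))))
          ≡⟨ ∑-cong (allVecs q') (λ y → ∑-cong (allVecs m') (λ r → cong 𝟙 (verdict y r))) ⟩
        (∑[ y ∈ allVecs q' ] ∑[ r ∈ allVecs m' ] G (toBits y) (toBits r))
          ≡⟨ ∑-blocks q'≡ m'≡ G ⟩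
        (∑[ U ∈ tuples (bits Q) k ] ∑[ W ∈ tuples (bits Q) l ] ∑[ C ∈ tuples (bits M) u ] 𝟙 (outcome b U W C)) ∎
        where
        open ≡-Reasoning
        G : List Bool → List Bool → ℕ
        G Y c = 𝟙 (majority (trials V p Q k l M u (l * Q) x Y (reply b Y) c))
        parameters : ∀ Y B c → repeatedly V p q kP lP m uP lqP (exam x Y B c) ≡ majority (trials V p Q k l M u (l * Q) x Y B c)
        parameters Y B c = trans
          (cong₂ (λ k l → majority (trials V p Q k l M (eval uP n) (eval lqP n) x Y B c)) (sym (proj₂ poly-k n)) (sym (proj₂ poly-l n)))
          (cong₂ (λ u lq → majority (trials V p Q k l M u lq x Y B c)) (sym (proj₂ poly-u n)) (sym (proj₂ poly-lq n)))
        verdict : ∀ y r → acceptsWithin M' P' (fields (exam x (toBits y) (toBits (b zero y)) (toBits r))) ≡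
                  majority (trials V p Q k l M u (l * Q) x (toBits y) (reply b (toBits y)) (toBits r))
        verdict y r = trans (meaning (exam x (toBits y) (toBits (b zero y)) (toBits r)))
          (trans (parameters (toBits y) (toBits (b zero y)) (toBits r))
            (cong (λ v → majority (trials V p Q k l M u (l * Q) x (toBits y) (toBits (b zero v)) (toBits r))) (sym (vecOf-toList y))))

      sound : ¬ Lang x → ∀ (b : Provers 1 q') → 3 * accCount 1 M' P' q'P m'P x b ≤ total 1 q'P m'P x
      sound x∉ b = subst₂ (λ a t → 3 * a ≤ t) (sym (accepted-1 b)) (sym total-1)
        (soundness bounded (λ U W → reply b (concat W ++ concat U)) (λ U W → trans (Vecₚ.length-toList (b zero (vecOf q' (concat W ++ concat U)))) q'≡))
        where
        bounded : ∀ (β₁ β₂ : List Bool → List Bool) → (∀ y → β₁ y ∈ bits Q) → (∀ y → β₂ y ∈ bits Q) →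
          3 * (∑[ s ∈ bits Q ] ∑[ t ∈ bits Q ] ∑[ r ∈ bits M ] 𝟙 (trial V p x s t (β₁ s) (β₂ t) r)) ≤ allQ * (allQ * allM)
        bounded β₁ β₂ β₁∈ β₂∈ = subst₂ (λ a t → 3 * a ≤ t)
          (accepted-2 provers β₁ β₂ (λ v → toList-vecOf _ (∈-bits⁻ (β₁∈ (toBits v)))) (λ v → toList-vecOf _ (∈-bits⁻ (β₂∈ (toBits v)))))
          total-2 (proj₂ (spec x) x∉ provers)
          where
          provers : Provers 2 Q
          provers zero    v = vecOf Q (β₁ (toBits v))
          provers (suc _) v = vecOf Q (β₂ (toBits v))

      complete : Lang x → Σ (Provers 1 q') λ b → 2 * total 1 q'P m'P x ≤ 3 * accCount 1 M' P' q'P m'P x b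
      complete x∈ = prover , subst₂ (λ t a → 2 * t ≤ 3 * a) (sym total-1) (sym (accepted-1 prover))
        (many-successes accepting rejecting partition (subst (λ f → 3 * f ≤ allQ ^ k * (allQ ^ l * allM ^ u)) (sym same) (completeness β₁ β₂ legal₁ legal₂ few)))
        where
        b : Provers 2 Q
        b = proj₁ (proj₁ (spec x) x∈)
        β₁ β₂ : List Bool → List Bool
        β₁ s = toBits (b zero (vecOf Q s))
        β₂ t = toBits (b (suc zero) (vecOf Q t))
        legal₁ : ∀ y → length (β₁ y) ≡ Q
        legal₁ y = Vecₚ.length-toList (b zero (vecOf Q y))
        legal₂ : ∀ y → length (β₂ y) ≡ Q
        legal₂ y = Vecₚ.length-toList (b (suc zero) (vecOf Q y))
        few : 3 * (∑[ s ∈ bits Q ] ∑[ t ∈ bits Q ] ∑[ r ∈ bits M ] 𝟙 (not (trial V p x s t (β₁ s) (β₂ t) r))) ≤ allQ * (allQ * allM)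
        few = few-failures
          (∑[ s ∈ bits Q ] ∑[ t ∈ bits Q ] ∑[ r ∈ bits M ] 𝟙 (trial V p x s t (β₁ s) (β₂ t) r))
          (∑[ s ∈ bits Q ] ∑[ t ∈ bits Q ] ∑[ r ∈ bits M ] 𝟙 (not (trial V p x s t (β₁ s) (β₂ t) r)))
          (∑³-complement (bits Q) (bits Q) (bits M) (λ s t r → trial V p x s t (β₁ s) (β₂ t) r))
          (subst₂ (λ t a → 2 * t ≤ 3 * a) total-2
            (accepted-2 b β₁ β₂ (λ v → cong (toBits ∘ b zero) (sym (vecOf-toList v))) (λ v → cong (toBits ∘ b (suc zero)) (sym (vecOf-toList v))))
            (proj₂ (proj₁ (spec x) x∈)))
        answer : List Bool → List Bool
        answer = honest β₁ β₂ legal₁ legal₂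
        prover : Provers 1 q'
        prover _ y = vecOf q' (answer (toBits y))
        accepting rejecting : ℕ
        accepting = ∑[ U ∈ tuples (bits Q) k ] ∑[ W ∈ tuples (bits Q) l ] ∑[ C ∈ tuples (bits M) u ] 𝟙 (outcome prover U W C)
        rejecting = ∑[ U ∈ tuples (bits Q) k ] ∑[ W ∈ tuples (bits Q) l ] ∑[ C ∈ tuples (bits M) u ] 𝟙 (not (outcome prover U W C))
        partition : accepting + rejecting ≡ allQ ^ k * (allQ ^ l * allM ^ u)
        partition = trans (∑³-complement (tuples (bits Q) k) (tuples (bits Q) l) (tuples (bits M) u) (outcome prover))
          (cong₂ _*_ (length-tuples (bits Q) k) (cong₂ _*_ (length-tuples (bits Q) l) (length-tuples (bits M) u)))
        -- The prover receives and sends vectors. On concatenated blocks both passages through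
        -- `vecOf` are exact, because the challenge and the honest answer have length `q'`.
        truthful : ∀ {U W} → U ∈ tuples (bits Q) k → W ∈ tuples (bits Q) l →
                   reply prover (concat W ++ concat U) ≡ answer (concat W ++ concat U)
        truthful {U} {W} U∈ W∈ = trans (toList-vecOf _ (trans (length-honest β₁ β₂ legal₁ legal₂ _) (sym q'≡)))
          (cong answer (toList-vecOf (concat W ++ concat U) (trans (trans (Listₚ.length-++ (concat W))
            (cong₂ _+_ (length-blocks Q l W∈) (length-blocks Q k U∈))) (sym q'≡))))
        same : rejecting ≡
               (∑[ U ∈ tuples (bits Q) k ] ∑[ W ∈ tuples (bits Q) l ] ∑[ C ∈ tuples (bits M) u ]
                 𝟙 (not (majority (ballot U W C (answer (concat W ++ concat U))))))
        same = ∑-cong-∈ (tuples (bits Q) k) λ {U} U∈ → ∑-cong-∈ (tuples (bits Q) l) λ {W} W∈ → ∑-cong (tuples (bits M) u) λ C →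
          cong (λ B → 𝟙 (not (majority (ballot U W C B)))) (truthful U∈ W∈)

theorem47 : (Lang : List Bool → Set) → (AM 2 Lang → AM 1 Lang) × (AM 1 Lang → AM 2 Lang)
theorem47 Lang = AM2⇒AM1 Lang , AM1⇒AM2 Lang
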